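{- Let $G$ be a planar PCC graph. Then every face $\sigma$ of $G$ satisfies $|\sigma|\le 41$.
   Context: All graphs are finite, simple, connected, and 2-cell embedded in the sphere; the set of faces includes the outer face. For a face $\sigma$, its size $|\sigma|$ is the number of edges in its boundary walk, counted with multiplicity. For a vertex $v$, $F(v)$ is the multiset of faces incident to $v$ (one entry per corner), $K(v)=1-\frac{\deg(v)}{2}+\sum_{\sigma\in F(v)}\frac{1}{|\sigma|}$ is its combinatorial curvature, and the face vector $f(v)$ is the multiset of sizes of faces in $F(v)$. A prism of order $N$: $2N$ vertices, two faces of size $N$, $N$ faces of size $4$, $f(v)=\{4,4,N\}$ for all $v$. An antiprism of order $N$: $2N$ vertices, two faces of size $N$, $2N$ faces of size $3$, $f(v)=\{3,3,3,N\}$ for all $v$. A planar PCC graph is such a graph with $K(v)>0$ and $\deg(v)\ge3$ for every vertex $v$, which is not a prism or an antiprism. -}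

module Defs where

open import Data.Bool using (Bool; true; false)
open import Data.Nat as ℕ using (ℕ; zero; suc; _<ᵇ_)
open import Data.Fin using (Fin; toℕ)
open import Data.Fin.Properties using (_≟_)
open import Data.List using (List; []; _∷_; map; upTo; filterᵇ; length; replicate; foldr; allFin; drop)
open import Data.List.Relation.Binary.Permutation.Propositional using (_↭_)
open import Data.Integer using (+_)
open import Data.Rational using (ℚ; 0ℚ; 1ℚ; _/_; _+_; _-_)
open import Data.Product using (Σ; _×_; ∃)
open import Relation.Nullary using (¬_; yes; no)
open import Relation.Binary.PropositionalEquality using (_≡_; _≢_)
open import Function.Definitions using (Injective)

allᵇ : ∀ {A : Set} → (A → Bool) → List A → Bool
allᵇ p [] = true
allᵇ p (x ∷ xs) with p x
... | true = allᵇ p xs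
... | false = false

iter : ∀ {n} → (Fin n → Fin n) → ℕ → Fin n → Fin n
iter f zero d = d
iter f (suc k) d = f (iter f k d)

-- Orbit length of d under f: the least k ∈ {1,…,n} with f^k d = d.
-- (For a permutation of Fin n such a k always exists; the fallback n is never used.)
period : ∀ {n} → (Fin n → Fin n) → Fin n → ℕ
period {n} f d = search n 1
  where
  search : ℕ → ℕ → ℕ
  search zero k = n
  search (suc fuel) k with iter f k d ≟ d
  ... | yes _ = k
  ... | no  _ = search fuel (suc k)

orbit : ∀ {n} → (Fin n → Fin n) → Fin n → List (Fin n)
orbit f d = map (λ k → iter f k d) (upTo (period f d))

InOrbit : ∀ {n} → (Fin n → Fin n) → Fin n → Fin n → Set
InOrbit f d e = ∃ λ k → iter f k d ≡ e

isRep : ∀ {n} → (Fin n → Fin n) → Fin n → Bool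
isRep f d = allᵇ (λ e → toℕ d <ᵇ toℕ e) (drop 1 (orbit f d))

reps : ∀ {n} → (Fin n → Fin n) → List (Fin n)
reps {n} f = filterᵇ (isRep f) (allFin n)

numOrbits : ∀ {n} → (Fin n → Fin n) → ℕ
numOrbits f = length (reps f)

-- A combinatorial map (rotation system) on the dart set Fin n:
-- σ = rotation of darts around their vertex (a permutation),
-- α = the other half of the edge (fixed-point-free involution).
-- Vertices = σ-orbits, edges = α-orbits, faces = φ-orbits with φ = σ ∘ α.
record CombMap (n : ℕ) : Set where
  field
    σ     : Fin n → Fin n
    α     : Fin n → Fin n
    σ-inj : Injective _≡_ _≡_ σ
    α-inv : ∀ d → α (α d) ≡ d
    α-fpf : ∀ d → α d ≢ d

  φ : Fin n → Fin n
  φ d = σ (α d)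

  deg : Fin n → ℕ
  deg = period σ

  -- size of the face containing the corner represented by dart d
  -- (length of the boundary walk, edges counted with multiplicity)
  faceSize : Fin n → ℕ
  faceSize = period φ

  numV numE numF : ℕ
  numV = numOrbits σ
  numE = ℕ._/_ n 2
  numF = numOrbits φ

  faceVector : Fin n → List ℕ
  faceVector d = map faceSize (orbit σ d)

  faceSizes : List ℕ
  faceSizes = map faceSize (reps φ)

  data Reach : Fin n → Fin n → Set where
    here : ∀ {d} → Reach d d
    byσ  : ∀ {d e} → Reach d e → Reach d (σ e)
    byα  : ∀ {d e} → Reach d e → Reach d (α e)

  Connected : Set
  Connected = ∀ d e → Reach d e

  -- embedded in the sphere: V − E + F = 2, i.e. 2V + 2F = (#darts) + 4
  Spherical : Set
  Spherical = 2 ℕ.* numV ℕ.+ 2 ℕ.* numF ≡ n ℕ.+ 4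

  Simple : Set
  Simple = (∀ d → ¬ InOrbit σ d (α d))
         × (∀ d e → InOrbit σ d e → InOrbit σ (α d) (α e) → d ≡ e)

  recip : ℕ → ℚ
  recip zero = 0ℚ
  recip (suc k) = + 1 / suc k

  curvature : Fin n → ℚ
  curvature d = (1ℚ - (+ deg d / 2)) + foldr (λ s acc → recip s + acc) 0ℚ (faceVector d)

  IsPrism : ℕ → Set
  IsPrism N = numV ≡ 2 ℕ.* N
            × faceSizes ↭ (N ∷ N ∷ replicate N 4)
            × (∀ d → faceVector d ↭ (4 ∷ 4 ∷ N ∷ []))

  IsAntiprism : ℕ → Set
  IsAntiprism N = numV ≡ 2 ℕ.* N
                × faceSizes ↭ (N ∷ N ∷ replicate (2 ℕ.* N) 3)
                × (∀ d → faceVector d ↭ (3 ∷ 3 ∷ 3 ∷ N ∷ []))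

  IsPlanarPCC : Set
  IsPlanarPCC = Connected × Spherical × Simple
              × (∀ d → 3 ℕ.≤ deg d)
              × (∀ d → 0ℚ Data.Rational.< curvature d)
              × (¬ ∃ IsPrism) × (¬ ∃ IsAntiprism)

-- Suppose that some face has N ≥ 42 edges. Positivity of the curvature leaves few possibilities for
-- the other faces at a vertex of it: sizes 3,3 up to 3,6 or 4,4 in degree 3, and 3,3,3 in degree 4. So
-- its vertices lie on no other face of size at least 42, are distinct, and have curvature at least 1/N
-- each; together they carry at least 1 of the total curvature 2. If there are two such faces, all these
-- estimates are equalities: every vertex lies on one of the two faces, the sizes 3,6 cannot occur, and
-- the graph is a prism or an antiprism. If there is only one, the other faces have at most 41 edges, and
-- curvature can be moved along the edges that leave the large face so that each of its vertices gains
-- 1/41 while no other vertex becomes negative; the total would then be at least 1 + N/41 > 2.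
-- The local claims concern finitely many configurations and are verified by evaluation, for which all
-- reciprocals are scaled to natural numbers.
module Submission where

open import Defs
open import Data.Nat using (ℕ; _≤_)
open import Data.Fin using (Fin)
import Data.Nat as ℕ
open import Data.Nat hiding (_≟_)
open import Data.Nat.Properties hiding (_≟_)
open import Data.Nat.DivMod using (_/_; _%_; m≡m%n+[m/n]*n; m%n<n; m*[n/m]≡n)
open import Data.Nat.Divisibility using (_∣_; m≤n⇒m!∣n!; ∣-trans; m∣m*n; ∣n⇒∣m*n)
open import Data.Nat.Induction using (<-wellFounded)
open import Data.Nat.ListAction using (sum)
open import Data.Nat.ListAction.Properties using (sum-++; sum-↭)
open import Data.Nat.Solver using (module +-*-Solver)
open +-*-Solver using (solve; _:+_; _:*_; _:=_; con)
open import Induction.WellFounded using (Acc; acc)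
open import Data.Bool using (Bool; true; false; T; _∧_; _∨_; not; if_then_else_)
open import Data.Maybe using (Maybe; just; nothing; is-just)
open import Data.Fin using (toℕ; fromℕ<)
open import Data.Fin.Properties using (_≟_; toℕ<n; toℕ-injective; fromℕ<-injective; injective⇒≤; pigeonhole)
import Data.Fin.Properties as Fin
open import Data.List using (List; []; _∷_; map; upTo; applyUpTo; allFin; drop; concat; length; filter; foldr; replicate)
open import Data.List.Properties using (map-upTo; map-++; map-∘; length-map; length-upTo; length-tabulate)
open import Data.List.Membership.Propositional using (_∈_; find)
open import Data.List.Membership.Propositional.Properties
open import Data.List.Membership.Propositional.Properties.WithK using (unique∧set⇒bag)
open import Data.List.Relation.Unary.Any as Any using (here; there; any?)
open import Data.List.Relation.Unary.All as All using (All; []; _∷_)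
import Data.List.Relation.Unary.All.Properties as All
open import Data.List.Relation.Unary.AllPairs using (AllPairs; []; _∷_)
import Data.List.Relation.Unary.AllPairs.Properties as AllPairs
open import Data.List.Relation.Unary.Unique.Propositional using (Unique)
import Data.List.Relation.Unary.Unique.Propositional.Properties as Unique
open import Data.List.Relation.Binary.Pointwise using (Pointwise; []; _∷_; Pointwise-length)
open import Data.List.Relation.Binary.Disjoint.Propositional using (Disjoint)
open import Data.List.Relation.Binary.Permutation.Propositional using (_↭_; ↭-trans; ↭-reflexive)
import Data.List.Relation.Binary.Permutation.Propositional.Properties as ↭
open import Data.List.Relation.Binary.BagAndSetEquality using (∼bag⇒↭)
open import Data.Product using (∃; _×_; _,_; proj₁; proj₂)
open import Data.Sum as Sum using (_⊎_; inj₁; inj₂; [_,_]′)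
open import Data.Empty using (⊥; ⊥-elim)
open import Relation.Nullary using (¬_; Dec; yes; no; ¬?; does)
open import Relation.Nullary.Decidable using (T?; map′; dec-true; dec-false; decidable-stable; _×-dec_)
open import Relation.Binary.PropositionalEquality
open import Relation.Binary.Definitions using (tri<; tri≈; tri>)
open import Function using (_∘_; id; mk⇔)
open import Function.Definitions using (Injective)

-- Finiteness comes from capping: sizes above 42 are read as 42, which only raises the curvature,
-- and the sizes found next to a large face are at most 6, hence unaffected by the cap. The first
-- obstacle is that an edge leaving the large face might return to it, so that a vertex in want
-- would be served by another one in want. The faces beside such a chord are so small that they
-- force a shorter chord, which ends in a loop or a double edge. The second obstacle is a vertex
-- with corners 5, 6, 3, 3. Its curvature is 1/30, but it may be asked for 1/41 + 1/82, which is
-- 2/615 too much. It fetches 1/210 along the edge between pentagon and hexagon. The other end can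
-- spare this: at corners 5, 6, 7, for instance, the curvature is 1/105. A topological argument
-- shows that the two ends of such an edge are never both in want of it. Transfers are attached to
-- darts: what one dart of an edge receives, its partner sends, so summing over all darts and
-- reindexing by `α` cancels them. Inequalities are kept free of subtraction by placing outflow on
-- one side and inflow on the other.

-- Orbits of permutations

-- The worker of `period` has no name; unification recovers it as the solution of this hole.
mutual
  search : ∀ {n} → (Fin n → Fin n) → Fin n → ℕ → ℕ → ℕ
  search f d fuel k = _

  period-step : ∀ m (f : Fin (suc m) → Fin (suc m)) d → f d ≢ d → period f d ≡ search f d m 2
  period-step m f d fd≢d with f d ≟ d
  ... | yes fd≡d with () ← fd≢d fd≡d
  ... | no _ with suc m | 2
  ...   | _ | _ = refl

-- A known return time `p` inside the window `k ≤ p < k + fuel` keeps the search from exhausting its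
-- fuel, so the fallback value never appears.
search-least : ∀ {n} (f : Fin n → Fin n) d fuel k p → k ≤ p → p < k + fuel → iter f p d ≡ d →
  let s = search f d fuel k in
  iter f s d ≡ d × k ≤ s × s ≤ p × (∀ j → k ≤ j → j < s → iter f j d ≢ d)
search-least f d zero k p k≤p p<k _ rewrite +-identityʳ k = ⊥-elim (<⇒≱ p<k k≤p)
search-least f d (suc fuel) k p k≤p p<k+w cyc with iter f k d ≟ d
... | yes e = e , ≤-refl , k≤p , λ j k≤j j<k → ⊥-elim (<⇒≱ j<k k≤j)
... | no ne with search-least f d fuel (suc k) p k<p (subst (p <_) (+-suc k fuel) p<k+w) cyc
  where
  k<p : k < p
  k<p = ≤∧≢⇒< k≤p λ k≡p → ne (subst (λ x → iter f x d ≡ d) (sym k≡p) cyc)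
...   | c , k<s , s≤p , least = c , <⇒≤ k<s , s≤p , least′
  where
  least′ : ∀ j → k ≤ j → j < search f d fuel (suc k) → iter f j d ≢ d
  least′ j k≤j j<s with k ℕ.≟ j
  ... | yes refl = ne
  ... | no k≢j = least j (≤∧≢⇒< k≤j k≢j) j<s

iter-+ : ∀ {n} (f : Fin n → Fin n) a b d → iter f (a + b) d ≡ iter f a (iter f b d)
iter-+ f zero b d = refl
iter-+ f (suc a) b d = cong f (iter-+ f a b d)

allᵇ-sound : ∀ {A : Set} (p : A → Bool) xs → allᵇ p xs ≡ true → ∀ {x} → x ∈ xs → p x ≡ true
allᵇ-sound p (x ∷ xs) eq m with p x in px
allᵇ-sound p (x ∷ xs) eq (here refl) | true = px
allᵇ-sound p (x ∷ xs) eq (there m) | true = allᵇ-sound p xs eq m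

allᵇ-false : ∀ {A : Set} (p : A → Bool) xs → allᵇ p xs ≡ false → ∃ λ x → x ∈ xs × p x ≡ false
allᵇ-false p (x ∷ xs) eq with p x in px
... | false = x , here refl , px
... | true with allᵇ-false p xs eq
...   | y , m , py = y , there m , py

unique⇒allPairs : ∀ {A : Set} {P : A → Set} {R : A → A → Set} →
  (∀ {x y} → P x → P y → x ≢ y → R x y) → ∀ {xs} → All P xs → Unique xs → AllPairs R xs
unique⇒allPairs h [] [] = []
unique⇒allPairs h (p ∷ ps) (x∉ ∷ u) =
  All.zipWith (λ { (q , ne) → h p q ne }) (ps , x∉) ∷ unique⇒allPairs h ps u

-- Finite sums over lists

∑ : ∀ {A : Set} → List A → (A → ℕ) → ℕ
∑ xs g = sum (map g xs)

∑-concat : ∀ {A : Set} (g : A → ℕ) xss → ∑ (concat xss) g ≡ ∑ xss (λ xs → ∑ xs g)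
∑-concat g [] = refl
∑-concat g (xs ∷ xss) = trans (cong sum (map-++ g xs (concat xss)))
  (trans (sum-++ (map g xs) (map g (concat xss))) (cong (∑ xs g +_) (∑-concat g xss)))

∑-cong : ∀ {A : Set} (xs : List A) {g h : A → ℕ} → (∀ {x} → x ∈ xs → g x ≡ h x) → ∑ xs g ≡ ∑ xs h
∑-cong [] eq = refl
∑-cong (x ∷ xs) eq = cong₂ _+_ (eq (here refl)) (∑-cong xs (eq ∘ there))

∑-mono : ∀ {A : Set} (xs : List A) {g h : A → ℕ} → (∀ {x} → x ∈ xs → g x ≤ h x) → ∑ xs g ≤ ∑ xs h
∑-mono [] le = z≤n
∑-mono (x ∷ xs) le = +-mono-≤ (le (here refl)) (∑-mono xs (le ∘ there))

∑-mono-< : ∀ {A : Set} (xs : List A) {g h : A → ℕ} → (∀ {x} → x ∈ xs → g x ≤ h x) →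
  ∀ {y} → y ∈ xs → g y < h y → ∑ xs g < ∑ xs h
∑-mono-< (x ∷ xs) le (here refl) lt = +-mono-<-≤ lt (∑-mono xs (le ∘ there))
∑-mono-< (x ∷ xs) le (there m) lt = +-mono-≤-< (le (here refl)) (∑-mono-< xs (le ∘ there) m lt)

∑-const : ∀ {A : Set} (xs : List A) c → ∑ xs (λ _ → c) ≡ length xs * c
∑-const [] c = refl
∑-const (x ∷ xs) c = cong (c +_) (∑-const xs c)

∑-+ : ∀ {A : Set} (xs : List A) (g h : A → ℕ) → ∑ xs (λ x → g x + h x) ≡ ∑ xs g + ∑ xs h
∑-+ [] g h = refl
∑-+ (x ∷ xs) g h rewrite ∑-+ xs g h = +-interchange (g x) (h x) (∑ xs g) (∑ xs h)
  where
  open import Algebra.Properties.CommutativeSemigroup +-commutativeSemigroup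
    renaming (interchange to +-interchange)

∑-* : ∀ {A : Set} (xs : List A) c (g : A → ℕ) → ∑ xs (λ x → c * g x) ≡ c * ∑ xs g
∑-* [] c g = sym (*-zeroʳ c)
∑-* (x ∷ xs) c g rewrite ∑-* xs c g = sym (*-distribˡ-+ c (g x) (∑ xs g))

-- Cycle structure of a permutation

module Perm {n} (f : Fin n → Fin n) (f-inj : Injective _≡_ _≡_ f) where

  iter-inj : ∀ k {d e} → iter f k d ≡ iter f k e → d ≡ e
  iter-inj zero eq = eq
  iter-inj (suc k) eq = iter-inj k (f-inj eq)

  iter-cancel : ∀ i j {d} → i ≤ j → iter f i d ≡ iter f j d → iter f (j ∸ i) d ≡ d
  iter-cancel i j {d} i≤j eq = sym (iter-inj i (trans eq
    (trans (cong (λ x → iter f x d) (sym (m+[n∸m]≡n i≤j))) (iter-+ f i (j ∸ i) d))))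

  -- Two of the n + 1 iterates with exponents 0, ..., n agree; cancelling the smaller exponent gives
  -- a return time of at most n, which the search must meet.
  period-spec : ∀ d → iter f (period f d) d ≡ d × 1 ≤ period f d × period f d ≤ n
    × (∀ j → 1 ≤ j → j < period f d → iter f j d ≢ d)
  period-spec d with pigeonhole (n<1+n n) (λ i → iter f (toℕ i) d)
  ... | i , j , i<j , eq with search-least f d n 1 (toℕ j ∸ toℕ i) (m<n⇒0<n∸m i<j)
          (s≤s (≤-trans (m∸n≤m (toℕ j) (toℕ i)) (s≤s⁻¹ (toℕ<n j))))
          (iter-cancel (toℕ i) (toℕ j) (<⇒≤ i<j) eq)
  ...   | c , 1≤ , ≤p , least =
          c , 1≤ , ≤-trans ≤p (≤-trans (m∸n≤m (toℕ j) (toℕ i)) (s≤s⁻¹ (toℕ<n j))) , least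

  iter-period : ∀ d → iter f (period f d) d ≡ d
  iter-period d = proj₁ (period-spec d)

  period-pos : ∀ d → 1 ≤ period f d
  period-pos d = proj₁ (proj₂ (period-spec d))

  period≤n : ∀ d → period f d ≤ n
  period≤n d = proj₁ (proj₂ (proj₂ (period-spec d)))

  period-least : ∀ d j → 1 ≤ j → iter f j d ≡ d → period f d ≤ j
  period-least d j 1≤j eq = ≮⇒≥ λ j<p → proj₂ (proj₂ (proj₂ (period-spec d))) j 1≤j j<p eq

  InOrbit-index : ∀ {d} i j → i < period f d → j < period f d → iter f i d ≡ iter f j d → i ≡ j
  InOrbit-index {d} i j i<p j<p eq with <-cmp i j
  ... | tri≈ _ i≡j _ = i≡j
  ... | tri< i<j _ _ = ⊥-elim (<⇒≱ j<p
      (≤-trans (period-least d (j ∸ i) (m<n⇒0<n∸m i<j) (iter-cancel i j (<⇒≤ i<j) eq)) (m∸n≤m j i)))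
  ... | tri> _ _ j<i = ⊥-elim (<⇒≱ i<p
      (≤-trans (period-least d (i ∸ j) (m<n⇒0<n∸m j<i) (iter-cancel j i (<⇒≤ j<i) (sym eq))) (m∸n≤m i j)))

  iter-*period : ∀ d q → iter f (q * period f d) d ≡ d
  iter-*period d zero = refl
  iter-*period d (suc q) = trans (iter-+ f (period f d) (q * period f d) d)
    (trans (cong (iter f (period f d)) (iter-*period d q)) (iter-period d))

  InOrbit< : ∀ {d e} → InOrbit f d e → ∃ λ k → k < period f d × iter f k d ≡ e
  InOrbit< {d} (k , eq) = k % p , m%n<n k p , trans (sym step) eq
    where
    p = period f d
    instance
      p≢0 : NonZero p
      p≢0 = >-nonZero (period-pos d)
    step : iter f k d ≡ iter f (k % p) d
    step = trans (cong (λ x → iter f x d) (m≡m%n+[m/n]*n k p))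
      (trans (iter-+ f (k % p) (k / p * p) d) (cong (iter f (k % p)) (iter-*period d (k / p))))

  InOrbit-trans : ∀ {d e x} → InOrbit f d e → InOrbit f e x → InOrbit f d x
  InOrbit-trans {d} (k , refl) (l , refl) = l + k , iter-+ f l k d

  InOrbit-sym : ∀ {d e} → InOrbit f d e → InOrbit f e d
  InOrbit-sym {d} o with InOrbit< o
  ... | k , k<p , refl = period f d ∸ k , trans (sym (iter-+ f (period f d ∸ k) k d))
    (trans (cong (λ x → iter f x d) (m∸n+n≡m (<⇒≤ k<p))) (iter-period d))

  orbit≡ : ∀ d → orbit f d ≡ applyUpTo (λ k → iter f k d) (period f d)
  orbit≡ d = map-upTo (λ k → iter f k d) (period f d)

  ∈-orbit⁺ : ∀ {d e} → InOrbit f d e → e ∈ orbit f d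
  ∈-orbit⁺ {d} o with InOrbit< o
  ... | k , k<p , refl rewrite orbit≡ d = ∈-applyUpTo⁺ (λ k → iter f k d) k<p

  ∈-orbit⁻ : ∀ {d e} → e ∈ orbit f d → InOrbit f d e
  ∈-orbit⁻ {d} m rewrite orbit≡ d with ∈-applyUpTo⁻ (λ k → iter f k d) m
  ... | k , _ , eq = k , sym eq

  length-orbit : ∀ d → length (orbit f d) ≡ period f d
  length-orbit d = trans (length-map (λ k → iter f k d) (upTo (period f d))) (length-upTo (period f d))

  orbit-unique : ∀ d → Unique (orbit f d)
  orbit-unique d rewrite orbit≡ d = Unique.applyUpTo⁺₁ _ (period f d) λ {i} {j} i<j j<p eq →
    <⇒≢ i<j (InOrbit-index i j (<-trans i<j j<p) j<p eq)

  period-orbit-≤ : ∀ {d e} → InOrbit f d e → period f e ≤ period f d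
  period-orbit-≤ {d} (k , refl) = period-least _ (period f d) (period-pos d)
    (trans (sym (iter-+ f (period f d) k d)) (trans (cong (λ x → iter f x d) (+-comm (period f d) k))
      (trans (iter-+ f k (period f d) d) (cong (iter f k) (iter-period d)))))

  period-orbit : ∀ {d e} → InOrbit f d e → period f e ≡ period f d
  period-orbit o = ≤-antisym (period-orbit-≤ o) (period-orbit-≤ (InOrbit-sym o))

  ∈-drop⁺ : ∀ {d e} → InOrbit f d e → e ≢ d → e ∈ drop 1 (orbit f d)
  ∈-drop⁺ {d} o ne with period f d | period-pos d | ∈-orbit⁺ o
  ... | suc p | _ | here eq = ⊥-elim (ne eq)
  ... | suc p | _ | there m = m

  ∈-drop⁻ : ∀ {d e} → e ∈ drop 1 (orbit f d) → InOrbit f d e × e ≢ d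
  ∈-drop⁻ {d} {e} m with period f d | period-pos d | orbit-unique d | (λ (m′ : e ∈ orbit f d) → ∈-orbit⁻ m′)
  ... | suc p | _ | x∉ ∷ _ | h = h (there m) , λ { refl → All.lookup x∉ m refl }

  isRep-sound : ∀ {d e} → isRep f d ≡ true → InOrbit f d e → e ≢ d → toℕ d < toℕ e
  isRep-sound {d} {e} r o ne = <ᵇ⇒< (toℕ d) (toℕ e)
    (subst T (sym (allᵇ-sound _ (drop 1 (orbit f d)) r (∈-drop⁺ o ne))) _)

  isRep-unique : ∀ {d e} → isRep f d ≡ true → isRep f e ≡ true → InOrbit f d e → d ≡ e
  isRep-unique {d} {e} rd re o with d ≟ e
  ... | yes eq = eq
  ... | no ne = ⊥-elim (<-asym (isRep-sound rd o (ne ∘ sym)) (isRep-sound re (InOrbit-sym o) ne))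

  -- Descent on the number of the dart: one that is not a representative has a smaller dart in its
  -- orbit.
  hasRep′ : ∀ e → Acc _<_ (toℕ e) → ∃ λ d → isRep f d ≡ true × InOrbit f d e
  hasRep′ e (acc rs) with isRep f e in eq
  ... | true = e , eq , 0 , refl
  ... | false with allᵇ-false _ (drop 1 (orbit f e)) eq
  ...   | x , m , x≮ with ∈-drop⁻ m
  ...     | o , ne with hasRep′ x (rs x<e)
    where
    x<e : toℕ x < toℕ e
    x<e = ≤∧≢⇒< (≮⇒≥ λ e<x → subst T x≮ (<⇒<ᵇ e<x)) (ne ∘ toℕ-injective)
  ...       | d , r , o′ = d , r , InOrbit-trans o′ (InOrbit-sym o)

  hasRep : ∀ e → ∃ λ d → isRep f d ≡ true × InOrbit f d e
  hasRep e = hasRep′ e (<-wellFounded (toℕ e))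

  ∈-reps⁺ : ∀ {d} → isRep f d ≡ true → d ∈ reps f
  ∈-reps⁺ {d} r = ∈-filter⁺ (T? ∘ isRep f) (∈-allFin d) (subst T (sym r) _)

  ∈-reps⁻ : ∀ {d} → d ∈ reps f → isRep f d ≡ true
  ∈-reps⁻ {d} m with isRep f d | proj₂ (∈-filter⁻ (T? ∘ isRep f) {xs = allFin n} m)
  ... | true | _ = refl

  reps-unique : Unique (reps f)
  reps-unique = Unique.filter⁺ (T? ∘ isRep f) (Unique.allFin⁺ n)

  InOrbit? : ∀ d e → Dec (InOrbit f d e)
  InOrbit? d e = map′ ∈-orbit⁻ ∈-orbit⁺ (any? (e ≟_) (orbit f d))

  -- The source of all double counting: a sum over darts may be grouped by vertices or by faces.
  partition : concat (map (orbit f) (reps f)) ↭ allFin n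
  partition = ∼bag⇒↭ (unique∧set⇒bag
    (Unique.concat⁺ (All.map⁺ (All.universal orbit-unique (reps f)))
      (AllPairs.map⁺ (unique⇒allPairs disjoint (All.tabulate ∈-reps⁻) reps-unique)))
    (Unique.allFin⁺ n)
    (λ {e} → mk⇔ (λ _ → ∈-allFin e) (λ _ → cover e)))
    where
    disjoint : ∀ {x y} → isRep f x ≡ true → isRep f y ≡ true → x ≢ y → Disjoint (orbit f x) (orbit f y)
    disjoint rx ry ne (mx , my) =
      ne (isRep-unique rx ry (InOrbit-trans (∈-orbit⁻ mx) (InOrbit-sym (∈-orbit⁻ my))))
    cover : ∀ e → e ∈ concat (map (orbit f) (reps f))
    cover e with hasRep e
    ... | d , r , o = ∈-concat⁺′ (∈-orbit⁺ o) (∈-map⁺ (orbit f) (∈-reps⁺ r))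

  ∑-orbits : (g : Fin n → ℕ) → ∑ (reps f) (λ r → ∑ (orbit f r) g) ≡ ∑ (allFin n) g
  ∑-orbits g = trans (cong sum (map-∘ (reps f)))
    (trans (sym (∑-concat g (map (orbit f) (reps f)))) (sum-↭ (↭.map⁺ g partition)))

  orbit-↭ : ∀ {d e} → InOrbit f d e → orbit f d ↭ orbit f e
  orbit-↭ o = ∼bag⇒↭ (unique∧set⇒bag (orbit-unique _) (orbit-unique _)
    (mk⇔ (λ m → ∈-orbit⁺ (InOrbit-trans (InOrbit-sym o) (∈-orbit⁻ m)))
         (λ m → ∈-orbit⁺ (InOrbit-trans o (∈-orbit⁻ m)))))

  ∑-orbit : ∀ {d e} → InOrbit f d e → (g : Fin n → ℕ) → ∑ (orbit f d) g ≡ ∑ (orbit f e) g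
  ∑-orbit o g = sum-↭ (↭.map⁺ g (orbit-↭ o))

  ∑-orbit-≤ : ∀ d (g : Fin n → ℕ) → ∑ (orbit f d) g ≤ ∑ (allFin n) g
  ∑-orbit-≤ d g = go (hasRep d)
    where
    member-≤ : ∀ {x : Fin n} xs (h : Fin n → ℕ) → x ∈ xs → h x ≤ ∑ xs h
    member-≤ (x ∷ xs) h (here refl) = m≤m+n (h x) (∑ xs h)
    member-≤ (y ∷ xs) h (there m) = ≤-trans (member-≤ xs h m) (m≤n+m (∑ xs h) (h y))
    go : (∃ λ r → isRep f r ≡ true × InOrbit f r d) → ∑ (orbit f d) g ≤ ∑ (allFin n) g
    go (r , isr , o) = subst₂ _≤_ (∑-orbit o g) (∑-orbits g)
      (member-≤ (reps f) (λ x → ∑ (orbit f x) g) (∈-reps⁺ isr))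

  surjective : ∀ y → ∃ λ x → f x ≡ y
  surjective y with period f y | iter-period y | period-pos y
  ... | suc p | eq | _ = iter f p y , eq

  -- For the edge involution this says that everything sent along edges is received.
  ∑-reindex : (g : Fin n → ℕ) → ∑ (allFin n) (g ∘ f) ≡ ∑ (allFin n) g
  ∑-reindex g = trans (cong sum (map-∘ (allFin n))) (sum-↭ (↭.map⁺ g (∼bag⇒↭ (unique∧set⇒bag
    (Unique.map⁺ f-inj (Unique.allFin⁺ n)) (Unique.allFin⁺ n)
    (λ {e} → mk⇔ (λ _ → ∈-allFin e) (λ _ → hit e))))))
    where
    hit : ∀ e → e ∈ map f (allFin n)
    hit e with surjective e
    ... | x , refl = ∈-map⁺ f (∈-allFin x)

  -- Each orbit of length p contributes p · (S / p) = S.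
  ∑-weights : ∀ S (w : ℕ → ℕ) → (∀ d → period f d * w (period f d) ≡ S) →
    ∑ (allFin n) (λ d → w (period f d)) ≡ numOrbits f * S
  ∑-weights S w pw = trans (sym (∑-orbits (λ d → w (period f d))))
    (trans (∑-cong (reps f) λ {r} _ → trans (∑-cong (orbit f r) λ {e} m → cong w (period-orbit (∈-orbit⁻ m)))
      (trans (∑-const (orbit f r) _) (trans (cong (_* w (period f r)) (length-orbit r)) (pw r))))
    (∑-const (reps f) S))

-- Curvature as an inequality between natural numbers

module Scaling where
  import Data.Integer as ℤ
  import Data.Integer.Properties as ℤₚ
  import Data.Rational as ℚ
  import Data.Rational.Properties as ℚₚ
  import Data.Rational.Unnormalised as ℚᵘ
  import Data.Rational.Unnormalised.Properties as ℚᵘₚ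
  open ℤ using (ℤ; +_)
  open ℚ using (ℚ; 0ℚ; 1ℚ)
  open ℚᵘ using (mkℚᵘ; _≃_; *≡*)

  -- Stated for unnormalised rationals, where products are numerator by numerator and no gcd
  -- intervenes.
  Scaled : ℕ → ℚ → ℤ → Set
  Scaled t q a = ℚ.toℚᵘ q ℚᵘ.* mkℚᵘ (+ t) 0 ≃ mkℚᵘ a 0

  scaled-+ : ∀ {t p q a b} → Scaled t p a → Scaled t q b → Scaled t (p ℚ.+ q) (a ℤ.+ b)
  scaled-+ {t} {p} {q} {a} {b} sp sq = begin
    ℚ.toℚᵘ (p ℚ.+ q) ℚᵘ.* t/1                       ≈⟨ ℚᵘₚ.*-congʳ {t/1} (ℚₚ.toℚᵘ-homo-+ p q) ⟩
    (ℚ.toℚᵘ p ℚᵘ.+ ℚ.toℚᵘ q) ℚᵘ.* t/1               ≈⟨ ℚᵘₚ.*-distribʳ-+ t/1 (ℚ.toℚᵘ p) (ℚ.toℚᵘ q) ⟩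
    ℚ.toℚᵘ p ℚᵘ.* t/1 ℚᵘ.+ ℚ.toℚᵘ q ℚᵘ.* t/1        ≈⟨ ℚᵘₚ.+-cong sp sq ⟩
    mkℚᵘ a 0 ℚᵘ.+ mkℚᵘ b 0
        ≡⟨ cong (λ x → mkℚᵘ x 0) (cong₂ ℤ._+_ (ℤₚ.*-identityʳ a) (ℤₚ.*-identityʳ b)) ⟩
    mkℚᵘ (a ℤ.+ b) 0 ∎
    where
    open import Relation.Binary.Reasoning.Setoid ℚᵘₚ.≃-setoid
    t/1 = mkℚᵘ (+ t) 0

  scaled-neg : ∀ {t p a} → Scaled t p a → Scaled t (ℚ.- p) (ℤ.- a)
  scaled-neg {t} {p} {a} sp = begin
    ℚ.toℚᵘ (ℚ.- p) ℚᵘ.* t/1      ≈⟨ ℚᵘₚ.*-congʳ {t/1} (ℚₚ.toℚᵘ-homo‿- p) ⟩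
    (ℚᵘ.- ℚ.toℚᵘ p) ℚᵘ.* t/1     ≈⟨ ℚᵘₚ.≃-sym (ℚᵘₚ.neg-distribˡ-* (ℚ.toℚᵘ p) t/1) ⟩
    ℚᵘ.- (ℚ.toℚᵘ p ℚᵘ.* t/1)     ≈⟨ ℚᵘₚ.-‿cong sp ⟩
    mkℚᵘ (ℤ.- a) 0 ∎
    where
    open import Relation.Binary.Reasoning.Setoid ℚᵘₚ.≃-setoid
    t/1 = mkℚᵘ (+ t) 0

  scaled-/ : ∀ t m k a → m * t ≡ a * suc k → Scaled t (+ m ℚ./ suc k) (+ a)
  scaled-/ t m k a eq = ℚᵘₚ.≃-trans (ℚᵘₚ.*-congʳ {mkℚᵘ (+ t) 0} (ℚₚ.toℚᵘ-fromℚᵘ (mkℚᵘ (+ m) k)))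
    (*≡* (begin
      + m ℤ.* + t ℤ.* ℤ.1ℤ    ≡⟨ ℤₚ.*-identityʳ (+ m ℤ.* + t) ⟩
      + m ℤ.* + t             ≡⟨ sym (ℤₚ.pos-* m t) ⟩
      + (m * t)               ≡⟨ cong +_ eq ⟩
      + (a * suc k)           ≡⟨ cong (λ x → + (a * x)) (sym (*-identityʳ (suc k))) ⟩
      + (a * (suc k * 1))     ≡⟨ ℤₚ.pos-* a (suc k * 1) ⟩
      + a ℤ.* + (suc k * 1)   ∎))
    where open ≡-Reasoning

  scaled-pos : ∀ {t q a} → 0 < t → Scaled t q a → 0ℚ ℚ.< q → ℤ.0ℤ ℤ.< a
  scaled-pos {suc t} {q} {a} _ sq 0<q with ℚᵘₚ.<-respʳ-≃ sq
      (ℚᵘₚ.<-respˡ-≃ (ℚᵘₚ.*-zeroˡ (mkℚᵘ (+ suc t) 0)) (ℚᵘₚ.*-monoˡ-<-pos (mkℚᵘ (+ suc t) 0)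
          (ℚₚ.toℚᵘ-mono-< 0<q)))
  ... | ℚᵘ.*<* lt = subst₂ ℤ._<_ refl (ℤₚ.*-identityʳ a) lt

  module _ {n} (M : CombMap n) (S : ℕ) (w : ℕ → ℕ) where
    open CombMap M

    scaled-recips : ∀ cs → (∀ {c} → c ∈ cs → 1 ≤ c × c * w c ≡ S) →
      Scaled (2 * S) (foldr (λ s acc → recip s ℚ.+ acc) 0ℚ cs) (+ ∑ cs (λ c → 2 * w c))
    scaled-recips [] h = ℚᵘₚ.*-zeroˡ (mkℚᵘ (+ (2 * S)) 0)
    scaled-recips (zero ∷ cs) h with () ← proj₁ (h (here refl))
    scaled-recips (suc c ∷ cs) h = scaled-+ {2 * S} {recip (suc c)}
      (scaled-/ (2 * S) 1 c (2 * w (suc c)) (begin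
        1 * (2 * S)               ≡⟨ *-identityˡ (2 * S) ⟩
        2 * S                     ≡⟨ cong (2 *_) (sym (proj₂ (h (here refl)))) ⟩
        2 * (suc c * w (suc c))   ≡⟨ cong (2 *_) (*-comm (suc c) (w (suc c))) ⟩
        2 * (w (suc c) * suc c)   ≡⟨ sym (*-assoc 2 (w (suc c)) (suc c)) ⟩
        2 * w (suc c) * suc c ∎))
      (scaled-recips cs (h ∘ there))
      where open ≡-Reasoning

    -- This is `0 < curvature d` times `2 * S`, with the degree term moved across: the 2 clears the
    -- half of the degree, `S` clears the reciprocals.
    curvature-pos : ∀ d → 0 < S → (∀ {c} → c ∈ faceVector d → 1 ≤ c × c * w c ≡ S) → 0ℚ ℚ.< curvature d →
      deg d * S < 2 * S + ∑ (faceVector d) (λ c → 2 * w c)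
    curvature-pos d 0<S h 0<K = ℤₚ.drop‿+<+ (subst₂ ℤ._<_ (ℤₚ.+-identityˡ y) x-y+y (ℤₚ.+-monoˡ-< y 0<a))
      where
      s = ∑ (faceVector d) (λ c → 2 * w c)
      y = + (deg d * S)
      a = (+ (2 * S) ℤ.+ ℤ.- y) ℤ.+ + s
      0<a : ℤ.0ℤ ℤ.< a
      0<a = scaled-pos {2 * S} {curvature d} (+-mono-< 0<S (+-mono-<-≤ 0<S z≤n))
        (scaled-+ {2 * S} {1ℚ ℚ.- (+ deg d ℚ./ 2)}
          (scaled-+ {2 * S} {1ℚ} {ℚ.- (+ deg d ℚ./ 2)} (ℚᵘₚ.*-identityˡ (mkℚᵘ (+ (2 * S)) 0))
            (scaled-neg {2 * S} {+ deg d ℚ./ 2} (scaled-/ (2 * S) (deg d) 1 (deg d * S)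
              (trans (cong (deg d *_) (*-comm 2 S)) (sym (*-assoc (deg d) S 2))))))
          (scaled-recips (faceVector d) h)) 0<K
      x-y+y : a ℤ.+ y ≡ + (2 * S + s)
      x-y+y = begin
        (+ (2 * S) ℤ.+ ℤ.- y) ℤ.+ + s ℤ.+ y    ≡⟨ ℤₚ.+-assoc (+ (2 * S) ℤ.+ ℤ.- y) (+ s) y ⟩
        (+ (2 * S) ℤ.+ ℤ.- y) ℤ.+ (+ s ℤ.+ y)  ≡⟨ cong (ℤ._+_ (+ (2 * S) ℤ.+ ℤ.- y)) (ℤₚ.+-comm (+ s) y) ⟩
        (+ (2 * S) ℤ.+ ℤ.- y) ℤ.+ (y ℤ.+ + s)  ≡⟨ ℤₚ.+-assoc (+ (2 * S)) (ℤ.- y) (y ℤ.+ + s) ⟩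
        + (2 * S) ℤ.+ (ℤ.- y ℤ.+ (y ℤ.+ + s))  ≡⟨ cong (ℤ._+_ (+ (2 * S))) (sym (ℤₚ.+-assoc (ℤ.- y) y (+ s))) ⟩
        + (2 * S) ℤ.+ (ℤ.- y ℤ.+ y ℤ.+ + s)    ≡⟨ cong (λ z → + (2 * S) ℤ.+ (z ℤ.+ + s)) (ℤₚ.+-inverseˡ y) ⟩
        + (2 * S) ℤ.+ (ℤ.0ℤ ℤ.+ + s)           ≡⟨ cong (ℤ._+_ (+ (2 * S))) (ℤₚ.+-identityˡ (+ s)) ⟩
        + (2 * S) ℤ.+ + s ∎
        where open ≡-Reasoning

-- The finite checks

-- The least common multiple of 1, …, 42.
opaque
  L : ℕ
  L = 219060189739591200

u : ℕ → ℕ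
u zero = 0
u (suc c) = L / suc c

-- Positivity of 1 - k/2 + Σ 1/c, multiplied by `2 * L`, where k is the number of corners.
record Positive (cs : List ℕ) : Set where
  constructor positive
  field
    positive< : length cs * L < 2 * L + ∑ cs (λ c → 2 * u c)

open Positive

-- The checks below are opaque so that their parts can be recovered by unification.
infixr 4 _⇒_
opaque
  positiveᵇ : List ℕ → Bool
  positiveᵇ cs = length cs * L <ᵇ 2 * L + ∑ cs (λ c → 2 * u c)

  _⇒_ : Bool → Bool → Bool
  false ⇒ _ = true
  true ⇒ b = b

  ⇒-elim : ∀ {a b} → (a ⇒ b) ≡ true → a ≡ true → b ≡ true
  ⇒-elim h refl = h

∧-left : ∀ {a b} → a ∧ b ≡ true → a ≡ true
∧-left {true} _ = refl

∧-right : ∀ {a b} → a ∧ b ≡ true → b ≡ true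
∧-right {true} h = h

-- The possible sizes of the two other faces at a vertex of degree 3 with a face of size at least 42.
data Flank : ℕ → ℕ → Set where
  f33 : Flank 3 3
  f34 : Flank 3 4
  f43 : Flank 4 3
  f35 : Flank 3 5
  f53 : Flank 5 3
  f36 : Flank 3 6
  f63 : Flank 6 3
  f44 : Flank 4 4

flank? : ∀ a b → Maybe (Flank a b)
flank? 3 3 = just f33
flank? 3 4 = just f34
flank? 4 3 = just f43
flank? 3 5 = just f35
flank? 5 3 = just f53
flank? 3 6 = just f36
flank? 6 3 = just f63
flank? 4 4 = just f44
flank? _ _ = nothing

flank-sound : ∀ a b → is-just (flank? a b) ≡ true → Flank a b
flank-sound a b h with flank? a b
... | just v = v

flank-swap : ∀ {a b} → Flank a b → Flank b a
flank-swap f33 = f33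
flank-swap f34 = f43
flank-swap f43 = f34
flank-swap f35 = f53
flank-swap f53 = f35
flank-swap f36 = f63
flank-swap f63 = f36
flank-swap f44 = f44

-- A dart at a vertex off the large face either does not lead to that face, or leads to a vertex
-- of it of degree 3, or to one of degree 4, whose first (fore) or second (aft) inner edge it is.
data Kind : Set where
  none fore aft cubic : Kind

isNone : Kind → Bool
isNone none = true
isNone _ = false

opaque
  kinds : List Kind
  kinds = none ∷ fore ∷ aft ∷ cubic ∷ []

  ∈-kinds : ∀ k → k ∈ kinds
  ∈-kinds none = here refl
  ∈-kinds fore = there (here refl)
  ∈-kinds aft = there (there (here refl))
  ∈-kinds cubic = there (there (there (here refl)))

-- At a vertex of degree 4 on the large face all other corners are triangles, so both faces beside
-- either inner edge are; at one of degree 3 they form a `Flank`.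
fits : Kind → ℕ → ℕ → Bool
fits none a b = true
fits fore a b = (a ≡ᵇ 3) ∧ (b ≡ᵇ 3)
fits aft a b = (a ≡ᵇ 3) ∧ (b ≡ᵇ 3)
fits cubic a b = is-just (flank? a b)

-- The middle argument is the size of the face between two consecutive darts.
follows : Kind → ℕ → Kind → Bool
follows fore m none = false
follows fore m fore = false
follows none m aft = false
follows aft m aft = false
follows cubic m none = not (m ≡ᵇ 3)
follows none m cubic = not (m ≡ᵇ 3)
follows _ m _ = true

-- Amounts are in units of 1 / L. To gain 1 / 41, a vertex of degree 3 on the large face asks for this
-- amount along its inner edge if the faces beside that edge are as follows …
ask : ℕ → ℕ → ℕ
ask 4 4 = L / 41
ask 3 6 = L / 41
ask 6 3 = L / 41
ask _ _ = 0

-- … and in these cases its curvature exceeds 1 / N + 1 / 41 by an amount that it passes on.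
spare : ℕ → ℕ → ℕ
spare 3 5 = L / 30 ∸ L / 41
spare 5 3 = L / 30 ∸ L / 41
spare 3 4 = L / 12 ∸ L / 41
spare 4 3 = L / 12 ∸ L / 41
spare _ _ = 0

pentagonHexagon : ℕ → ℕ → Bool
pentagonHexagon 5 6 = true
pentagonHexagon 6 5 = true
pentagonHexagon _ _ = false

-- At a vertex with corners 5, 6, 3, 3 the demands may exceed the curvature by less than L / 210,
-- which is then fetched along the edge between the pentagon and the hexagon.
needyᵇ : ℕ → (a b c e : ℕ) → Bool → Bool → Bool
needyᵇ k a b c e h h′ = (k ≡ᵇ 4) ∧ (c ≡ᵇ 3) ∧ (e ≡ᵇ 3) ∧
  (((a ≡ᵇ 5) ∧ (b ≡ᵇ 6) ∧ h) ∨ ((a ≡ᵇ 6) ∧ (b ≡ᵇ 5) ∧ h′))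

-- The arguments are the degree, four consecutive corners, the first two of which lie beside the dart,
-- and the kinds of the dart, of its successor and of the third dart after it.
gain loss : ℕ → (a b c e : ℕ) → Kind → Kind → Kind → ℕ
gain k a b c e none k₁ k₃ = if needyᵇ k a b c e (not (isNone k₁)) (not (isNone k₃)) then L / 210 else 0
gain k a b c e _ k₁ k₃ = spare a b
loss k a b c e none k₁ k₃ = if pentagonHexagon a b ∧ not (needyᵇ k a b c e (not (isNone k₁)) (not (isNone k₃)))
  then L / 210 else 0
loss k a b c e fore k₁ k₃ = L / 82
loss k a b c e aft k₁ k₃ = L / 82
loss k a b c e cubic k₁ k₃ = ask a b

balancedᵇ : List ℕ → ℕ → ℕ → Bool
balancedᵇ cs in′ out = length cs * L + 2 * out ≤ᵇ 2 * L + ∑ cs (λ c → 2 * u c) + 2 * in′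

-- A dart looks at four consecutive corners and at the third dart after it; in degree 3 both wrap
-- around, whence the repeated `a` and `x`. In degree 4 the third dart is the predecessor, the only
-- case in which `needyᵇ` consults it. The final zeros make the totals agree with `sum` of a list.
balance₃ : (a b c : ℕ) (x y z : Kind) → Bool
balance₃ a b c x y z = balancedᵇ (a ∷ b ∷ c ∷ [])
  (gain 3 a b c a x y x + (gain 3 b c a b y z y + (gain 3 c a b c z x z + 0)))
  (loss 3 a b c a x y x + (loss 3 b c a b y z y + (loss 3 c a b c z x z + 0)))

balance₄ : (a b c e : ℕ) (x y z t : Kind) → Bool
balance₄ a b c e x y z t = balancedᵇ (a ∷ b ∷ c ∷ e ∷ [])
  (gain 4 a b c e x y t + (gain 4 b c e a y z x + (gain 4 c e a b z t y + (gain 4 e a b c t x z + 0))))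
  (loss 4 a b c e x y t + (loss 4 b c e a y z x + (loss 4 c e a b z t y + (loss 4 e a b c t x z + 0))))

balance₅ : (a b c e f : ℕ) (x y z t s : Kind) → Bool
balance₅ a b c e f x y z t s = balancedᵇ (a ∷ b ∷ c ∷ e ∷ f ∷ [])
  (gain 5 a b c e x y t + (gain 5 b c e f y z s +
      (gain 5 c e f a z t x + (gain 5 e f a b t s y + (gain 5 f a b c s x z + 0)))))
  (loss 5 a b c e x y t + (loss 5 b c e f y z s +
      (loss 5 c e f a z t x + (loss 5 e f a b t s y + (loss 5 f a b c s x z + 0)))))

opaque
  sizes : List ℕ
  sizes = applyUpTo (3 +_) 40

  smallSizes : List ℕ
  smallSizes = applyUpTo (3 +_) 39

  ∈-sizes : ∀ {c} → 3 ≤ c → c ≤ 42 → c ∈ sizes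
  ∈-sizes {c} lo hi = subst (_∈ sizes) (m+[n∸m]≡n lo) (∈-applyUpTo⁺ (3 +_) (s≤s (∸-monoˡ-≤ 3 hi)))

  ∈-smallSizes : ∀ {c} → 3 ≤ c → c ≤ 41 → c ∈ smallSizes
  ∈-smallSizes {c} lo hi = subst (_∈ smallSizes) (m+[n∸m]≡n lo) (∈-applyUpTo⁺ (3 +_) (s≤s (∸-monoˡ-≤ 3 hi)))

check-big₃ : Bool
check-big₃ = allᵇ (λ b → allᵇ (λ c → positiveᵇ (42 ∷ b ∷ c ∷ []) ⇒ is-just (flank? b c)) sizes) sizes

-- The tests with `3` in the places not yet chosen prune the search: no size has a larger
-- reciprocal, so if such a test fails, every completion fails.
check-big₄ : Bool
check-big₄ = allᵇ (λ b → positiveᵇ (42 ∷ b ∷ 3 ∷ 3 ∷ []) ⇒ allᵇ (λ c → positiveᵇ (42 ∷ b ∷ c ∷ 3 ∷ []) ⇒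
  allᵇ (λ e → positiveᵇ (42 ∷ b ∷ c ∷ e ∷ []) ⇒ (b ≡ᵇ 3) ∧ (c ≡ᵇ 3) ∧ (e ≡ᵇ 3)) sizes) sizes) sizes

check₃ : Bool
check₃ = allᵇ (λ a → allᵇ (λ b → positiveᵇ (a ∷ b ∷ 3 ∷ []) ⇒ allᵇ (λ c → positiveᵇ (a ∷ b ∷ c ∷ []) ⇒
  allᵇ (λ x → fits x a b ⇒ allᵇ (λ y → fits y b c ⇒ follows x b y ⇒ allᵇ (λ z →
      fits z c a ⇒ follows y c z ⇒ follows z a x ⇒
    balance₃ a b c x y z) kinds) kinds) kinds) smallSizes) smallSizes) smallSizes

check₄ : Bool
check₄ = allᵇ (λ a → allᵇ (λ b → positiveᵇ (a ∷ b ∷ 3 ∷ 3 ∷ []) ⇒ allᵇ (λ c → positiveᵇ (a ∷ b ∷ c ∷ 3 ∷ []) ⇒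
  allᵇ (λ e → positiveᵇ (a ∷ b ∷ c ∷ e ∷ []) ⇒
  allᵇ (λ x → fits x a b ⇒ allᵇ (λ y → fits y b c ⇒ follows x b y ⇒ allᵇ (λ z → fits z c e ⇒ follows y c z ⇒
    allᵇ (λ t → fits t e a ⇒ follows z e t ⇒ follows t a x ⇒ balance₄ a b c e x y z t) kinds) kinds) kinds)
        kinds)
  smallSizes) smallSizes) smallSizes) smallSizes

check₅ : Bool
check₅ = allᵇ (λ a → allᵇ (λ b → positiveᵇ (a ∷ b ∷ 3 ∷ 3 ∷ 3 ∷ []) ⇒ allᵇ (λ c →
    positiveᵇ (a ∷ b ∷ c ∷ 3 ∷ 3 ∷ []) ⇒
  allᵇ (λ e → positiveᵇ (a ∷ b ∷ c ∷ e ∷ 3 ∷ []) ⇒ allᵇ (λ f → positiveᵇ (a ∷ b ∷ c ∷ e ∷ f ∷ []) ⇒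
  allᵇ (λ x → fits x a b ⇒ allᵇ (λ y → fits y b c ⇒ follows x b y ⇒ allᵇ (λ z → fits z c e ⇒ follows y c z ⇒
    allᵇ (λ t → fits t e f ⇒ follows z e t ⇒ allᵇ (λ s → fits s f a ⇒ follows t f s ⇒ follows s a x ⇒
      balance₅ a b c e f x y z t s) kinds) kinds) kinds) kinds) kinds)
  smallSizes) smallSizes) smallSizes) smallSizes) smallSizes

-- The flanks with reciprocals adding up to exactly 1/2: the vertex then has no curvature beyond the
-- 1/N of its large corner.
data Flat : ℕ → ℕ → Set where
  g36 : Flat 3 6
  g63 : Flat 6 3
  g44 : Flat 4 4

opaque
  unfolding L positiveᵇ _⇒_ kinds sizes smallSizes
  big₃-holds : check-big₃ ≡ true
  big₃-holds = refl
  big₄-holds : check-big₄ ≡ true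
  big₄-holds = refl
  big₅-fails : positiveᵇ (42 ∷ 3 ∷ 3 ∷ 3 ∷ 3 ∷ []) ≡ false
  big₅-fails = refl
  holds₃ : check₃ ≡ true
  holds₃ = refl
  holds₄ : check₄ ≡ true
  holds₄ = refl
  holds₅ : check₅ ≡ true
  holds₅ = refl
  u-exact-check : allᵇ (λ c → suc c * u (suc c) ≡ᵇ L) (applyUpTo (λ c → c) 42) ≡ true
  u-exact-check = refl
  u≤u3-check : allᵇ (λ c → u c ≤ᵇ u 3) sizes ≡ true
  u≤u3-check = refl
  L-pos : 0 < L
  L-pos = s≤s z≤n
  -- The origin of the threshold: gains of 1/41 at N vertices exceed 1 exactly when N ≥ 42.
  42units : L < 42 * (L / 41)
  42units = <ᵇ⇒< _ _ _
  -- The large corner is left out, because its 1/N is credited separately. What remains is 1/b + 1/c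
  -- - 1/2, which together with `ask` must cover 1/41 and `spare`.
  excess₃ : ∀ {b c} → Flank b c → 3 * L + 2 * spare b c + 2 * (L / 41) ≤ 2 * L + (2 * u b + 2 * u c) + 2 *
      ask b c
  excess₃ f33 = ≤ᵇ⇒≤ _ _ _
  excess₃ f34 = ≤ᵇ⇒≤ _ _ _
  excess₃ f43 = ≤ᵇ⇒≤ _ _ _
  excess₃ f35 = ≤ᵇ⇒≤ _ _ _
  excess₃ f53 = ≤ᵇ⇒≤ _ _ _
  excess₃ f36 = ≤ᵇ⇒≤ _ _ _
  excess₃ f63 = ≤ᵇ⇒≤ _ _ _
  excess₃ f44 = ≤ᵇ⇒≤ _ _ _
  -- Three triangles contribute exactly 0 beside the large corner, so the whole 1/41 has to arrive
  -- in two halves along the two inner edges.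
  excess₄ : 4 * L + 2 * (L / 41) ≤ 2 * L + (2 * u 3 + (2 * u 3 + 2 * u 3)) + 2 * (L / 82 + L / 82)
  excess₄ = ≤ᵇ⇒≤ _ _ _
  flat₄ : 4 * L ≡ 2 * L + (2 * u 3 + (2 * u 3 + 2 * u 3))
  flat₄ = refl
  flat₃ : ∀ {b c} → Flank b c → 3 * L ≤ 2 * L + (2 * u b + 2 * u c)
  flat₃ f33 = ≤ᵇ⇒≤ _ _ _
  flat₃ f34 = ≤ᵇ⇒≤ _ _ _
  flat₃ f43 = ≤ᵇ⇒≤ _ _ _
  flat₃ f35 = ≤ᵇ⇒≤ _ _ _
  flat₃ f53 = ≤ᵇ⇒≤ _ _ _
  flat₃ f36 = ≤ᵇ⇒≤ _ _ _
  flat₃ f63 = ≤ᵇ⇒≤ _ _ _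
  flat₃ f44 = ≤ᵇ⇒≤ _ _ _
  flat₃⁻ : ∀ {b c} → Flank b c → 2 * L + (2 * u b + 2 * u c) ≤ 3 * L → Flat b c
  flat₃⁻ f33 h = ⊥-elim (≤⇒≤ᵇ h)
  flat₃⁻ f34 h = ⊥-elim (≤⇒≤ᵇ h)
  flat₃⁻ f43 h = ⊥-elim (≤⇒≤ᵇ h)
  flat₃⁻ f35 h = ⊥-elim (≤⇒≤ᵇ h)
  flat₃⁻ f53 h = ⊥-elim (≤⇒≤ᵇ h)
  flat₃⁻ f36 h = g36
  flat₃⁻ f63 h = g63
  flat₃⁻ f44 h = g44

≤⇒≤ᵇ≡ : ∀ {a b} → a ≤ b → (a ≤ᵇ b) ≡ true
≤⇒≤ᵇ≡ {a} {b} le with a ≤ᵇ b | ≤⇒≤ᵇ le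
... | true | _ = refl

≤ᵇ≡⇒≤ : ∀ {a b} → (a ≤ᵇ b) ≡ true → a ≤ b
≤ᵇ≡⇒≤ {a} {b} eq = ≤ᵇ⇒≤ a b (subst T (sym eq) _)

≡ᵇ≡⇒≡ : ∀ {a b} → (a ≡ᵇ b) ≡ true → a ≡ b
≡ᵇ≡⇒≡ {a} {b} eq = ≡ᵇ⇒≡ a b (subst T (sym eq) _)

needy-elim : ∀ {k a b c e h h′} → needyᵇ k a b c e h h′ ≡ true → k ≡ 4 × c ≡ 3 × e ≡ 3 ×
  (a ≡ 5 × b ≡ 6 × h ≡ true ⊎ a ≡ 6 × b ≡ 5 × h′ ≡ true)
needy-elim {k} {a} {b} {c} {e} {h} {h′} eq = ≡ᵇ≡⇒≡ (∧-left eq) , ≡ᵇ≡⇒≡ (∧-left eq₁) , ≡ᵇ≡⇒≡ (∧-left eq₂) ,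
  split ((a ≡ᵇ 5) ∧ (b ≡ᵇ 6) ∧ h) refl (∧-right {e ≡ᵇ 3} eq₂)
  where
  eq₁ = ∧-right {k ≡ᵇ 4} eq
  eq₂ = ∧-right {c ≡ᵇ 3} eq₁
  corner : ∀ i j y → (a ≡ᵇ i) ∧ (b ≡ᵇ j) ∧ y ≡ true → a ≡ i × b ≡ j × y ≡ true
  corner i j y p = ≡ᵇ≡⇒≡ (∧-left p) , ≡ᵇ≡⇒≡ (∧-left (∧-right {a ≡ᵇ i} p)) , ∧-right {b ≡ᵇ j}
      (∧-right {a ≡ᵇ i} p)
  split : ∀ z → (a ≡ᵇ 5) ∧ (b ≡ᵇ 6) ∧ h ≡ z → z ∨ ((a ≡ᵇ 6) ∧ (b ≡ᵇ 5) ∧ h′) ≡ true →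
    a ≡ 5 × b ≡ 6 × h ≡ true ⊎ a ≡ 6 × b ≡ 5 × h′ ≡ true
  split true p _ = inj₁ (corner 5 6 h p)
  split false _ q = inj₂ (corner 6 5 h′ q)

flank-complete : ∀ {a b} → Flank a b → is-just (flank? a b) ≡ true
flank-complete f33 = refl
flank-complete f34 = refl
flank-complete f43 = refl
flank-complete f35 = refl
flank-complete f53 = refl
flank-complete f36 = refl
flank-complete f63 = refl
flank-complete f44 = refl

ask-swap : ∀ {a b} → Flank a b → ask a b ≡ ask b a
ask-swap f33 = refl
ask-swap f34 = refl
ask-swap f43 = refl
ask-swap f35 = refl
ask-swap f53 = refl
ask-swap f36 = refl
ask-swap f63 = refl
ask-swap f44 = refl

spare-swap : ∀ {a b} → Flank a b → spare a b ≡ spare b a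
spare-swap f33 = refl
spare-swap f34 = refl
spare-swap f43 = refl
spare-swap f35 = refl
spare-swap f53 = refl
spare-swap f36 = refl
spare-swap f63 = refl
spare-swap f44 = refl

Size Small : ℕ → Set
Size c = 3 ≤ c × c ≤ 42
Small c = 3 ≤ c × c ≤ 41

u-exact : ∀ c → 1 ≤ c → c ≤ 42 → c * u c ≡ L
u-exact (suc c) _ c≤42 = ≡ᵇ≡⇒≡ (allᵇ-sound (λ c → suc c * u (suc c) ≡ᵇ L) (applyUpTo (λ c → c) 42) u-exact-check
    (∈-applyUpTo⁺ (λ c → c) c≤42))

u≤u3 : ∀ {c} → Size c → u c ≤ u 3
u≤u3 (lo , hi) = ≤ᵇ≡⇒≤ (allᵇ-sound _ sizes u≤u3-check (∈-sizes lo hi))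

opaque
  unfolding positiveᵇ
  positive-mono : ∀ {cs cs′} → Pointwise (λ c c′ → u c ≤ u c′) cs cs′ → Positive cs → positiveᵇ cs′ ≡ true
  positive-mono {cs} {cs′} p (positive pos) with length cs′ * L <ᵇ 2 * L + ∑ cs′ (λ c → 2 * u c) |
    <⇒<ᵇ (<-≤-trans (subst (λ k → k * L < 2 * L + ∑ cs (λ c → 2 * u c)) (Pointwise-length p) pos) (+-monoʳ-≤
        (2 * L) (go p)))
    where
    go : ∀ {cs cs′} → Pointwise (λ c c′ → u c ≤ u c′) cs cs′ → ∑ cs (λ c → 2 * u c) ≤ ∑ cs′ (λ c → 2 * u c)
    go [] = z≤n
    go (h ∷ p) = +-mono-≤ (*-monoʳ-≤ 2 h) (go p)
  ... | true | _ = refl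

-- Each corner contributes at most 1/3, so k corners give a curvature of at most 1 - k/6. The factor
-- 3 avoids dividing `L`.
length<6 : ∀ cs → All Size cs → Positive cs → length cs < 6
length<6 cs sz pos = ≰⇒> λ 6≤k → <⇒≱ (positive< pos) (*-cancelˡ-≤ 3 (begin
  3 * (2 * L + ∑ cs (λ c → 2 * u c))          ≤⟨ *-monoʳ-≤ 3 (+-monoʳ-≤ (2 * L) (go sz)) ⟩
  3 * (2 * L + length cs * (2 * u 3))
      ≡⟨ solve 3 (λ l k v → con 3 :* (con 2 :* l :+ k :* (con 2 :* v)) :=
      con 6 :* l :+ con 2 :* k :* (con 3 :* v)) refl L (length cs) (u 3) ⟩
  6 * L + 2 * length cs * (3 * u 3)
      ≡⟨ cong (λ x → 6 * L + 2 * length cs * x) (u-exact 3 (s≤s z≤n) (s≤s (s≤s (s≤s z≤n)))) ⟩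
  6 * L + 2 * length cs * L                   ≤⟨ +-monoˡ-≤ (2 * length cs * L) (*-monoˡ-≤ L 6≤k) ⟩
  length cs * L + 2 * length cs * L
      ≡⟨ solve 2 (λ l k → k :* l :+ con 2 :* k :* l := con 3 :* (k :* l)) refl L (length cs) ⟩
  3 * (length cs * L) ∎))
  where
  open ≤-Reasoning
  go : ∀ {cs} → All Size cs → ∑ cs (λ c → 2 * u c) ≤ length cs * (2 * u 3)
  go [] = z≤n
  go (h ∷ p) = +-mono-≤ (*-monoʳ-≤ 2 (u≤u3 h)) (go p)

∈-small : ∀ {c} → Small c → c ∈ smallSizes
∈-small (lo , hi) = ∈-smallSizes lo hi

small⇒size : ∀ {c} → Small c → Size c
small⇒size (lo , hi) = lo , m≤n⇒m≤1+n hi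

big₃ : ∀ {b c} → Size b → Size c → Positive (42 ∷ b ∷ c ∷ []) → Flank b c
big₃ {b} {c} (b≥ , b≤) (c≥ , c≤) pos = flank-sound b c (⇒-elim
  (allᵇ-sound _ sizes (allᵇ-sound _ sizes big₃-holds (∈-sizes b≥ b≤)) (∈-sizes c≥ c≤))
  (positive-mono (≤-refl ∷ ≤-refl ∷ ≤-refl ∷ []) pos))

big₄ : ∀ {b c e} → Size b → Size c → Size e → Positive (42 ∷ b ∷ c ∷ e ∷ []) → b ≡ 3 × c ≡ 3 × e ≡ 3
big₄ {b} {c} {e} sb sc se pos = ≡ᵇ≡⇒≡ (∧-left h) , ≡ᵇ≡⇒≡ (∧-left (∧-right {b ≡ᵇ 3} h)) , ≡ᵇ≡⇒≡
    (∧-right {c ≡ᵇ 3} (∧-right {b ≡ᵇ 3} h))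
  where
  h : (b ≡ᵇ 3) ∧ (c ≡ᵇ 3) ∧ (e ≡ᵇ 3) ≡ true
  h = ⇒-elim (allᵇ-sound _ sizes (⇒-elim (allᵇ-sound _ sizes (⇒-elim (allᵇ-sound _ sizes big₄-holds
        (∈-sizes (proj₁ sb) (proj₂ sb)))
        (positive-mono (≤-refl ∷ ≤-refl ∷ u≤u3 sc ∷ u≤u3 se ∷ []) pos)) (∈-sizes (proj₁ sc) (proj₂ sc)))
        (positive-mono (≤-refl ∷ ≤-refl ∷ ≤-refl ∷ u≤u3 se ∷ []) pos)) (∈-sizes (proj₁ se) (proj₂ se)))
        (positive-mono (≤-refl ∷ ≤-refl ∷ ≤-refl ∷ ≤-refl ∷ []) pos)

big₅ : ∀ {b c e f} → Size b → Size c → Size e → Size f → ¬ Positive (42 ∷ b ∷ c ∷ e ∷ f ∷ [])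
big₅ sb sc se sf pos with () ← trans (sym big₅-fails)
  (positive-mono (≤-refl ∷ u≤u3 sb ∷ u≤u3 sc ∷ u≤u3 se ∷ u≤u3 sf ∷ []) pos)

Balanced : List ℕ → ℕ → ℕ → Set
Balanced cs in′ out = length cs * L + 2 * out ≤ 2 * L + ∑ cs (λ c → 2 * u c) + 2 * in′

module _ {a b c} (sa : Small a) (sb : Small b) (sc : Small c) (pos : Positive (a ∷ b ∷ c ∷ [])) where
  balanced₃ : ∀ x y z → fits x a b ≡ true → fits y b c ≡ true → fits z c a ≡ true →
    follows x b y ≡ true → follows y c z ≡ true → follows z a x ≡ true →
    Balanced (a ∷ b ∷ c ∷ [])
      (gain 3 a b c a x y x + (gain 3 b c a b y z y + (gain 3 c a b c z x z + 0)))
      (loss 3 a b c a x y x + (loss 3 b c a b y z y + (loss 3 c a b c z x z + 0)))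
  balanced₃ x y z fx fy fz xy yz zx =
      ≤ᵇ≡⇒≤ (⇒-elim (⇒-elim (⇒-elim (allᵇ-sound _ kinds (⇒-elim (⇒-elim (allᵇ-sound _ kinds (⇒-elim
    (allᵇ-sound _ kinds (⇒-elim (allᵇ-sound _ smallSizes
        (⇒-elim (allᵇ-sound _ smallSizes (allᵇ-sound _ smallSizes holds₃
      (∈-small sa)) (∈-small sb))
      (positive-mono (≤-refl ∷ ≤-refl ∷ u≤u3 (small⇒size sc) ∷ []) pos)) (∈-small sc))
      (positive-mono (≤-refl ∷ ≤-refl ∷ ≤-refl ∷ []) pos))
    (∈-kinds x)) fx) (∈-kinds y)) fy) xy) (∈-kinds z)) fz) yz) zx)

module _ {a b c e} (sa : Small a) (sb : Small b) (sc : Small c) (se : Small e) (pos : Positive (a ∷ b ∷ c ∷ e ∷ [])) where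
  balanced₄ : ∀ x y z t → fits x a b ≡ true → fits y b c ≡ true → fits z c e ≡ true → fits t e a ≡ true →
    follows x b y ≡ true → follows y c z ≡ true → follows z e t ≡ true → follows t a x ≡ true →
    Balanced (a ∷ b ∷ c ∷ e ∷ [])
      (gain 4 a b c e x y t + (gain 4 b c e a y z x + (gain 4 c e a b z t y + (gain 4 e a b c t x z + 0))))
      (loss 4 a b c e x y t + (loss 4 b c e a y z x + (loss 4 c e a b z t y + (loss 4 e a b c t x z + 0))))
  balanced₄ x y z t fx fy fz ft xy yz zt tx =
      ≤ᵇ≡⇒≤ (⇒-elim (⇒-elim (⇒-elim (allᵇ-sound _ kinds (⇒-elim (⇒-elim (allᵇ-sound _ kinds
    (⇒-elim (⇒-elim (allᵇ-sound _ kinds (⇒-elim (allᵇ-sound _ kinds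
    (⇒-elim (allᵇ-sound _ smallSizes
        (⇒-elim (allᵇ-sound _ smallSizes (⇒-elim (allᵇ-sound _ smallSizes (allᵇ-sound _ smallSizes holds₄
      (∈-small sa)) (∈-small sb))
      (positive-mono (≤-refl ∷ ≤-refl ∷ u≤u3 (small⇒size sc) ∷ u≤u3 (small⇒size se) ∷ []) pos)) (∈-small sc))
      (positive-mono (≤-refl ∷ ≤-refl ∷ ≤-refl ∷ u≤u3 (small⇒size se) ∷ []) pos)) (∈-small se))
      (positive-mono (≤-refl ∷ ≤-refl ∷ ≤-refl ∷ ≤-refl ∷ []) pos))
    (∈-kinds x)) fx) (∈-kinds y)) fy) xy) (∈-kinds z)) fz) yz) (∈-kinds t)) ft) zt) tx)

module _ {a b c e f} (sa : Small a) (sb : Small b) (sc : Small c) (se : Small e) (sf : Small f)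
  (pos : Positive (a ∷ b ∷ c ∷ e ∷ f ∷ [])) where
  balanced₅ : ∀ x y z t s → fits x a b ≡ true → fits y b c ≡ true → fits z c e ≡ true → fits t e f ≡ true →
      fits s f a ≡ true →
    follows x b y ≡ true → follows y c z ≡ true → follows z e t ≡ true → follows t f s ≡ true →
        follows s a x ≡ true →
    Balanced (a ∷ b ∷ c ∷ e ∷ f ∷ [])
      (gain 5 a b c e x y t + (gain 5 b c e f y z s +
          (gain 5 c e f a z t x + (gain 5 e f a b t s y + (gain 5 f a b c s x z + 0)))))
      (loss 5 a b c e x y t + (loss 5 b c e f y z s +
          (loss 5 c e f a z t x + (loss 5 e f a b t s y + (loss 5 f a b c s x z + 0)))))
  balanced₅ x y z t s fx fy fz ft fs xy yz zt ts sx =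
      ≤ᵇ≡⇒≤ (⇒-elim (⇒-elim (⇒-elim (allᵇ-sound _ kinds (⇒-elim (⇒-elim (allᵇ-sound _ kinds
    (⇒-elim (⇒-elim (allᵇ-sound _ kinds (⇒-elim (⇒-elim (allᵇ-sound _ kinds (⇒-elim (allᵇ-sound _ kinds
    (⇒-elim (allᵇ-sound _ smallSizes
        (⇒-elim (allᵇ-sound _ smallSizes (⇒-elim (allᵇ-sound _ smallSizes (⇒-elim (allᵇ-sound _ smallSizes
      (allᵇ-sound _ smallSizes holds₅ (∈-small sa)) (∈-small sb))
      (positive-mono (≤-refl ∷ ≤-refl ∷ u≤u3 (small⇒size sc) ∷ u≤u3 (small⇒size se) ∷ u≤u3 (small⇒size sf) ∷ [])
          pos)) (∈-small sc))
      (positive-mono (≤-refl ∷ ≤-refl ∷ ≤-refl ∷ u≤u3 (small⇒size se) ∷ u≤u3 (small⇒size sf) ∷ []) pos))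
          (∈-small se))
      (positive-mono (≤-refl ∷ ≤-refl ∷ ≤-refl ∷ ≤-refl ∷ u≤u3 (small⇒size sf) ∷ []) pos)) (∈-small sf))
      (positive-mono (≤-refl ∷ ≤-refl ∷ ≤-refl ∷ ≤-refl ∷ ≤-refl ∷ []) pos))
    (∈-kinds x)) fx) (∈-kinds y)) fy) xy) (∈-kinds z)) fz) yz) (∈-kinds t)) ft) zt) (∈-kinds s)) fs) ts) sx)

∈⇒∣! : ∀ {c n} → 1 ≤ c → c ≤ n → c ∣ n !
∈⇒∣! {suc c} _ c≤n = ∣-trans (m∣m*n (c !)) (m≤n⇒m!∣n! c≤n)

-- This carries the outcome of the checks on capped sizes back to the true face sizes.
uncap : ∀ {c} → c ⊓ 42 ≤ 6 → c ⊓ 42 ≡ c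
uncap {c} h with ≤-total c 42
... | inj₁ c≤42 = m≤n⇒m⊓n≡m c≤42
... | inj₂ 42≤c with () ← ≤⇒≤ᵇ (subst (_≤ 6) (m≥n⇒m⊓n≡n 42≤c) h)

flank≤6 : ∀ {a b} → Flank a b → a ≤ 6 × b ≤ 6
flank≤6 f33 = ≤ᵇ⇒≤ _ _ _ , ≤ᵇ⇒≤ _ _ _
flank≤6 f34 = ≤ᵇ⇒≤ _ _ _ , ≤ᵇ⇒≤ _ _ _
flank≤6 f43 = ≤ᵇ⇒≤ _ _ _ , ≤ᵇ⇒≤ _ _ _
flank≤6 f35 = ≤ᵇ⇒≤ _ _ _ , ≤ᵇ⇒≤ _ _ _
flank≤6 f53 = ≤ᵇ⇒≤ _ _ _ , ≤ᵇ⇒≤ _ _ _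
flank≤6 f36 = ≤ᵇ⇒≤ _ _ _ , ≤ᵇ⇒≤ _ _ _
flank≤6 f63 = ≤ᵇ⇒≤ _ _ _ , ≤ᵇ⇒≤ _ _ _
flank≤6 f44 = ≤ᵇ⇒≤ _ _ _ , ≤ᵇ⇒≤ _ _ _

flank-uncap : ∀ {a b} → Flank (a ⊓ 42) (b ⊓ 42) → Flank a b
flank-uncap {a} {b} f = subst₂ Flank (uncap {a} (proj₁ (flank≤6 f))) (uncap {b} (proj₂ (flank≤6 f))) f

-- A common denominator for all face sizes

module Weights (n : ℕ) where

  -- Face sizes are at most `n`, so `n !` clears every reciprocal. The factor `L` makes the weights
  -- of sizes up to 42 equal to `n !` times the table `u`, so an evaluated inequality only has to be
  -- multiplied by `n !`.
  S : ℕ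
  S = L * n !

  w : ℕ → ℕ
  w zero = 0
  w (suc c) = S / suc c

  w-exact : ∀ {c} → 1 ≤ c → c ≤ n → c * w c ≡ S
  w-exact {suc c} 1≤c c≤n = m*[n/m]≡n (∣n⇒∣m*n L (∈⇒∣! 1≤c c≤n))

  w≡u : ∀ {c} → 1 ≤ c → c ≤ 42 → c * w c ≡ S → w c ≡ u c * n !
  w≡u {suc c} 1≤c c≤42 eq = *-cancelˡ-≡ (w (suc c)) (u (suc c) * n !) (suc c) (begin
    suc c * w (suc c)         ≡⟨ eq ⟩
    L * n !                   ≡⟨ cong (_* n !) (sym (u-exact (suc c) 1≤c c≤42)) ⟩
    suc c * u (suc c) * n !   ≡⟨ *-assoc (suc c) (u (suc c)) (n !) ⟩
    suc c * (u (suc c) * n !) ∎)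
    where open ≡-Reasoning

  -- Reciprocals decrease, so capping overestimates the curvature and preserves its positivity.
  w≤u : ∀ {c} → 1 ≤ c → c * w c ≡ S → w c ≤ u (c ⊓ 42) * n !
  w≤u {c} 1≤c eq with ≤-total c 42
  ... | inj₁ c≤42 = ≤-reflexive (trans (w≡u 1≤c c≤42 eq) (cong (λ x → u x * n !) (sym (m≤n⇒m⊓n≡m c≤42))))
  ... | inj₂ 42≤c rewrite m≥n⇒m⊓n≡n 42≤c = *-cancelˡ-≤ 42 (begin
    42 * w c           ≤⟨ *-monoˡ-≤ (w c) 42≤c ⟩
    c * w c            ≡⟨ eq ⟩
    L * n !            ≡⟨ cong (_* n !) (sym (u-exact 42 (s≤s z≤n) ≤-refl)) ⟩
    42 * u 42 * n !    ≡⟨ *-assoc 42 (u 42) (n !) ⟩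
    42 * (u 42 * n !) ∎)
    where open ≤-Reasoning

  instance
    n!≢0 : NonZero (n !)
    n!≢0 = n !≢0

  0<S : 0 < S
  0<S = *-mono-< L-pos (>-nonZero⁻¹ (n !))

-- Vertices on a large face

module Map {n} (M : CombMap n) (pcc : CombMap.IsPlanarPCC M) where
  open CombMap M public
  open Weights n public

  connected : Connected
  connected = proj₁ pcc

  spherical : Spherical
  spherical = proj₁ (proj₂ pcc)

  no-loop : ∀ d → ¬ InOrbit σ d (α d)
  no-loop = proj₁ (proj₁ (proj₂ (proj₂ pcc)))

  no-parallel : ∀ d e → InOrbit σ d e → InOrbit σ (α d) (α e) → d ≡ e
  no-parallel = proj₂ (proj₁ (proj₂ (proj₂ pcc)))

  deg≥3 : ∀ d → 3 ≤ deg d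
  deg≥3 = proj₁ (proj₂ (proj₂ (proj₂ pcc)))

  face : Fin n → ℕ
  face = faceSize

  α-inj : Injective _≡_ _≡_ α
  α-inj {d} {e} eq = trans (sym (α-inv d)) (trans (cong α eq) (α-inv e))

  φ-inj : Injective _≡_ _≡_ φ
  φ-inj = α-inj ∘ σ-inj

  module V = Perm σ σ-inj
  module F = Perm φ φ-inj

  _~_ : Fin n → Fin n → Set
  d ~ e = InOrbit σ d e

  ~σ : ∀ {d} → d ~ σ d
  ~σ = 1 , refl

  ~refl : ∀ {d} → d ~ d
  ~refl = 0 , refl

  ~trans : ∀ {d e x} → d ~ e → e ~ x → d ~ x
  ~trans = V.InOrbit-trans

  ~sym : ∀ {d e} → d ~ e → e ~ d
  ~sym = V.InOrbit-sym

  σd≢d : ∀ d → σ d ≢ d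
  σd≢d d eq = <⇒≱ (deg≥3 d) (≤-trans (V.period-least d 1 ≤-refl eq) (n≤1+n 1))

  σσd≢d : ∀ d → σ (σ d) ≢ d
  σσd≢d d eq = <⇒≱ (deg≥3 d) (V.period-least d 2 (s≤s z≤n) eq)

  face-φ : ∀ d → face (φ d) ≡ face d
  face-φ d = F.period-orbit (1 , refl)

  φα : ∀ d → φ (α d) ≡ σ d
  φα d = cong σ (α-inv d)

  face-α : ∀ d → face (α d) ≡ face (σ d)
  face-α d = trans (sym (face-φ (α d))) (cong face (φα d))

  face-σα : ∀ d → face (σ (α d)) ≡ face d
  face-σα = face-φ

  -- A face of size 1 is a loop. One of size 2 has parallel sides, which must coincide by
  -- simplicity; then `σ` fixes `d`, against the degree bound.
  face≥3 : ∀ d → 3 ≤ face d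
  face≥3 d = ≤∧≢⇒< (≤∧≢⇒< (F.period-pos d) (λ eq →
      loop (subst (λ k → iter φ k d ≡ d) (sym eq) (F.iter-period d))))
    (λ eq → digon (subst (λ k → iter φ k d ≡ d) (sym eq) (F.iter-period d)))
    where
    loop : φ d ≡ d → ⊥
    loop eq = no-loop d (~sym (1 , eq))
    digon : φ (φ d) ≡ d → ⊥
    digon eq = σd≢d d (trans (cong σ d≡) eq)
      where
      d≡ : d ≡ α (φ d)
      d≡ = no-parallel d (α (φ d)) (~sym (1 , eq)) (1 , sym (α-inv (φ d)))

  face≤n : ∀ d → face d ≤ n
  face≤n = F.period≤n

  w-face : ∀ d → face d * w (face d) ≡ S
  w-face d = w-exact (F.period-pos d) (face≤n d)

  cap : Fin n → ℕ
  cap d = face d ⊓ 42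

  cap-size : ∀ d → Size (cap d)
  cap-size d = ⊓-glb (face≥3 d) (≤ᵇ⇒≤ _ _ _) , m⊓n≤n (face d) 42

  corners : Fin n → List ℕ
  corners d = map cap (orbit σ d)

  positive-curvature : ∀ d → deg d * S < 2 * S + ∑ (orbit σ d) (λ e → 2 * w (face e))
  positive-curvature d = subst (λ x → deg d * S < 2 * S + x) (cong sum (sym (map-∘ (orbit σ d))))
    (Scaling.curvature-pos M S w d 0<S face-weights (proj₁ (proj₂ (proj₂ (proj₂ (proj₂ pcc)))) d))
    where
    face-weights : ∀ {c} → c ∈ faceVector d → 1 ≤ c × c * w c ≡ S
    face-weights m with ∈-map⁻ face m
    ... | e , _ , refl = F.period-pos e , w-face e

  positive-corners : ∀ d → Positive (corners d)
  positive-corners d = positive (*-cancelʳ-< (n !) _ _ (begin-strict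
    length (corners d) * L * n !
        ≡⟨ cong (λ k → k * L * n !) (trans (length-map cap (orbit σ d)) (V.length-orbit d)) ⟩
    deg d * L * n !                                        ≡⟨ *-assoc (deg d) L (n !) ⟩
    deg d * S                                              <⟨ positive-curvature d ⟩
    2 * S + ∑ (orbit σ d) (λ e → 2 * w (face e))
        ≤⟨ +-monoʳ-≤ (2 * S) (∑-mono (orbit σ d) λ {e} _ → bound e) ⟩
    2 * S + ∑ (orbit σ d) (λ e → n ! * (2 * u (cap e)))
        ≡⟨ cong₂ _+_ (sym (*-assoc 2 L (n !))) (∑-* (orbit σ d) (n !) (λ e → 2 * u (cap e))) ⟩
    2 * L * n ! + n ! * ∑ (orbit σ d) (λ e → 2 * u (cap e))
        ≡⟨ cong (2 * L * n ! +_) (trans (*-comm (n !) _) (cong (λ x → sum x * n !) (map-∘ (orbit σ d)))) ⟩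
    2 * L * n ! + ∑ (corners d) (λ c → 2 * u c) * n !          ≡⟨ sym (*-distribʳ-+ (n !) (2 * L) _) ⟩
    (2 * L + ∑ (corners d) (λ c → 2 * u c)) * n ! ∎))
    where
    open ≤-Reasoning
    bound : ∀ e → 2 * w (face e) ≤ n ! * (2 * u (cap e))
    bound e = begin
      2 * w (face e)          ≤⟨ *-monoʳ-≤ 2 (w≤u (F.period-pos e) (w-face e)) ⟩
      2 * (u (cap e) * n !)   ≡⟨ trans (sym (*-assoc 2 (u (cap e)) (n !))) (*-comm _ (n !)) ⟩
      n ! * (2 * u (cap e)) ∎

  deg<6 : ∀ d → deg d < 6
  deg<6 d = subst (_< 6) (trans (length-map cap (orbit σ d)) (V.length-orbit d))
    (length<6 (corners d) (All.map⁺ (All.universal cap-size (orbit σ d))) (positive-corners d))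

  data Degree (d : Fin n) : Set where
    deg₃ : deg d ≡ 3 → Degree d
    deg₄ : deg d ≡ 4 → Degree d
    deg₅ : deg d ≡ 5 → Degree d

  degree : ∀ d → Degree d
  degree d = go (deg d) refl (deg≥3 d) (deg<6 d)
    where
    go : ∀ k → deg d ≡ k → 3 ≤ k → k < 6 → Degree d
    go 1 _ (s≤s ()) _
    go 2 _ (s≤s (s≤s ())) _
    go 3 eq _ _ = deg₃ eq
    go 4 eq _ _ = deg₄ eq
    go 5 eq _ _ = deg₅ eq
    go (suc (suc (suc (suc (suc (suc _)))))) _ _ (s≤s (s≤s (s≤s (s≤s (s≤s (s≤s ()))))))

  deg-σ : ∀ d → deg (σ d) ≡ deg d
  deg-σ d = V.period-orbit ~σ

  cycle : ∀ {d k} → deg d ≡ k → iter σ k d ≡ d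
  cycle {d} refl = V.iter-period d

  positive-deg : ∀ {d k} → deg d ≡ k → Positive (map cap (map (λ j → iter σ j d) (upTo k)))
  positive-deg {d} refl = positive-corners d

  Big : Fin n → Set
  Big d = 42 ≤ face d

  data Around (d : Fin n) : Set where
    around₃ : deg d ≡ 3 → Flank (face (σ d)) (face (σ (σ d))) → Around d
    around₄ : deg d ≡ 4 → face (σ d) ≡ 3 → face (σ (σ d)) ≡ 3 → face (σ (σ (σ d))) ≡ 3 → Around d

  uncap₃ : ∀ {e} → cap e ≡ 3 → face e ≡ 3
  uncap₃ {e} eq = trans (sym (uncap {face e} (subst (_≤ 6) (sym eq) (≤ᵇ⇒≤ _ _ _)))) eq

  around : ∀ {d} → Big d → Around d
  around {d} b = go (degree d)
    where
    Corners = λ cs → Positive (42 ∷ cs)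
    capped : ∀ {cs} → Positive (cap d ∷ cs) → Corners cs
    capped {cs} = subst (λ c → Positive (c ∷ cs)) (m≥n⇒m⊓n≡n b)
    threes : ∀ {e f g} → cap e ≡ 3 × cap f ≡ 3 × cap g ≡ 3 → face e ≡ 3 × face f ≡ 3 × face g ≡ 3
    threes {e} {f} {g} (p , q , r) = uncap₃ {e} p , uncap₃ {f} q , uncap₃ {g} r
    go : Degree d → Around d
    go (deg₃ eq) = around₃ eq (flank-uncap {face (σ d)} (big₃ (cap-size _) (cap-size _)
        (capped (positive-deg eq))))
    go (deg₄ eq) = let p , q , r = threes {σ d} {σ (σ d)} {σ (σ (σ d))} (big₄ (cap-size _) (cap-size _) (cap-size _) (capped (positive-deg eq)))
      in around₄ eq p q r
    go (deg₅ eq) = ⊥-elim (big₅ (cap-size (σ d)) (cap-size (σ (σ d))) (cap-size (σ (σ (σ d))))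
        (cap-size (σ (σ (σ (σ d)))))
      (capped (positive-deg eq)))

-- Inner edges and chords of a large face

module Local {n} (M : CombMap n) (pcc : CombMap.IsPlanarPCC M) where
  open Map M pcc public

  3≢4 : 3 ≢ 4
  3≢4 ()

  ≤6⇒¬Big : ∀ {d} → face d ≤ 6 → ¬ Big d
  ≤6⇒¬Big h b = <⇒≱ {6} {42} (≤ᵇ⇒≤ _ _ _) (≤-trans b h)

  ≡3⇒¬Big : ∀ {d} → face d ≡ 3 → ¬ Big d
  ≡3⇒¬Big h = ≤6⇒¬Big (subst (_≤ 6) (sym h) (≤ᵇ⇒≤ _ _ _))

  beside≤6 : ∀ {d} → Around d → face (σ d) ≤ 6 × face (σ (σ d)) ≤ 6
  beside≤6 (around₃ _ f) = flank≤6 f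
  beside≤6 (around₄ _ p q _) = subst (_≤ 6) (sym p) (≤ᵇ⇒≤ _ _ _) , subst (_≤ 6) (sym q) (≤ᵇ⇒≤ _ _ _)

  big-φ : ∀ {d} → Big d → Big (φ d)
  big-φ {d} = subst (42 ≤_) (sym (face-φ d))

  -- The other corners at such a vertex have at most 6 edges. Hence the dart of the large corner can
  -- stand for its vertex from here on.
  big-unique : ∀ {d e} → Big d → Big e → d ~ e → d ≡ e
  big-unique {d} {e} bd be d~e = go (around bd) (V.InOrbit< d~e)
    where
    go : Around d → (∃ λ k → k < deg d × iter σ k d ≡ e) → d ≡ e
    go _ (0 , _ , eq) = eq
    go a (1 , _ , refl) = ⊥-elim (≤6⇒¬Big (proj₁ (beside≤6 a)) be)
    go a (2 , _ , refl) = ⊥-elim (≤6⇒¬Big (proj₂ (beside≤6 a)) be)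
    go (around₄ _ _ _ h) (3 , _ , refl) = ⊥-elim (≡3⇒¬Big h be)
    go (around₃ d3 _) (suc (suc (suc k)) , lt , _) with () ← <⇒≱ lt (subst (_≤ _) (sym d3) (m≤m+n 3 k))
    go (around₄ d4 _ _ _) (suc (suc (suc (suc k))) , lt , _) with () ← <⇒≱ lt
        (subst (_≤ _) (sym d4) (m≤m+n 4 k))

  -- The corner `face x` lies between the predecessor of `x` in the rotation and `x`, so these two
  -- darts run along the large face. One dart is left in degree 3 and two in degree 4.
  data Inner (x g : Fin n) : Set where
    cubic : deg x ≡ 3 → g ≡ σ x → Inner x g
    fore : deg x ≡ 4 → g ≡ σ x → Inner x g
    aft : deg x ≡ 4 → g ≡ σ (σ x) → Inner x g

  inner : ∀ {x g} → Big x → x ~ g → g ≢ x → σ g ≢ x → Inner x g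
  inner {x} {g} b x~g g≢x σg≢x = go (around b) (V.InOrbit< x~g)
    where
    go : Around x → (∃ λ k → k < deg x × iter σ k x ≡ g) → Inner x g
    go _ (0 , _ , eq) = ⊥-elim (g≢x (sym eq))
    go (around₃ d3 _) (1 , _ , eq) = cubic d3 (sym eq)
    go (around₃ d3 _) (2 , _ , refl) = ⊥-elim (σg≢x (cycle d3))
    go (around₃ d3 _) (suc (suc (suc k)) , lt , _) with () ← <⇒≱ lt (subst (_≤ _) (sym d3) (m≤m+n 3 k))
    go (around₄ d4 _ _ _) (1 , _ , eq) = fore d4 (sym eq)
    go (around₄ d4 _ _ _) (2 , _ , eq) = aft d4 (sym eq)
    go (around₄ d4 _ _ _) (3 , _ , refl) = ⊥-elim (σg≢x (cycle d4))
    go (around₄ d4 _ _ _) (suc (suc (suc (suc k))) , lt , _) with () ← <⇒≱ lt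
        (subst (_≤ _) (sym d4) (m≤m+n 4 k))

  triangle : ∀ {e} → face e ≡ 3 → φ (φ (φ e)) ≡ e
  triangle {e} eq = subst (λ k → iter φ k e ≡ e) eq (F.iter-period e)

  triangle-last : ∀ {d} → face (σ d) ≡ 3 → φ (φ (σ d)) ≡ α d
  triangle-last {d} h = φ-inj (trans (triangle h) (sym (φα d)))

  ασ-pred : ∀ {d} → deg d ≡ 3 → φ (α (σ (σ d))) ≡ d
  ασ-pred {d} d3 = trans (φα (σ (σ d))) (cycle d3)

  -- The triangle on the edge `d` would have a second side `x` along a large face. At the common end
  -- of the two sides both `x` and `φ d` would be large corners, contrary to `big-unique`.
  fore-triangle : ∀ {d x} → Big d → Big x → face (σ d) ≡ 3 → φ (σ d) ≡ α x → ⊥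
  fore-triangle {d} {x} bd bx h eq = σσd≢d x (sym x≡)
    where
    σx≡αd : σ x ≡ α d
    σx≡αd = trans (sym (φα x)) (trans (cong φ (sym eq)) (triangle-last h))
    x≡ : x ≡ σ (σ x)
    x≡ = big-unique bx (subst Big (cong σ (sym σx≡αd)) (big-φ bd)) (2 , refl)

  -- The mirror image: the third side of the triangle would be the edge `x` of a large face, and it
  -- ends at the vertex of the predecessor `p`, where both `p` and `φ x` would be large corners.
  aft-triangle : ∀ {d x} → Big d → Big x → deg d ≡ 3 → face (σ (σ d)) ≡ 3 → α (σ d) ≡ σ x → ⊥
  aft-triangle {d} {x} bd bx d3 h eq = σσd≢d p (sym p≡)
    where
    p = α (σ (σ d))
    bp : Big p
    bp = subst (42 ≤_) (trans (cong face (sym (ασ-pred d3))) (face-φ p)) bd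
    g≡ : φ (φ (φ (α (σ d)))) ≡ α (σ d)
    g≡ = triangle (trans (face-α (σ d)) h)
    σασp≡ : σ (α (σ p)) ≡ σ x
    σασp≡ = trans (cong (σ ∘ α ∘ σ ∘ α) (sym (φα (σ d)))) (trans g≡ eq)
    φx≡ : φ x ≡ σ (σ p)
    φx≡ = cong σ (trans (cong α (sym (σ-inj σασp≡))) (α-inv (σ p)))
    p≡ : p ≡ σ (σ p)
    p≡ = big-unique bp (subst Big φx≡ (big-φ bx)) (2 , refl)

  pred₃ : ∀ {d} → deg (φ d) ≡ 3 → α d ≡ σ (σ (φ d))
  pred₃ {d} h = σ-inj (sym (cycle h))

  pred₄ : ∀ {d} → deg (φ d) ≡ 4 → α d ≡ σ (σ (σ (φ d)))
  pred₄ {d} h = σ-inj (sym (cycle h))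

  -- A chord between the i-th and the j-th vertex of a large face forces one between the (i+1)-st and
  -- the (j−1)-st, and so on until a loop or a double edge appears.
  chord-step : ∀ {d x} → Big d → Big x → φ x ~ α (σ d) → x ~ α (σ (φ d))
  chord-step {d} {x} bd bx chord = go (around bd) (inner bφx chord
      (λ eq → ≤6⇒¬Big face-g≤6 (subst Big (sym eq) bφx))
      (λ eq → ≤6⇒¬Big face-σg≤6 (subst Big (sym eq) bφx)))
    where
    e = σ d
    g = α e
    bφx = big-φ bx
    bφd = big-φ bd
    face-g : face g ≡ face (σ (σ d))
    face-g = face-α e
    face-σg : face (σ g) ≡ face e
    face-σg = face-σα e
    face-g≤6 : face g ≤ 6
    face-g≤6 = subst (_≤ 6) (sym face-g) (proj₂ (beside≤6 (around bd)))
    face-σg≤6 : face (σ g) ≤ 6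
    face-σg≤6 = subst (_≤ 6) (sym face-σg) (proj₁ (beside≤6 (around bd)))
    σg≢3 : face e ≢ 3 → ∀ {y} → face y ≡ 3 → σ g ≢ y
    σg≢3 ne h eq = ne (trans (sym face-σg) (trans (cong face eq) h))

    degree4 : deg (φ x) ≡ 4 → face (σ (σ (φ x))) ≡ 3 × face (σ (σ (σ (φ x)))) ≡ 3
    degree4 d4 = pick (around bφx)
      where
      pick : Around (φ x) → face (σ (σ (φ x))) ≡ 3 × face (σ (σ (σ (φ x)))) ≡ 3
      pick (around₃ d3 _) = ⊥-elim (3≢4 (trans (sym d3) d4))
      pick (around₄ _ _ p q) = p , q

    -- If `g` is the last inner dart at `φ x`, the triangle has both `d` and `x` as sides, which
    -- `fore-triangle` forbids. Otherwise the next inner dart leads to the vertex of `φ d`, and the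
    -- triangle behind it supplies the edge from there to `x`.
    through-triangle : face e ≡ 3 → Inner (φ x) g → x ~ α (σ (φ d))
    through-triangle h (cubic d3 eq) = ⊥-elim (fore-triangle bd bx h (trans (cong σ eq) (sym (pred₃ d3))))
    through-triangle h (aft d4 eq) = ⊥-elim (fore-triangle bd bx h (trans (cong σ eq) (sym (pred₄ d4))))
    through-triangle h (fore d4 eq) = finish (around bφd)
      where
      y = σ (σ (φ x))
      φσx≡ : φ (σ x) ≡ α y
      φσx≡ = trans (sym (α-inv _)) (cong α (σ-inj (begin
        φ (φ (σ x))        ≡⟨ cong (φ ∘ φ) (sym (φα x)) ⟩
        φ (φ (φ (α x)))    ≡⟨ triangle (trans (cong face (pred₄ d4)) (proj₂ (degree4 d4))) ⟩
        α x                ≡⟨ pred₄ d4 ⟩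
        σ y ∎)))
        where open ≡-Reasoning
      αd≡ : α d ≡ σ (σ (α (σ x)))
      αd≡ = trans (sym (triangle-last h)) (cong σ (trans (cong (α ∘ σ) eq) (sym φσx≡)))
      finish : Around (φ d) → x ~ α (σ (φ d))
      finish (around₃ d3 _) = ⊥-elim (σσd≢d x (sym (big-unique bx
          (subst Big (cong σ (trans (cong α (sym ασx≡)) (α-inv (σ x)))) (big-φ bφd)) (2 , refl))))
        where
        ασx≡ : α (σ x) ≡ φ d
        ασx≡ = σ-inj (σ-inj (trans (sym αd≡) (pred₃ d3)))
      finish (around₄ d4′ _ _ _) = 1 , trans (sym (α-inv (σ x)))
          (cong α (σ-inj (σ-inj (trans (sym αd≡) (pred₄ d4′)))))

    -- A vertex of degree 4 has no square, so `φ x` is cubic. The square then has the sides `d`, `e`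
    -- and `x`, and its fourth side is the new chord.
    through-square : face e ≡ 4 → Inner (φ x) g → x ~ α (σ (φ d))
    through-square h (fore d4 eq) = ⊥-elim (σg≢3 (λ h3 → 3≢4 (trans (sym h3) h)) (proj₁ (degree4 d4))
        (cong σ eq))
    through-square h (aft d4 eq) = ⊥-elim (σg≢3 (λ h3 → 3≢4 (trans (sym h3) h)) (proj₂ (degree4 d4))
        (cong σ eq))
    through-square h (cubic d3 eq) = finish (around bφd)
      where
      αd≡ : α d ≡ σ (α (σ x))
      αd≡ = φ-inj (begin
        φ (α d)               ≡⟨ φα d ⟩
        e                     ≡⟨ sym (subst (λ k → iter φ k e ≡ e) h (F.iter-period e)) ⟩
        φ (φ (φ (φ e)))       ≡⟨ cong (φ ∘ φ ∘ φ) (trans (cong σ eq) (sym (pred₃ d3))) ⟩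
        φ (φ (φ (α x)))       ≡⟨ cong (φ ∘ φ) (φα x) ⟩
        φ (σ (α (σ x))) ∎)
        where open ≡-Reasoning
      finish : Around (φ d) → x ~ α (σ (φ d))
      finish (around₃ d3′ _) = 1 , trans (sym (α-inv (σ x))) (cong α (σ-inj (trans (sym αd≡) (pred₃ d3′))))
      finish (around₄ d4 _ _ h3) = ⊥-elim
          (3≢4 (trans (sym h3) (trans (cong face (sym (pred₄ d4))) (trans (face-α d) h))))

    -- With the triangle on the far side of `e`, a cubic end meets `aft-triangle`, and an end of
    -- degree 4 would make the face of `e` a triangle too.
    blocked : deg d ≡ 3 → face (σ (σ d)) ≡ 3 → face e ≢ 3 → Inner (φ x) g → x ~ α (σ (φ d))
    blocked d3 h ne (cubic _ eq) = ⊥-elim (aft-triangle bd bφx d3 h eq)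
    blocked d3 h ne (fore d4 eq) = ⊥-elim (σg≢3 ne (proj₁ (degree4 d4)) (cong σ eq))
    blocked d3 h ne (aft d4 eq) = ⊥-elim (σg≢3 ne (proj₂ (degree4 d4)) (cong σ eq))

    through : deg d ≡ 3 → ∀ {a b} → face e ≡ a → face (σ (σ d)) ≡ b → Flank a b → Inner (φ x) g →
        x ~ α (σ (φ d))
    through d3 p q f33 = through-triangle p
    through d3 p q f34 = through-triangle p
    through d3 p q f35 = through-triangle p
    through d3 p q f36 = through-triangle p
    through d3 p q f43 = through-square p
    through d3 p q f44 = through-square p
    through d3 p q f53 = blocked d3 q λ h → case (trans (sym h) p)
      where
      case : 3 ≢ 5
      case ()
    through d3 p q f63 = blocked d3 q λ h → case (trans (sym h) p)
      where
      case : 3 ≢ 6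
      case ()

    go : Around d → Inner (φ x) g → x ~ α (σ (φ d))
    go (around₃ d3 f) i = through d3 refl refl f i
    go (around₄ _ h _ _) i = through-triangle h i

  no-chord′ : ∀ j {d} → Big d → ¬ (iter φ j d ~ α (σ d))
  no-chord′ 0 {d} b o = no-loop (σ d) (~trans (~sym ~σ) o)
  no-chord′ 1 {d} b o = σd≢d d (sym (no-parallel d (σ d) ~σ (~trans ~σ o)))
  no-chord′ (suc (suc j)) {d} b o = no-chord′ j (big-φ b)
    (subst (_~ α (σ (φ d))) iter-comm (chord-step b (subst (42 ≤_) (sym (F.period-orbit (suc j , refl))) b) o))
    where
    iter-comm : iter φ (suc j) d ≡ iter φ j (φ d)
    iter-comm = trans (cong (λ k → iter φ k d) (+-comm 1 j)) (iter-+ φ j 1 d)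

  no-chord : ∀ {d x} → Big d → InOrbit φ d x → ¬ (x ~ α (σ d))
  no-chord b (j , refl) = no-chord′ j b

  -- If a triangle lies between the last two darts of a vertex of a face, its apex is also the end of
  -- the first inner edge at the preceding vertex p.
  preceding-apex : ∀ {t} → face (σ t) ≡ 3 → let p = α (σ t) in φ p ≡ σ (σ t) × σ (α (σ p)) ≡ α t
  preceding-apex {t} h = φα (σ t) , trans (sym (α-inv (φ (σ (α (σ t)))))) (cong α (σ-inj (triangle h)))

  no-aft-chord : ∀ {d x} → Big d → deg d ≡ 4 → face (σ (σ (σ d))) ≡ 3 → InOrbit φ d x → ¬ (x ~ α (σ (σ d)))
  no-aft-chord {d} {x} b d4 h o c = no-chord bp (F.InOrbit-trans (1 , pd) o)
    (~trans c (~sym (1 , proj₂ (preceding-apex h))))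
    where
    pd : φ (α (σ (σ (σ d)))) ≡ d
    pd = trans (proj₁ (preceding-apex h)) (cycle d4)
    bp : Big (α (σ (σ (σ d))))
    bp = subst (42 ≤_) (trans (cong face (sym pd)) (face-φ _)) b

  flank-of : ∀ {x} → Around x → deg x ≡ 3 → Flank (face (σ x)) (face (σ (σ x)))
  flank-of (around₃ _ f) _ = f
  flank-of (around₄ d4 _ _ _) d3 = ⊥-elim (3≢4 (trans (sym d3) d4))

  threes-of : ∀ {x} → Around x → deg x ≡ 4 → face (σ x) ≡ 3 × face (σ (σ x)) ≡ 3 × face (σ (σ (σ x))) ≡ 3
  threes-of (around₄ _ p q r) _ = p , q , r
  threes-of (around₃ d3 _) d4 = ⊥-elim (3≢4 (trans (sym d3) d4))

  left : ∀ {g y} → α g ≡ y → face g ≡ face (σ y)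
  left {g} refl = sym (face-φ g)

  right : ∀ {g y} → α g ≡ y → face (σ g) ≡ face y
  right {g} refl = sym (face-α g)

  big-pred : ∀ {p x} → φ p ≡ x → Big x → Big p
  big-pred {p} eq b = subst (42 ≤_) (trans (cong face (sym eq)) (face-φ p)) b

  inner-~ : ∀ {x g} → Inner x g → x ~ g
  inner-~ (cubic _ refl) = 1 , refl
  inner-~ (fore _ refl) = 1 , refl
  inner-~ (aft _ refl) = 2 , refl

-- Total curvature

module Total {n} (M : CombMap n) (pcc : CombMap.IsPlanarPCC M) where
  open Local M pcc public

  -- With `A` as outflow and `B` as inflow, this says that `2 * S` times the curvature, plus inflow,
  -- minus outflow, is not negative.
  VertexBound : (A B : Fin n → ℕ) → Fin n → Set
  VertexBound A B d = ∑ (orbit σ d) (λ e → S + A e) ≤ 2 * S + ∑ (orbit σ d) (λ e → 2 * w (face e) + B e)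

  vertexBound-~ : ∀ {A B d e} → d ~ e → VertexBound A B d → VertexBound A B e
  vertexBound-~ {A} {B} o = subst₂ _≤_ (V.∑-orbit o _) (cong (2 * S +_) (V.∑-orbit o _))

  ∑-face-weights : ∑ (allFin n) (λ e → 2 * w (face e)) ≡ 2 * (numF * S)
  ∑-face-weights = trans (∑-* (allFin n) 2 (w ∘ face)) (cong (2 *_) (F.∑-weights S w w-face))

  ∑-constant : ∀ c → ∑ (allFin n) (λ _ → c) ≡ n * c
  ∑-constant c = trans (∑-const (allFin n) c) (cong (_* c) (length-tabulate (id {A = Fin n})))

  -- Euler's formula: the vertex terms 2S − deg·S + Σ 2S/|face| add up to 4S.
  module _ (A B : Fin n → ℕ) where
    left-sum : ∑ (reps σ) (λ r → ∑ (orbit σ r) (λ e → S + A e)) ≡ n * S + ∑ (allFin n) A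
    left-sum = trans (V.∑-orbits (λ e → S + A e))
      (trans (∑-+ (allFin n) (λ _ → S) A) (cong (_+ ∑ (allFin n) A) (∑-constant S)))

    right-sum : ∑ (reps σ) (λ r → 2 * S + ∑ (orbit σ r) (λ e → 2 * w (face e) + B e)) ≡ n * S +
        (4 * S + ∑ (allFin n) B)
    right-sum = begin
      ∑ (reps σ) (λ r → 2 * S + ∑ (orbit σ r) C)
          ≡⟨ ∑-+ (reps σ) (λ _ → 2 * S) (λ r → ∑ (orbit σ r) C) ⟩
      ∑ (reps σ) (λ _ → 2 * S) + ∑ (reps σ) (λ r → ∑ (orbit σ r) C)
          ≡⟨ cong₂ _+_ (∑-const (reps σ) (2 * S)) (V.∑-orbits C) ⟩
      numV * (2 * S) + ∑ (allFin n) C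
          ≡⟨ cong (numV * (2 * S) +_) (∑-+ (allFin n) (λ e → 2 * w (face e)) B) ⟩
      numV * (2 * S) + (∑ (allFin n) (λ e → 2 * w (face e)) + ∑ (allFin n) B)
          ≡⟨ cong (λ x → numV * (2 * S) + (x + ∑ (allFin n) B)) ∑-face-weights ⟩
      numV * (2 * S) + (2 * (numF * S) + ∑ (allFin n) B)
          ≡⟨ solve 4 (λ v f s b → v :* (con 2 :* s) :+ (con 2 :* (f :* s) :+ b) :=
          (con 2 :* v :+ con 2 :* f) :* s :+ b) refl numV numF S (∑ (allFin n) B) ⟩
      (2 * numV + 2 * numF) * S + ∑ (allFin n) B
          ≡⟨ cong (λ x → x * S + ∑ (allFin n) B) spherical ⟩
      (n + 4) * S + ∑ (allFin n) B
          ≡⟨ solve 3 (λ k s b → (k :+ con 4) :* s :+ b := k :* s :+ (con 4 :* s :+ b)) refl n S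
          (∑ (allFin n) B) ⟩
      n * S + (4 * S + ∑ (allFin n) B) ∎
      where
      open ≡-Reasoning
      C : Fin n → ℕ
      C e = 2 * w (face e) + B e

    module _ (bound : ∀ d → VertexBound A B d) where
      total : ∑ (allFin n) A ≤ 4 * S + ∑ (allFin n) B
      total = +-cancelˡ-≤ (n * S) _ _ (subst₂ _≤_ left-sum right-sum (∑-mono (reps σ) (λ {r} _ → bound r)))

      -- One strict inequality at a vertex would make the sum strict.
      total-tight : 4 * S + ∑ (allFin n) B ≤ ∑ (allFin n) A → ∀ d →
        2 * S + ∑ (orbit σ d) (λ e → 2 * w (face e) + B e) ≤ ∑ (orbit σ d) (λ e → S + A e)
      total-tight eq d = ≮⇒≥ λ lt → <⇒≱ (strict lt (V.hasRep d)) eq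
        where
        strict : ∑ (orbit σ d) (λ e → S + A e) < 2 * S + ∑ (orbit σ d) (λ e → 2 * w (face e) + B e) →
          (∃ λ r → isRep σ r ≡ true × r ~ d) → ∑ (allFin n) A < 4 * S + ∑ (allFin n) B
        strict lt (r , isr , o) = +-cancelˡ-< (n * S) _ _ (subst₂ _<_ left-sum right-sum
          (∑-mono-< (reps σ) (λ {r} _ → bound r) (V.∈-reps⁺ isr)
            (subst₂ _<_ (V.∑-orbit (~sym o) _) (cong (2 * S +_) (V.∑-orbit (~sym o) _)) lt)))

-- Discharging around a single large face

-- The amount that the vertex of a dart receives from the other end. The first two arguments tell
-- whether this vertex and the other end lie on the large face; the last tells whether the dart is
-- needy.
demand : Bool → Bool → (k a b : ℕ) → Bool → ℕ
demand true true k a b _ = 0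
demand true false k a b _ = if k ≡ᵇ 4 then L / 82 else ask a b
demand false true k a b _ = spare a b
demand false false k a b h = if h then L / 210 else 0

module Discharge {n} (M : CombMap n) (pcc : CombMap.IsPlanarPCC M)
  (one-big : ∀ {d e} → 42 ≤ CombMap.faceSize M d → 42 ≤ CombMap.faceSize M e → InOrbit (CombMap.φ M) d e) where
  open Total M pcc public

  opaque
    onBig : Fin n → Bool
    onBig d = not (allᵇ (λ e → face e <ᵇ 42) (orbit σ d))

    onBig-intro : ∀ {x d} → Big x → x ~ d → onBig d ≡ true
    onBig-intro {x} {d} b o = go _ refl
      where
      go : ∀ y → allᵇ (λ e → face e <ᵇ 42) (orbit σ d) ≡ y → not y ≡ true
      go false _ = refl
      go true eq = ⊥-elim (<⇒≱ (<ᵇ⇒< (face x) 42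
          (subst T (sym (allᵇ-sound _ (orbit σ d) eq (V.∈-orbit⁺ (~sym o)))) _)) b)

    onBig-elim : ∀ {d} → onBig d ≡ true → ∃ λ x → Big x × x ~ d
    onBig-elim {d} = go _ refl
      where
      found : (∃ λ x → x ∈ orbit σ d × (face x <ᵇ 42) ≡ false) → ∃ λ x → Big x × x ~ d
      found (x , m , x≮) = x , ≮⇒≥ (λ lt → subst T x≮ (<⇒<ᵇ lt)) , ~sym (V.∈-orbit⁻ m)
      go : ∀ y → allᵇ (λ e → face e <ᵇ 42) (orbit σ d) ≡ y → not y ≡ true → ∃ λ x → Big x × x ~ d
      go false eq _ = found (allᵇ-false _ (orbit σ d) eq)

  Off : Fin n → Set
  Off d = onBig d ≡ false

  off-¬Big : ∀ {d e} → Off d → d ~ e → ¬ Big e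
  off-¬Big off o b with () ← trans (sym off) (onBig-intro b (~sym o))

  onBig-~ : ∀ {d e} → d ~ e → onBig d ≡ onBig e
  onBig-~ {d} {e} o = go _ _ refl refl
    where
    go : ∀ x y → onBig d ≡ x → onBig e ≡ y → x ≡ y
    go true true _ _ = refl
    go false false _ _ = refl
    go true false p q = let x , b , x~d = onBig-elim p in trans (sym (onBig-intro b (~trans x~d o))) q
    go false true p q = let x , b , x~e = onBig-elim q in trans (sym p) (onBig-intro b (~trans x~e (~sym o)))

  off-σ : ∀ {d} → Off d → Off (σ d)
  off-σ off = trans (sym (onBig-~ ~σ)) off

  data Head (g : Fin n) : Set where
    away : Off (α g) → Head g
    at : ∀ {x} → Big x → Inner x (α g) → Head g

  head : ∀ {g} → Off g → Head g
  head {g} off = go _ refl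
    where
    -- Were `α g` a boundary dart at `x`, the vertex of `g` would have a large corner as well.
    at-big : (∃ λ x → Big x × x ~ α g) → Head g
    at-big (x , b , o) = at b (inner b o
      (λ eq → off-¬Big off ~σ (subst Big (φα g) (big-φ (subst Big (sym eq) b))))
      (λ eq → off-¬Big off ~refl (subst (42 ≤_) (face-φ g) (subst Big (sym eq) b))))
    go : ∀ y → onBig (α g) ≡ y → Head g
    go false eq = away eq
    go true eq = at-big (onBig-elim eq)

  kindOf : ∀ {g} → Head g → Kind
  kindOf (away _) = none
  kindOf (at _ (cubic _ _)) = cubic
  kindOf (at _ (fore _ _)) = fore
  kindOf (at _ (aft _ _)) = aft

  head-on : ∀ {x g} → Big x → Inner x (α g) → onBig (α g) ≡ true
  head-on b i = onBig-intro b (inner-~ i)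

  kind-onBig : ∀ {g} (h : Head g) → not (isNone (kindOf h)) ≡ onBig (α g)
  kind-onBig (away off) = sym off
  kind-onBig (at b i@(cubic _ _)) = sym (head-on b i)
  kind-onBig (at b i@(fore _ _)) = sym (head-on b i)
  kind-onBig (at b i@(aft _ _)) = sym (head-on b i)

  flank-at : ∀ {x g} → Big x → deg x ≡ 3 → α g ≡ σ x → Flank (face g) (face (σ g))
  flank-at b d3 eq = subst₂ Flank (sym (left eq)) (sym (right eq)) (flank-swap (flank-of (around b) d3))

  fits-head : ∀ {g} (h : Head g) → fits (kindOf h) (face g) (face (σ g)) ≡ true
  fits-head (away _) = refl
  fits-head (at b (cubic d3 eq)) = flank-complete (flank-at b d3 eq)
  fits-head (at b (fore d4 eq)) rewrite left eq | right eq =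
    let p , q , _ = threes-of (around b) d4 in cong₂ (λ a c → (a ≡ᵇ 3) ∧ (c ≡ᵇ 3)) q p
  fits-head (at b (aft d4 eq)) rewrite left eq | right eq =
    let _ , q , r = threes-of (around b) d4 in cong₂ (λ a c → (a ≡ᵇ 3) ∧ (c ≡ᵇ 3)) r q

  -- The triangle between `g` and `σ g` has the edge `x` of the large face as its third side, so
  -- `σ g` leads to the next vertex `φ x`, arriving there as its last inner dart.
  next-apex : ∀ {x g} → α g ≡ σ x → face (σ g) ≡ 3 → σ (σ (α (σ g))) ≡ φ x
  next-apex {x} {g} eq h = cong σ (trans (cong (σ ∘ α) (sym φσx≡)) (triangle-last (trans (sym (right eq)) h)))
    where
    φσx≡ : φ (σ x) ≡ σ g
    φσx≡ = trans (cong φ (sym eq)) (φα g)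

  -- The reverse direction: `σ g` arrives as the last inner dart at `x`, so across the triangle `g`
  -- arrives as the first inner dart at the preceding vertex.
  previous-apex : ∀ {x g} → σ (σ (α (σ g))) ≡ x → face (σ g) ≡ 3 → ∃ λ p → φ p ≡ x × α g ≡ σ p
  previous-apex {x} {g} eq h = p , trans (proj₁ apex) eq , trans (cong α (sym ασp≡)) (α-inv (σ p))
    where
    p = α (σ (α (σ g)))
    apex = preceding-apex {α (σ g)} (trans (face-φ (σ g)) h)
    ασp≡ : α (σ p) ≡ g
    ασp≡ = σ-inj (trans (proj₂ apex) (α-inv (σ g)))

  ¬followed-away : ∀ {x g} → Big x → α g ≡ σ x → face (σ g) ≡ 3 → ¬ Off (α (σ g))
  ¬followed-away b eq h off = off-¬Big off (2 , next-apex eq h) (big-φ b)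

  ¬follows-away : ∀ {x g} → Big x → σ (σ (α (σ g))) ≡ x → face (σ g) ≡ 3 → ¬ Off (α g)
  ¬follows-away b eq h off = let p , φp , αg = previous-apex eq h in
    off-¬Big off (~sym (1 , sym αg)) (big-pred φp b)

  not3 : ∀ {c} → c ≢ 3 → not (c ≡ᵇ 3) ≡ true
  not3 {c} ne = go (c ≡ᵇ 3) refl
    where
    go : ∀ y → (c ≡ᵇ 3) ≡ y → not y ≡ true
    go false _ = refl
    go true eq = ⊥-elim (ne (≡ᵇ≡⇒≡ eq))

  third-σ : ∀ {x y} → deg x ≡ 4 → α y ≡ σ x → σ (σ (α y)) ≢ x
  third-σ {x} d4 eq eq′ = σd≢d x (trans (cong σ (trans (sym eq′) (cong (σ ∘ σ) eq))) (cycle d4))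

  around-fore : ∀ {x g} → Big x → deg x ≡ 4 → α g ≡ σ x → face (σ g) ≡ 3
  around-fore b d4 eq = trans (right eq) (proj₁ (threes-of (around b) d4))

  around-aft : ∀ {x g} → Big x → deg x ≡ 4 → α (σ g) ≡ σ (σ x) → face (σ g) ≡ 3
  around-aft b d4 eq = trans (left eq) (proj₂ (proj₂ (threes-of (around b) d4)))

  -- Crossing a triangle based on the large face moves one vertex along it. A fore dart is always
  -- followed by such a triangle, and the next dart is then the last inner one of its end, so it is
  -- aft or cubic. Dually an aft dart is preceded by a fore or cubic one. For a cubic dart the
  -- crossing is forced when the face between the two darts is a triangle.
  follows-head : ∀ {g} (h : Head g) (h′ : Head (σ g)) → follows (kindOf h) (face (σ g)) (kindOf h′) ≡ true
  follows-head (away _) (away _) = refl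
  follows-head (away _) (at _ (fore _ _)) = refl
  follows-head (away off) (at b (aft d4 eq)) = ⊥-elim
    (¬follows-away b (trans (cong (σ ∘ σ) eq) (cycle d4)) (around-aft b d4 eq) off)
  follows-head (away off) (at b (cubic d3 eq)) = not3 λ h →
    ¬follows-away b (trans (cong (σ ∘ σ) eq) (cycle d3)) h off
  follows-head (at b (fore d4 eq)) (away off) = ⊥-elim (¬followed-away b eq (around-fore b d4 eq) off)
  follows-head (at b (fore d4 eq)) (at b′ (fore d4′ eq′)) = ⊥-elim (third-σ d4′ eq′ (sym
    (big-unique b′ (subst Big (sym nx) (big-φ b)) (~trans (1 , sym eq′) (2 , refl)))))
    where nx = next-apex eq (around-fore b d4 eq)
  follows-head (at _ (fore _ _)) (at _ (aft _ _)) = refl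
  follows-head (at _ (fore _ _)) (at _ (cubic _ _)) = refl
  follows-head (at _ (aft _ _)) (away _) = refl
  follows-head (at _ (aft _ _)) (at _ (fore _ _)) = refl
  follows-head (at {x} b (aft d4 eq)) (at b′ (aft d4′ eq′)) = ⊥-elim (clash
    (previous-apex (trans (cong (σ ∘ σ) eq′) (cycle d4′)) (around-aft b′ d4′ eq′)))
    where
    clash : ¬ (∃ λ p → φ p ≡ _ × α _ ≡ σ p)
    clash (p , φp , αg) = σd≢d (σ x) (sym (trans (cong σ (big-unique b (big-pred φp b′)
      (~trans (2 , sym eq) (~sym (1 , sym αg))))) (trans (sym αg) eq)))
  follows-head (at _ (aft _ _)) (at _ (cubic _ _)) = refl
  follows-head (at b (cubic d3 eq)) (away off) = not3 λ h → ¬followed-away b eq h off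
  follows-head (at _ (cubic _ _)) (at _ (fore _ _)) = refl
  follows-head (at _ (cubic _ _)) (at _ (aft _ _)) = refl
  follows-head (at _ (cubic _ _)) (at _ (cubic _ _)) = refl

-- Index 0 is the large corner with weight `X`, index 1 the inner edge, index 2 the other boundary
-- edge. Here `m` is the factor `n !`, and `s`, `a`, `q` are what is passed on, asked for and kept.
-- The terms in `X` cancel, so the size of the large face does not enter.
bigBound₃ : ∀ m X b c s a q {A₀ A₁ A₂ C₀ C₁ C₂} → 3 * L + 2 * s + 2 * q ≤ 2 * L + (2 * b + 2 * c) + 2 * a →
  A₀ ≡ 2 * X + 2 * q * m → A₁ ≡ m * (2 * s) → A₂ ≡ 0 →
  C₀ ≡ 2 * X → C₁ ≡ 2 * (b * m) + m * (2 * a) → C₂ ≡ 2 * (c * m) →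
  (L * m + A₀) + ((L * m + A₁) + ((L * m + A₂) + 0)) ≤ 2 * (L * m) + (C₀ + (C₁ + (C₂ + 0)))
bigBound₃ m X b c s a q h refl refl refl refl refl refl = begin
  (L * m + (2 * X + 2 * q * m)) + ((L * m + m * (2 * s)) + ((L * m + 0) + 0))
    ≡⟨ solve 5 (λ l m x q s → (l :* m :+ (con 2 :* x :+ con 2 :* q :* m)) :+ ((l :* m :+ m :* (con 2 :* s)) :+
        ((l :* m :+ con 0) :+ con 0))
        := con 2 :* x :+ (con 3 :* l :+ con 2 :* s :+ con 2 :* q) :* m) refl L m X q s ⟩
  2 * X + (3 * L + 2 * s + 2 * q) * m  ≤⟨ +-monoʳ-≤ (2 * X) (*-monoˡ-≤ m h) ⟩
  2 * X + (2 * L + (2 * b + 2 * c) + 2 * a) * m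
    ≡⟨ solve 6 (λ l m x b c a → con 2 :* x :+ (con 2 :* l :+ (con 2 :* b :+ con 2 :* c) :+ con 2 :* a) :* m
        := con 2 :* (l :* m) :+ (con 2 :* x :+ ((con 2 :* (b :* m) :+ m :* (con 2 :* a)) :+
            (con 2 :* (c :* m) :+ con 0)))) refl L m X b c a ⟩
  2 * (L * m) + (2 * X + ((2 * (b * m) + m * (2 * a)) + (2 * (c * m) + 0))) ∎
  where open ≤-Reasoning

bigBound₄ : ∀ m X b a q {A₀ A₁ A₂ A₃ C₀ C₁ C₂ C₃} → 4 * L + 2 * q ≤ 2 * L + (2 * b + (2 * b + 2 * b)) + 2 *
    (a + a) →
  A₀ ≡ 2 * X + 2 * q * m → A₁ ≡ 0 → A₂ ≡ 0 → A₃ ≡ 0 →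
  C₀ ≡ 2 * X → C₁ ≡ 2 * (b * m) + m * (2 * a) → C₂ ≡ 2 * (b * m) + m * (2 * a) → C₃ ≡ 2 * (b * m) →
  (L * m + A₀) + ((L * m + A₁) + ((L * m + A₂) + ((L * m + A₃) + 0))) ≤ 2 * (L * m) +
      (C₀ + (C₁ + (C₂ + (C₃ + 0))))
bigBound₄ m X b a q h refl refl refl refl refl refl refl refl = begin
  (L * m + (2 * X + 2 * q * m)) + ((L * m + 0) + ((L * m + 0) + ((L * m + 0) + 0)))
    ≡⟨ solve 4 (λ l m x q → (l :* m :+ (con 2 :* x :+ con 2 :* q :* m)) :+
        ((l :* m :+ con 0) :+ ((l :* m :+ con 0) :+ ((l :* m :+ con 0) :+ con 0)))
        := con 2 :* x :+ (con 4 :* l :+ con 2 :* q) :* m) refl L m X q ⟩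
  2 * X + (4 * L + 2 * q) * m  ≤⟨ +-monoʳ-≤ (2 * X) (*-monoˡ-≤ m h) ⟩
  2 * X + (2 * L + (2 * b + (2 * b + 2 * b)) + 2 * (a + a)) * m
    ≡⟨ solve 5 (λ l m x b a → con 2 :* x :+ (con 2 :* l :+ (con 2 :* b :+ (con 2 :* b :+ con 2 :* b)) :+
        con 2 :* (a :+ a)) :* m
        := con 2 :* (l :* m) :+ (con 2 :* x :+ ((con 2 :* (b :* m) :+ m :* (con 2 :* a)) :+
            ((con 2 :* (b :* m) :+ m :* (con 2 :* a)) :+ (con 2 :* (b :* m) :+ con 0))))) refl L m X b a ⟩
  2 * (L * m) + (2 * X + ((2 * (b * m) + m * (2 * a)) + ((2 * (b * m) + m * (2 * a)) + (2 * (b * m) + 0)))) ∎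
  where open ≤-Reasoning

-- Demands along the edges and their balance

module Demand {n} (M : CombMap n) (pcc : CombMap.IsPlanarPCC M)
  (one-big : ∀ {d e} → 42 ≤ CombMap.faceSize M d → 42 ≤ CombMap.faceSize M e → InOrbit (CombMap.φ M) d e) where
  open Discharge M pcc one-big public

  off-intro : ∀ {d} → (∀ {x} → Big x → ¬ (x ~ d)) → Off d
  off-intro {d} h = go _ refl
    where
    go : ∀ y → onBig d ≡ y → y ≡ false
    go false _ = refl
    go true eq = let x , b , o = onBig-elim eq in ⊥-elim (h b o)

  off-first : ∀ {x} → Big x → Off (α (σ x))
  off-first b = off-intro λ b′ → no-chord b (one-big b b′)

  off-second : ∀ {x} → Big x → deg x ≡ 4 → Off (α (σ (σ x)))
  off-second b d4 = off-intro λ b′ → no-aft-chord b d4 (proj₂ (proj₂ (threes-of (around b) d4))) (one-big b b′)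

  needy : Fin n → Bool
  needy d = needyᵇ (deg d) (face d) (face (σ d)) (face (σ (σ d))) (face (σ (σ (σ d))))
    (onBig (α (σ d))) (onBig (α (σ (σ (σ d)))))

  dem : Fin n → ℕ
  dem d = demand (onBig d) (onBig (α d)) (deg d) (face d) (face (σ d)) (needy d)

  3≢6 : 3 ≢ 6
  3≢6 ()

  -- The inner edges at both ends of the edge that the hexagon has on the large face join it to
  -- vertices off that face, so the large face cannot meet the hexagon again.
  needy-hexagon : ∀ {d} → Off d → Off (α d) → face (σ d) ≡ 6 → onBig (α (σ d)) ≡ true →
    deg (α d) ≡ 4 → face (σ (σ (σ (α d)))) ≡ 3 → onBig (α (σ (σ (σ (α d))))) ≡ true → ⊥
  needy-hexagon {d} off off′ six on d4 three on′ = first (head (off-σ off))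
    where
    back : ∀ {x} → Big x → deg x ≡ 3 → α (σ d) ≡ σ x → ⊥
    back {x} bx d3 eq = last (onBig-elim on-y)
      where
      p = α (σ (σ x))
      bp : Big p
      bp = big-pred (ασ-pred d3) bx
      y = φ (φ (σ p))
      y≡ : y ≡ φ (φ (φ (φ (σ d))))
      y≡ = cong (φ ∘ φ ∘ φ) (cong σ (sym eq))
      face-y : face y ≡ 6
      face-y = trans (cong face y≡) (trans (face-φ _)
          (trans (face-φ _) (trans (face-φ _) (trans (face-φ _) six))))
      φy≡ : φ y ≡ α d
      φy≡ = φ-inj (trans (cong (φ ∘ φ) y≡) (trans (subst (λ k → iter φ k (σ d) ≡ σ d) six (F.iter-period (σ d)))
          (sym (φα d))))
      αy≡ : α y ≡ σ (σ (σ (α d)))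
      αy≡ = σ-inj (trans φy≡ (sym (cycle d4)))
      on-y : onBig y ≡ true
      on-y = trans (cong onBig (trans (sym (α-inv y)) (cong α αy≡))) on′
      touch : ∀ {q} → Big q → Inner q y → ⊥
      meet : ∀ {q} → Big q → y ≡ σ q → ⊥
      meet {q} bq eqy = no-chord bp (one-big bp (big-φ bq)) (~trans (~sym (1 , refl)) (~sym
        (1 , trans (sym (α-inv (φ (σ p)))) (cong α (σ-inj eqy)))))
      touch bq (cubic _ eqy) = meet bq eqy
      touch bq (fore _ eqy) = meet bq eqy
      touch bq (aft d4q eqy) = 3≢6 (trans (sym (proj₁ (proj₂ (threes-of (around bq) d4q))))
          (trans (cong face (sym eqy)) face-y))
      last : (∃ λ q → Big q × q ~ y) → ⊥
      last (q , bq , o) = touch bq (inner bq o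
        (λ eq → ≤6⇒¬Big (≤-reflexive face-y) (subst Big (sym eq) bq))
        (λ eq → ≡3⇒¬Big (trans (sym (face-α y)) (trans (cong face αy≡) three)) (subst Big (sym eq) bq)))
    first : Head (σ d) → ⊥
    first (away o) with () ← trans (sym on) o
    first (at b (cubic d3 eq)) = back b d3 eq
    first (at b (fore d4x eq)) = 3≢6 (trans (sym (proj₁ (proj₂ (threes-of (around b) d4x))))
        (trans (sym (left eq)) six))
    first (at b (aft d4x eq)) = 3≢6 (trans (sym (proj₂ (proj₂ (threes-of (around b) d4x))))
        (trans (sym (left eq)) six))

  5≢6 : 5 ≢ 6
  5≢6 ()

  Needy : Fin n → Set
  Needy d = deg d ≡ 4 × face (σ (σ d)) ≡ 3 × face (σ (σ (σ d))) ≡ 3 ×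
    (face d ≡ 5 × face (σ d) ≡ 6 × onBig (α (σ d)) ≡ true ⊎ face d ≡ 6 × face (σ d) ≡ 5 × onBig
        (α (σ (σ (σ d)))) ≡ true)

  needy-parts : ∀ {d} → needy d ≡ true → Needy d
  needy-parts {d} = needy-elim {deg d}

  -- Seen from the two ends, pentagon and hexagon change places, so both ends cannot satisfy the
  -- same alternative. In the mixed case both other edges of the hexagon at these ends lead to the
  -- large face, which `needy-hexagon` excludes. Hence the end that supplies L / 210 is not itself
  -- needy along this edge.
  needy-once : ∀ {d} → Off d → Off (α d) → needy d ≡ true → needy (α d) ≡ true → ⊥
  needy-once {d} off off′ p q = go (needy-parts p) (needy-parts q)
    where
    αα : α (α d) ≡ d
    αα = α-inv d
    go : Needy d → Needy (α d) → ⊥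
    go (_ , _ , _ , inj₁ (_ , six , on)) (d4 , _ , three , inj₂ (_ , _ , on′)) =
        needy-hexagon off off′ six on d4 three on′
    go (d4 , _ , three , inj₂ (_ , _ , on′)) (_ , _ , _ , inj₁ (_ , six , on)) =
        needy-hexagon off′ (trans (cong onBig αα) off) six on
      (trans (cong deg αα) d4) (trans (cong (λ x → face (σ (σ (σ x)))) αα) three)
          (trans (cong (λ x → onBig (α (σ (σ (σ x))))) αα) on′)
    go (_ , _ , _ , inj₁ (_ , six , _)) (_ , _ , _ , inj₁ (five , _ , _)) =
        5≢6 (trans (sym five) (trans (face-α d) six))
    go (_ , _ , _ , inj₂ (_ , five , _)) (_ , _ , _ , inj₂ (six , _ , _)) =
        5≢6 (trans (sym five) (trans (sym (face-α d)) six))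

  module _ {g g₁ g₂ g₃ k} (off : Off g) (dk : deg g ≡ k) (e₁ : σ g ≡ g₁) (e₂ : σ g₁ ≡ g₂) (e₃ : σ g₂ ≡ g₃)
    (h : Head g) (h₁ : Head g₁) (h₃ : Head g₃) where

    needy≡ : needy g ≡ needyᵇ k (face g) (face g₁) (face g₂) (face g₃) (not (isNone (kindOf h₁)))
        (not (isNone (kindOf h₃)))
    needy≡ rewrite sym dk | kind-onBig h₁ | kind-onBig h₃ | sym e₃ | sym e₂ | sym e₁ = refl

    dem≡gain : dem g ≡ gain k (face g) (face g₁) (face g₂) (face g₃) (kindOf h) (kindOf h₁) (kindOf h₃)
    dem≡gain = go h
      where
      off-on : onBig (α g) ≡ true → dem g ≡ spare (face g) (face g₁)
      off-on on = trans (cong₂ (λ x y → demand x y (deg g) (face g) (face (σ g)) (needy g)) off on)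
        (cong (spare (face g) ∘ face) e₁)
      go : (h : Head g) → dem g ≡ gain k (face g) (face g₁) (face g₂) (face g₃) (kindOf h) (kindOf h₁)
          (kindOf h₃)
      go (away o) = trans (cong₂ (λ x y → demand x y (deg g) (face g) (face (σ g)) (needy g)) off o)
        (cong (λ b → if b then L / 210 else 0) needy≡)
      go (at b i@(cubic _ _)) = off-on (head-on b i)
      go (at b i@(fore _ _)) = off-on (head-on b i)
      go (at b i@(aft _ _)) = off-on (head-on b i)

    -- Only an inequality, because the corners at `g` do not show whether the other end is needy:
    -- `loss` charges L / 210 for every edge between a pentagon and a hexagon that is not needy at
    -- `g`.
    dem≤loss : dem (α g) ≤ loss k (face g) (face g₁) (face g₂) (face g₃) (kindOf h) (kindOf h₁) (kindOf h₃)
    dem≤loss = go h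
      where
      off′ : Off (α (α g))
      off′ = trans (cong onBig (α-inv g)) off
      face-αg : face (α g) ≡ face g₁
      face-αg = trans (face-α g) (cong face e₁)
      dem-α : ∀ {y} → onBig (α g) ≡ y → dem (α g) ≡ demand y false (deg (α g)) (face g₁) (face g) (needy (α g))
      dem-α {y} on = trans (cong₂ (λ x y → demand x y (deg (α g)) (face (α g)) (face (σ (α g))) (needy (α g)))
          on off′)
        (cong₂ (λ a c → demand y false (deg (α g)) a c (needy (α g))) face-αg (face-σα g))
      quartic : ∀ {x} → Big x → Inner x (α g) → deg x ≡ 4 → dem (α g) ≡ L / 82
      quartic b i d4 = trans (dem-α (head-on b i)) (cong (λ j → if j ≡ᵇ 4 then L / 82 else ask (face g₁)
          (face g))
        (trans (V.period-orbit (inner-~ i)) d4))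
      unneedy : needy (α g) ≡ true → Off (α g) → ∀ z → needyᵇ k (face g) (face g₁) (face g₂) (face g₃)
          (not (isNone (kindOf h₁))) (not (isNone (kindOf h₃))) ≡ z → z ≡ false
      unneedy q o true eq = ⊥-elim (needy-once off o (trans needy≡ eq) q)
      unneedy q o false _ = refl
      pentagonHexagon-of : needy (α g) ≡ true → pentagonHexagon (face g) (face g₁) ≡ true
      pentagonHexagon-of q = pick (needy-parts q)
        where
        pick : Needy (α g) → pentagonHexagon (face g) (face g₁) ≡ true
        pick (_ , _ , _ , inj₁ (p , q , _)) = cong₂ pentagonHexagon (trans (sym (face-σα g)) q)
            (trans (sym face-αg) p)
        pick (_ , _ , _ , inj₂ (p , q , _)) = cong₂ pentagonHexagon (trans (sym (face-σα g)) q)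
            (trans (sym face-αg) p)
      fetch : Off (α g) → ∀ y → needy (α g) ≡ y → (if y then L / 210 else 0) ≤
        loss k (face g) (face g₁) (face g₂) (face g₃) none (kindOf h₁) (kindOf h₃)
      fetch o false _ = z≤n
      fetch o true q = ≤-reflexive (sym (cong₂ (λ x y → if x ∧ not y then L / 210 else 0) (pentagonHexagon-of q)
          (unneedy q o _ refl)))
      go : (h : Head g) → dem (α g) ≤ loss k (face g) (face g₁) (face g₂) (face g₃) (kindOf h) (kindOf h₁)
          (kindOf h₃)
      go (away o) = ≤-trans (≤-reflexive (dem-α o)) (fetch o _ refl)
      go (at b i@(fore d4 _)) = ≤-reflexive (quartic b i d4)
      go (at b i@(aft d4 _)) = ≤-reflexive (quartic b i d4)
      go (at b i@(cubic d3 eq)) = ≤-reflexive (trans (dem-α (head-on b i))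
        (trans (cong (λ j → if j ≡ᵇ 4 then L / 82 else ask (face g₁) (face g))
            (trans (V.period-orbit (inner-~ i)) d3))
          (sym (ask-swap (subst (Flank (face g)) (cong face e₁) (flank-at b d3 eq))))))

  fits-next : ∀ {g g₁} → σ g ≡ g₁ → (h : Head g) → fits (kindOf h) (face g) (face g₁) ≡ true
  fits-next refl h = fits-head h

  follows-next : ∀ {g g₁} → σ g ≡ g₁ → (h : Head g) (h₁ : Head g₁) →
      follows (kindOf h) (face g₁) (kindOf h₁) ≡ true
  follows-next refl h h₁ = follows-head h h₁

  -- What a vertex of the large face has to keep after all transfers, 1/N + 1/41 in units of 1 / (2
  -- S), entered at its large corner.
  bonus : Fin n → ℕ
  bonus e = if 42 ≤ᵇ face e then 2 * w (face e) + 2 * (L / 41) * n ! else 0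

  bonus-big : ∀ {e} → Big e → bonus e ≡ 2 * w (face e) + 2 * (L / 41) * n !
  bonus-big {e} b = cong (λ y → if y then 2 * w (face e) + 2 * (L / 41) * n ! else 0) (≤⇒≤ᵇ≡ b)

  bonus-small : ∀ {e} → ¬ Big e → bonus e ≡ 0
  bonus-small {e} ¬b = go (42 ≤ᵇ face e) refl
    where
    go : ∀ y → (42 ≤ᵇ face e) ≡ y → (if y then 2 * w (face e) + 2 * (L / 41) * n ! else 0) ≡ 0
    go false _ = refl
    go true eq = ⊥-elim (¬b (≤ᵇ≡⇒≤ eq))

  -- A dart sends what its partner demands. The bonus is outflow that arrives nowhere, so its total
  -- is bounded by the total curvature.
  A B : Fin n → ℕ
  A e = bonus e + n ! * (2 * dem (α e))
  B e = n ! * (2 * dem e)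

  balance-sum : ∀ es {gs ls} → Pointwise (λ e g → dem e ≡ g) es gs → Pointwise (λ e l → dem (α e) ≤ l) es ls →
    Balanced (map face es) (sum gs) (sum ls) →
    ∑ es (λ e → L + 2 * dem (α e)) ≤ 2 * L + ∑ es (λ e → 2 * u (face e) + 2 * dem e)
  balance-sum es {gs} {ls} pg pl bal = begin
    ∑ es (λ e → L + 2 * dem (α e))                     ≤⟨ losses pl ⟩
    length (map face es) * L + 2 * sum ls              ≤⟨ bal ⟩
    2 * L + ∑ (map face es) (λ c → 2 * u c) + 2 * sum gs   ≡⟨ +-assoc (2 * L) _ _ ⟩
    2 * L + (∑ (map face es) (λ c → 2 * u c) + 2 * sum gs) ≡⟨ cong (2 * L +_) (gains pg) ⟩
    2 * L + ∑ es (λ e → 2 * u (face e) + 2 * dem e) ∎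
    where
    open ≤-Reasoning
    losses : ∀ {es ls} → Pointwise (λ e l → dem (α e) ≤ l) es ls →
      ∑ es (λ e → L + 2 * dem (α e)) ≤ length (map face es) * L + 2 * sum ls
    losses [] = z≤n
    losses {e ∷ es} {l ∷ ls} (p ∷ ps) = ≤-trans (+-mono-≤ (+-monoʳ-≤ L (*-monoʳ-≤ 2 p)) (losses ps))
      (≤-reflexive (solve 4 (λ x y z t → (x :+ con 2 :* y) :+ (z :+ con 2 :* t) :=
          x :+ z :+ con 2 :* (y :+ t)) refl L l (length (map face es) * L) (sum ls)))
    gains : ∀ {es gs} → Pointwise (λ e g → dem e ≡ g) es gs →
      ∑ (map face es) (λ c → 2 * u c) + 2 * sum gs ≡ ∑ es (λ e → 2 * u (face e) + 2 * dem e)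
    gains [] = refl
    gains {e ∷ es} {_ ∷ gs} (refl ∷ ps) = trans
      (solve 4 (λ x y z t → x :+ y :+ con 2 :* (z :+ t) := (x :+ con 2 :* z) :+ (y :+ con 2 :* t)) refl
        (2 * u (face e)) (∑ (map face es) (λ c → 2 * u c)) (dem e) (sum gs))
      (cong (2 * u (face e) + 2 * dem e +_) (gains ps))

  off-small : ∀ {d e} → Off d → d ~ e → Small (face e)
  off-small {d} {e} off o = face≥3 e , s≤s⁻¹ (≰⇒> (off-¬Big off o))

  positive-off : ∀ {d k} → Off d → deg d ≡ k → Positive (map face (map (λ j → iter σ j d) (upTo k)))
  positive-off {d} off refl = subst Positive (uncapped (orbit σ d) λ m → off-small off (V.∈-orbit⁻ m))
      (positive-corners d)
    where
    uncapped : ∀ es → (∀ {e} → e ∈ es → Small (face e)) → map cap es ≡ map face es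
    uncapped [] h = refl
    uncapped (e ∷ es) h = cong₂ _∷_ (m≤n⇒m⊓n≡m (m≤n⇒m≤1+n (proj₂ (h (here refl))))) (uncapped es (h ∘ there))

  OffBound : Fin n → Set
  OffBound d = ∑ (orbit σ d) (λ e → L + 2 * dem (α e)) ≤ 2 * L + ∑ (orbit σ d) (λ e →
      2 * u (face e) + 2 * dem e)

  offBound : ∀ {d} → Off d → OffBound d
  offBound {d} off = go (degree d)
    where
    along : ∀ {k} → deg d ≡ k → let es = map (λ j → iter σ j d) (upTo k) in
      ∑ es (λ e → L + 2 * dem (α e)) ≤ 2 * L + ∑ es (λ e → 2 * u (face e) + 2 * dem e) → OffBound d
    along refl h = h
    o₀ = off
    o₁ = off-σ o₀
    o₂ = off-σ o₁
    o₃ = off-σ o₂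
    o₄ = off-σ o₃
    small : ∀ j → Small (face (iter σ j d))
    small j = off-small off (j , refl)
    degs : ∀ {k} → deg d ≡ k → ∀ j → deg (iter σ j d) ≡ k
    degs eq j = trans (V.period-orbit (j , refl)) eq
    go : Degree d → OffBound d
    -- The equation `c` stands wherever a step of the rotation closes up at `d`; the other steps
    -- hold by computation.
    go (deg₃ eq) = along eq (balance-sum _
      (dem≡gain o₀ (degs eq 0) refl refl c h₀ h₁ h₀ ∷ dem≡gain o₁ (degs eq 1) refl c refl h₁ h₂ h₁ ∷
       dem≡gain o₂ (degs eq 2) c refl refl h₂ h₀ h₂ ∷ [])
      (dem≤loss o₀ (degs eq 0) refl refl c h₀ h₁ h₀ ∷ dem≤loss o₁ (degs eq 1) refl c refl h₁ h₂ h₁ ∷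
       dem≤loss o₂ (degs eq 2) c refl refl h₂ h₀ h₂ ∷ [])
      (balanced₃ (small 0) (small 1) (small 2) (positive-off off eq) (kindOf h₀) (kindOf h₁) (kindOf h₂)
        (fits-next refl h₀) (fits-next refl h₁) (fits-next c h₂)
        (follows-next refl h₀ h₁) (follows-next refl h₁ h₂) (follows-next c h₂ h₀)))
      where
      c = cycle eq
      h₀ = head o₀
      h₁ = head o₁
      h₂ = head o₂
    go (deg₄ eq) = along eq (balance-sum _
      (dem≡gain o₀ (degs eq 0) refl refl refl h₀ h₁ h₃ ∷ dem≡gain o₁ (degs eq 1) refl refl c h₁ h₂ h₀ ∷
       dem≡gain o₂ (degs eq 2) refl c refl h₂ h₃ h₁ ∷ dem≡gain o₃ (degs eq 3) c refl refl h₃ h₀ h₂ ∷ [])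
      (dem≤loss o₀ (degs eq 0) refl refl refl h₀ h₁ h₃ ∷ dem≤loss o₁ (degs eq 1) refl refl c h₁ h₂ h₀ ∷
       dem≤loss o₂ (degs eq 2) refl c refl h₂ h₃ h₁ ∷ dem≤loss o₃ (degs eq 3) c refl refl h₃ h₀ h₂ ∷ [])
      (balanced₄ (small 0) (small 1) (small 2) (small 3) (positive-off off eq) (kindOf h₀) (kindOf h₁)
          (kindOf h₂) (kindOf h₃)
        (fits-next refl h₀) (fits-next refl h₁) (fits-next refl h₂) (fits-next c h₃)
        (follows-next refl h₀ h₁) (follows-next refl h₁ h₂) (follows-next refl h₂ h₃) (follows-next c h₃ h₀)))
      where
      c = cycle eq
      h₀ = head o₀
      h₁ = head o₁
      h₂ = head o₂
      h₃ = head o₃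
    go (deg₅ eq) = along eq (balance-sum _
      (dem≡gain o₀ (degs eq 0) refl refl refl h₀ h₁ h₃ ∷ dem≡gain o₁ (degs eq 1) refl refl refl h₁ h₂ h₄ ∷
       dem≡gain o₂ (degs eq 2) refl refl c h₂ h₃ h₀ ∷ dem≡gain o₃ (degs eq 3) refl c refl h₃ h₄ h₁ ∷
       dem≡gain o₄ (degs eq 4) c refl refl h₄ h₀ h₂ ∷ [])
      (dem≤loss o₀ (degs eq 0) refl refl refl h₀ h₁ h₃ ∷ dem≤loss o₁ (degs eq 1) refl refl refl h₁ h₂ h₄ ∷
       dem≤loss o₂ (degs eq 2) refl refl c h₂ h₃ h₀ ∷ dem≤loss o₃ (degs eq 3) refl c refl h₃ h₄ h₁ ∷
       dem≤loss o₄ (degs eq 4) c refl refl h₄ h₀ h₂ ∷ [])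
      (balanced₅ (small 0) (small 1) (small 2) (small 3) (small 4) (positive-off off eq)
        (kindOf h₀) (kindOf h₁) (kindOf h₂) (kindOf h₃) (kindOf h₄)
        (fits-next refl h₀) (fits-next refl h₁) (fits-next refl h₂) (fits-next refl h₃) (fits-next c h₄)
        (follows-next refl h₀ h₁) (follows-next refl h₁ h₂) (follows-next refl h₂ h₃) (follows-next refl h₃ h₄)
            (follows-next c h₄ h₀)))
      where
      c = cycle eq
      h₀ = head o₀
      h₁ = head o₁
      h₂ = head o₂
      h₃ = head o₃
      h₄ = head o₄

-- The contradiction for a single large face

module OneBig {n} (M : CombMap n) (pcc : CombMap.IsPlanarPCC M)
  (one-big : ∀ {d e} → 42 ≤ CombMap.faceSize M d → 42 ≤ CombMap.faceSize M e → InOrbit (CombMap.φ M) d e) where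
  open Demand M pcc one-big public

  w-small : ∀ {e} → face e ≤ 42 → w (face e) ≡ u (face e) * n !
  w-small {e} h = w≡u (F.period-pos e) h (w-face e)

  vertexBound-off : ∀ {d} → Off d → VertexBound A B d
  vertexBound-off {d} off = begin
    ∑ (orbit σ d) (λ e → S + A e)                        ≡⟨ ∑-cong (orbit σ d) (λ m → lhs (V.∈-orbit⁻ m)) ⟩
    ∑ (orbit σ d) (λ e → n ! * (L + 2 * dem (α e)))      ≡⟨ ∑-* (orbit σ d) (n !) _ ⟩
    n ! * ∑ (orbit σ d) (λ e → L + 2 * dem (α e))        ≤⟨ *-monoʳ-≤ (n !) (offBound off) ⟩
    n ! * (2 * L + ∑ (orbit σ d) (λ e → 2 * u (face e) + 2 * dem e))
      ≡⟨ solve 3 (λ m l x → m :* (con 2 :* l :+ x) := con 2 :* (l :* m) :+ m :* x) refl (n !) L _ ⟩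
    2 * S + n ! * ∑ (orbit σ d) (λ e → 2 * u (face e) + 2 * dem e)
        ≡⟨ cong (2 * S +_) (sym (∑-* (orbit σ d) (n !) _)) ⟩
    2 * S + ∑ (orbit σ d) (λ e → n ! * (2 * u (face e) + 2 * dem e))
        ≡⟨ cong (2 * S +_) (sym (∑-cong (orbit σ d) (λ m → rhs (V.∈-orbit⁻ m)))) ⟩
    2 * S + ∑ (orbit σ d) (λ e → 2 * w (face e) + B e) ∎
    where
    open ≤-Reasoning
    lhs : ∀ {e} → d ~ e → S + A e ≡ n ! * (L + 2 * dem (α e))
    lhs {e} o = trans (cong (λ x → S + (x + n ! * (2 * dem (α e)))) (bonus-small (off-¬Big off o)))
      (solve 3 (λ m l x → l :* m :+ m :* x := m :* (l :+ x)) refl (n !) L (2 * dem (α e)))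
    rhs : ∀ {e} → d ~ e → 2 * w (face e) + B e ≡ n ! * (2 * u (face e) + 2 * dem e)
    rhs {e} o = trans (cong (λ x → 2 * x + B e) (w-small (m≤n⇒m≤1+n (proj₂ (off-small off o)))))
      (solve 3 (λ m v x → con 2 :* (v :* m) :+ m :* x := m :* (con 2 :* v :+ x)) refl (n !) (u (face e))
          (2 * dem e))

  On : Fin n → Set
  On d = onBig d ≡ true

  dem-edge : ∀ {d} → On d → On (α d) → dem d ≡ 0 × dem (α d) ≡ 0
  dem-edge {d} on on′ = cong₂ (λ x y → demand x y (deg d) (face d) (face (σ d)) (needy d)) on on′ ,
    cong₂ (λ x y → demand x y (deg (α d)) (face (α d)) (face (σ (α d))) (needy (α d))) on′
        (trans (cong onBig (α-inv d)) on)

  dem-inner : ∀ {d} → On d → Off (α d) → dem d ≡ (if deg d ≡ᵇ 4 then L / 82 else ask (face d) (face (σ d)))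
    × dem (α d) ≡ spare (face (σ d)) (face d)
  dem-inner {d} on off = cong₂ (λ x y → demand x y (deg d) (face d) (face (σ d)) (needy d)) on off ,
    trans (cong₂ (λ x y → demand x y (deg (α d)) (face (α d)) (face (σ (α d))) (needy (α d))) off
        (trans (cong onBig (α-inv d)) on))
      (cong₂ spare (face-α d) (face-σα d))

  vertexBound-big : ∀ {x} → Big x → VertexBound A B x
  vertexBound-big {x} b = go (around b)
    where
    along : ∀ {k} → deg x ≡ k → let es = map (λ j → iter σ j x) (upTo k) in
      ∑ es (λ e → S + A e) ≤ 2 * S + ∑ es (λ e → 2 * w (face e) + B e) → VertexBound A B x
    along refl h = h
    on : ∀ j → On (iter σ j x)
    on j = onBig-intro b (j , refl)
    outer : dem x ≡ 0 × dem (α x) ≡ 0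
    outer = dem-edge (on 0) (onBig-intro (big-φ b) (~sym ~σ))
    last : ∀ {z} → x ~ z → σ z ≡ x → dem z ≡ 0 × dem (α z) ≡ 0
    last {z} o eq = dem-edge (onBig-intro b o) (onBig-intro (big-pred (trans (φα z) eq) b) ~refl)
    A-outer : ∀ {y e} → bonus e ≡ y → dem (α e) ≡ 0 → A e ≡ y
    A-outer {y} p q = trans (cong₂ (λ b′ d → b′ + n ! * (2 * d)) p q) (trans (cong (y +_) (*-zeroʳ (n !)))
        (+-identityʳ y))
    A-inner : ∀ {e s} → ¬ Big e → dem (α e) ≡ s → A e ≡ n ! * (2 * s)
    A-inner p q = cong₂ (λ b′ d → b′ + n ! * (2 * d)) (bonus-small p) q
    C-inner : ∀ {e v s} → face e ≤ 42 → u (face e) ≡ v → dem e ≡ s → 2 * w (face e) + B e ≡ 2 *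
        (v * n !) + n ! * (2 * s)
    C-inner h p q = cong₂ (λ v d → 2 * v + n ! * (2 * d)) (trans (w-small h) (cong (_* n !) p)) q
    drop-zero : ∀ {y z} → y ≡ z + n ! * (2 * 0) → y ≡ z
    drop-zero {y} {z} eq = trans eq (trans (cong (z +_) (*-zeroʳ (n !))) (+-identityʳ z))
    ≤42 : ∀ {e} → face e ≤ 6 → face e ≤ 42
    ≤42 h = ≤-trans h (≤ᵇ⇒≤ _ _ _)
    go : Around x → VertexBound A B x
    go (around₃ d3 f) = along d3 (bigBound₃ (n !) (w (face x)) (u (face (σ x))) (u (face (σ (σ x))))
      (spare (face (σ x)) (face (σ (σ x)))) (ask (face (σ x)) (face (σ (σ x)))) (L / 41) (excess₃ f)
      (A-outer (bonus-big b) (proj₂ outer))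
      (A-inner (≤6⇒¬Big (proj₁ (flank≤6 f))) (trans (proj₂ inner₁) (spare-swap (flank-swap f))))
      (A-outer (bonus-small (≤6⇒¬Big (proj₂ (flank≤6 f)))) (proj₂ last₂))
      (drop-zero (cong (λ d → 2 * w (face x) + n ! * (2 * d)) (proj₁ outer)))
      (C-inner (≤42 (proj₁ (flank≤6 f))) refl (trans (proj₁ inner₁)
        (cong (λ j → if j ≡ᵇ 4 then L / 82 else ask (face (σ x)) (face (σ (σ x)))) (trans (deg-σ x) d3))))
      (drop-zero (C-inner (≤42 (proj₂ (flank≤6 f))) refl (proj₁ last₂))))
      where
      inner₁ = dem-inner (on 1) (off-first b)
      last₂ = last (2 , refl) (cycle d3)
    go (around₄ d4 p q r) = along d4 (bigBound₄ (n !) (w (face x)) (u 3) (L / 82) (L / 41) excess₄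
      (A-outer (bonus-big b) (proj₂ outer))
      (A-outer (bonus-small (≡3⇒¬Big p)) (trans (proj₂ inner₁) (cong₂ spare q p)))
      (A-outer (bonus-small (≡3⇒¬Big q)) (trans (proj₂ inner₂) (cong₂ spare r q)))
      (A-outer (bonus-small (≡3⇒¬Big r)) (proj₂ last₃))
      (drop-zero (cong (λ d → 2 * w (face x) + n ! * (2 * d)) (proj₁ outer)))
      (C-inner (three p) (cong u p) (trans (proj₁ inner₁) (quartic 1)))
      (C-inner (three q) (cong u q) (trans (proj₁ inner₂) (quartic 2)))
      (drop-zero (C-inner (three r) (cong u r) (proj₁ last₃))))
      where
      inner₁ = dem-inner (on 1) (off-first b)
      inner₂ = dem-inner (on 2) (off-second b d4)
      last₃ = last (3 , refl) (cycle d4)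
      three : ∀ {e} → face e ≡ 3 → face e ≤ 42
      three eq = subst (_≤ 42) (sym eq) (≤ᵇ⇒≤ _ _ _)
      quartic : ∀ j {y} → (if deg (iter σ j x) ≡ᵇ 4 then L / 82 else y) ≡ L / 82
      quartic j {y} = cong (λ k → if k ≡ᵇ 4 then L / 82 else y) (trans (V.period-orbit (j , refl)) d4)

  vertexBound : ∀ d → VertexBound A B d
  vertexBound d = go _ refl
    where
    go : ∀ y → onBig d ≡ y → VertexBound A B d
    go false off = vertexBound-off off
    go true eq = let x , b , o = onBig-elim eq in vertexBound-~ {A} {B} o (vertexBound-big b)

  module α-perm = Perm α α-inj

  -- The demands occur once on each side, read from opposite ends of the edges, and cancel.
  ∑bonus≤ : ∑ (allFin n) bonus ≤ 4 * S
  ∑bonus≤ = +-cancelʳ-≤ (∑ (allFin n) B) _ _ (begin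
    ∑ (allFin n) bonus + ∑ (allFin n) B          ≡⟨ cong (∑ (allFin n) bonus +_) (sym (α-perm.∑-reindex B)) ⟩
    ∑ (allFin n) bonus + ∑ (allFin n) (B ∘ α)    ≡⟨ sym (∑-+ (allFin n) bonus (B ∘ α)) ⟩
    ∑ (allFin n) A                               ≤⟨ total A B vertexBound ⟩
    4 * S + ∑ (allFin n) B ∎)
    where open ≤-Reasoning

  no-big : ∀ d → ¬ Big d
  no-big d b = <⇒≱ (begin-strict
    4 * S
        ≡⟨ solve 2 (λ l m → con 4 :* (l :* m) := con 2 :* (l :* m) :+ con 2 :* l :* m) refl L (n !) ⟩
    2 * S + 2 * L * n !                    <⟨ +-monoʳ-< (2 * S) (*-monoˡ-< (n !) (*-monoʳ-< 2 42units)) ⟩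
    2 * S + 2 * (42 * q) * n !
        ≤⟨ +-monoʳ-≤ (2 * S) (*-monoˡ-≤ (n !) (*-monoʳ-≤ 2 (*-monoˡ-≤ q b))) ⟩
    2 * S + 2 * (N * q) * n !              ≡⟨ cong (λ s → 2 * s + 2 * (N * q) * n !) (sym (w-face d)) ⟩
    2 * (N * w N) + 2 * (N * q) * n !
        ≡⟨ solve 4 (λ k x y m → con 2 :* (k :* x) :+ con 2 :* (k :* y) :* m :=
        k :* (con 2 :* x :+ con 2 :* y :* m)) refl N (w N) q (n !) ⟩
    N * (2 * w N + 2 * q * n !)            ≡⟨ cong (_* (2 * w N + 2 * q * n !)) (sym (F.length-orbit d)) ⟩
    length (orbit φ d) * (2 * w N + 2 * q * n !)  ≡⟨ sym (∑-const (orbit φ d) _) ⟩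
    ∑ (orbit φ d) (λ _ → 2 * w N + 2 * q * n !)   ≡⟨ ∑-cong (orbit φ d) (λ m → sym (on-face (F.∈-orbit⁻ m))) ⟩
    ∑ (orbit φ d) bonus                    ≤⟨ F.∑-orbit-≤ d bonus ⟩
    ∑ (allFin n) bonus ∎) ∑bonus≤
    where
    open ≤-Reasoning
    N = face d
    q = L / 41
    on-face : ∀ {e} → InOrbit φ d e → bonus e ≡ 2 * w N + 2 * q * n !
    on-face o = trans (bonus-big (subst (42 ≤_) (sym (F.period-orbit o)) b)) (cong (λ k → 2 * w k + 2 * q * n !)
        (F.period-orbit o))

-- Two large faces

shareBound₃ : ∀ m X b c {A₀ A₁ A₂ C₁ C₂} → 3 * L ≤ 2 * L + (2 * b + 2 * c) →
  A₀ ≤ 2 * X → A₁ ≡ 0 → A₂ ≡ 0 → C₁ ≡ b * m → C₂ ≡ c * m →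
  (L * m + A₀) + ((L * m + A₁) + ((L * m + A₂) + 0)) ≤ 2 * (L * m) +
      ((2 * X + 0) + ((2 * C₁ + 0) + ((2 * C₂ + 0) + 0)))
shareBound₃ m X b c {A₀} h a refl refl refl refl = begin
  (L * m + A₀) + ((L * m + 0) + ((L * m + 0) + 0))
    ≡⟨ solve 3 (λ l m x → (l :* m :+ x) :+ ((l :* m :+ con 0) :+ ((l :* m :+ con 0) :+ con 0)) :=
        x :+ con 3 :* l :* m) refl L m A₀ ⟩
  A₀ + 3 * L * m  ≤⟨ +-mono-≤ a (*-monoˡ-≤ m h) ⟩
  2 * X + (2 * L + (2 * b + 2 * c)) * m
    ≡⟨ solve 5 (λ l m x b c → con 2 :* x :+ (con 2 :* l :+ (con 2 :* b :+ con 2 :* c)) :* m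
        := con 2 :* (l :* m) :+ ((con 2 :* x :+ con 0) :+ ((con 2 :* (b :* m) :+ con 0) :+
            ((con 2 :* (c :* m) :+ con 0) :+ con 0)))) refl L m X b c ⟩
  2 * (L * m) + ((2 * X + 0) + ((2 * (b * m) + 0) + ((2 * (c * m) + 0) + 0))) ∎
  where open ≤-Reasoning

shareTight₃ : ∀ m .{{_ : NonZero m}} X b c {A₀ A₁ A₂ C₁ C₂} → A₀ ≤ 2 * X → A₁ ≡ 0 → A₂ ≡ 0 → C₁ ≡ b * m →
    C₂ ≡ c * m →
  2 * (L * m) + ((2 * X + 0) + ((2 * C₁ + 0) + ((2 * C₂ + 0) + 0))) ≤ (L * m + A₀) +
      ((L * m + A₁) + ((L * m + A₂) + 0)) →
  2 * L + (2 * b + 2 * c) ≤ 3 * L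
shareTight₃ m X b c {A₀} a refl refl refl refl h = *-cancelʳ-≤ _ _ m (+-cancelˡ-≤ (2 * X) _ _ (begin
  2 * X + (2 * L + (2 * b + 2 * c)) * m
    ≡⟨ solve 5 (λ l m x b c → con 2 :* x :+ (con 2 :* l :+ (con 2 :* b :+ con 2 :* c)) :* m
        := con 2 :* (l :* m) :+ ((con 2 :* x :+ con 0) :+ ((con 2 :* (b :* m) :+ con 0) :+
            ((con 2 :* (c :* m) :+ con 0) :+ con 0)))) refl L m X b c ⟩
  2 * (L * m) + ((2 * X + 0) + ((2 * (b * m) + 0) + ((2 * (c * m) + 0) + 0)))  ≤⟨ h ⟩
  (L * m + A₀) + ((L * m + 0) + ((L * m + 0) + 0))
    ≡⟨ solve 3 (λ l m x → (l :* m :+ x) :+ ((l :* m :+ con 0) :+ ((l :* m :+ con 0) :+ con 0)) :=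
        x :+ con 3 :* l :* m) refl L m A₀ ⟩
  A₀ + 3 * L * m  ≤⟨ +-monoˡ-≤ (3 * L * m) a ⟩
  2 * X + 3 * L * m ∎))
  where open ≤-Reasoning

shareBound₄ : ∀ m X b {A₀ A₁ A₂ A₃ C₁ C₂ C₃} → 4 * L ≡ 2 * L + (2 * b + (2 * b + 2 * b)) →
  A₀ ≤ 2 * X → A₁ ≡ 0 → A₂ ≡ 0 → A₃ ≡ 0 → C₁ ≡ b * m → C₂ ≡ b * m → C₃ ≡ b * m →
  (L * m + A₀) + ((L * m + A₁) + ((L * m + A₂) + ((L * m + A₃) + 0))) ≤
    2 * (L * m) + ((2 * X + 0) + ((2 * C₁ + 0) + ((2 * C₂ + 0) + ((2 * C₃ + 0) + 0))))
shareBound₄ m X b {A₀} h a refl refl refl refl refl refl = begin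
  (L * m + A₀) + ((L * m + 0) + ((L * m + 0) + ((L * m + 0) + 0)))
    ≡⟨ solve 3 (λ l m x → (l :* m :+ x) :+
        ((l :* m :+ con 0) :+ ((l :* m :+ con 0) :+ ((l :* m :+ con 0) :+ con 0))) :=
        x :+ con 4 :* l :* m) refl L m A₀ ⟩
  A₀ + 4 * L * m  ≤⟨ +-mono-≤ a (≤-reflexive (cong (_* m) h)) ⟩
  2 * X + (2 * L + (2 * b + (2 * b + 2 * b))) * m
    ≡⟨ solve 4 (λ l m x b → con 2 :* x :+ (con 2 :* l :+ (con 2 :* b :+ (con 2 :* b :+ con 2 :* b))) :* m
        := con 2 :* (l :* m) :+ ((con 2 :* x :+ con 0) :+ ((con 2 :* (b :* m) :+ con 0) :+
            ((con 2 :* (b :* m) :+ con 0) :+ ((con 2 :* (b :* m) :+ con 0) :+ con 0))))) refl L m X b ⟩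
  2 * (L * m) + ((2 * X + 0) + ((2 * (b * m) + 0) + ((2 * (b * m) + 0) + ((2 * (b * m) + 0) + 0)))) ∎
  where open ≤-Reasoning

module TwoBig {n} (M : CombMap n) (pcc : CombMap.IsPlanarPCC M) (p q : Fin n)
  (big-p : 42 ≤ CombMap.faceSize M p) (big-q : 42 ≤ CombMap.faceSize M q) (p≁q : ¬ InOrbit (CombMap.φ M) p q) where
  open Total M pcc public

  share : Fin n → Fin n → ℕ
  share d e = if does (F.InOrbit? d e) then 2 * w (face e) else 0

  share-in : ∀ {d e} → InOrbit φ d e → share d e ≡ 2 * w (face e)
  share-in {d} {e} o = cong (λ y → if y then 2 * w (face e) else 0) (dec-true (F.InOrbit? d e) o)

  share-out : ∀ {d e} → ¬ InOrbit φ d e → share d e ≡ 0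
  share-out {d} {e} ¬o = cong (λ y → if y then 2 * w (face e) else 0) (dec-false (F.InOrbit? d e) ¬o)

  -- Each of the two faces claims the reciprocal terms of its own corners, which amount to `2 * S`
  -- per face and so to the entire total `4 * S`. No curvature is moved.
  A B : Fin n → ℕ
  A e = share p e + share q e
  B e = 0

  OnPQ : Fin n → Set
  OnPQ e = InOrbit φ p e ⊎ InOrbit φ q e

  ¬both : ∀ {e} → InOrbit φ p e → ¬ InOrbit φ q e
  ¬both o o′ = p≁q (F.InOrbit-trans o (F.InOrbit-sym o′))

  A-out : ∀ {e} → ¬ OnPQ e → A e ≡ 0
  A-out h = cong₂ _+_ (share-out (h ∘ inj₁)) (share-out (h ∘ inj₂))

  A≤ : ∀ e → A e ≤ 2 * w (face e)
  A≤ e = go (F.InOrbit? p e) (F.InOrbit? q e)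
    where
    go : Dec (InOrbit φ p e) → Dec (InOrbit φ q e) → A e ≤ 2 * w (face e)
    go (yes o) _ = ≤-reflexive (trans (cong₂ _+_ (share-in o) (share-out (¬both o))) (+-identityʳ _))
    go (no ¬o) (yes o) = ≤-reflexive (cong₂ _+_ (share-out ¬o) (share-in o))
    go (no ¬o) (no ¬o′) = ≤-trans (≤-reflexive (A-out [ ¬o , ¬o′ ]′)) z≤n

  onPQ-Big : ∀ {e} → OnPQ e → Big e
  onPQ-Big (inj₁ o) = subst (42 ≤_) (sym (F.period-orbit o)) big-p
  onPQ-Big (inj₂ o) = subst (42 ≤_) (sym (F.period-orbit o)) big-q

  A-small : ∀ {e} → ¬ Big e → A e ≡ 0
  A-small ¬b = A-out (¬b ∘ onPQ-Big)

  w-small : ∀ {e} → face e ≤ 6 → w (face e) ≡ u (face e) * n !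
  w-small {e} h = w≡u (F.period-pos e) (≤-trans h (≤ᵇ⇒≤ _ _ _)) (w-face e)

  w-three : ∀ {e} → face e ≡ 3 → w (face e) ≡ u 3 * n !
  w-three {e} eq = trans (w-small (subst (_≤ 6) (sym eq) (≤ᵇ⇒≤ _ _ _))) (cong (λ c → u c * n !) eq)

  bigOrNone : ∀ d → (∃ λ x → Big x × x ~ d) ⊎ (∀ {e} → d ~ e → ¬ Big e)
  bigOrNone d = go (any? (λ e → 42 ≤? face e) (orbit σ d))
    where
    go : Dec (Any.Any Big (orbit σ d)) → (∃ λ x → Big x × x ~ d) ⊎ (∀ {e} → d ~ e → ¬ Big e)
    go (yes a) = let x , m , b = find a in inj₁ (x , b , ~sym (V.∈-orbit⁻ m))
    go (no ¬a) = inj₂ λ o b → ¬a (Any.map (λ { refl → b }) (V.∈-orbit⁺ o))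

  -- Where nothing is claimed, positive curvature makes the local inequality strict.
  ∑-zero : ∀ {d} → (∀ {e} → d ~ e → A e ≡ 0) → ∑ (orbit σ d) (λ e → S + A e) < 2 * S + ∑ (orbit σ d) (λ e →
      2 * w (face e) + B e)
  ∑-zero {d} h = subst₂ _<_
    (trans (cong (_* S) (sym (V.length-orbit d))) (trans (sym (∑-const (orbit σ d) S))
      (∑-cong (orbit σ d) λ m → sym (trans (cong (S +_) (h (V.∈-orbit⁻ m))) (+-identityʳ S)))))
    (cong (2 * S +_) (∑-cong (orbit σ d) λ _ → sym (+-identityʳ _)))
    (positive-curvature d)

  along : ∀ {d k} → deg d ≡ k → (P : List (Fin n) → Set) → P (map (λ j → iter σ j d) (upTo k)) → P (orbit σ d)
  along refl P h = h

  across : ∀ {d k} → deg d ≡ k → (P : List (Fin n) → Set) → P (orbit σ d) → P (map (λ j → iter σ j d) (upTo k))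
  across refl P h = h

  vertexBound-big : ∀ {x} → Big x → VertexBound A B x
  vertexBound-big {x} b = go (around b)
    where
    P = λ es → ∑ es (λ e → S + A e) ≤ 2 * S + ∑ es (λ e → 2 * w (face e) + B e)
    go : Around x → VertexBound A B x
    go (around₃ d3 f) = along d3 P (shareBound₃ (n !) (w (face x)) (u (face (σ x))) (u (face (σ (σ x))))
        (flat₃ f) (A≤ x)
      (A-small (≤6⇒¬Big (proj₁ (flank≤6 f)))) (A-small (≤6⇒¬Big (proj₂ (flank≤6 f))))
      (w-small (proj₁ (flank≤6 f))) (w-small (proj₂ (flank≤6 f))))
    go (around₄ d4 h₁ h₂ h₃) = along d4 P (shareBound₄ (n !) (w (face x)) (u 3) flat₄ (A≤ x)
      (A-small (≡3⇒¬Big h₁)) (A-small (≡3⇒¬Big h₂)) (A-small (≡3⇒¬Big h₃)) (w-three h₁) (w-three h₂)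
          (w-three h₃))

  vertexBound : ∀ d → VertexBound A B d
  vertexBound d = go (bigOrNone d)
    where
    go : (∃ λ x → Big x × x ~ d) ⊎ (∀ {e} → d ~ e → ¬ Big e) → VertexBound A B d
    go (inj₁ (x , b , o)) = vertexBound-~ {A} {B} o (vertexBound-big b)
    go (inj₂ ¬bigs) = <⇒≤ (∑-zero λ o → A-small (¬bigs o))

  ∑-share : ∀ d → 2 * S ≤ ∑ (allFin n) (share d)
  ∑-share d = begin
    2 * S                                  ≡⟨ cong (2 *_) (sym (w-face d)) ⟩
    2 * (face d * w (face d))
        ≡⟨ solve 2 (λ k x → con 2 :* (k :* x) := k :* (con 2 :* x)) refl (face d) (w (face d)) ⟩
    face d * (2 * w (face d))              ≡⟨ cong (_* (2 * w (face d))) (sym (F.length-orbit d)) ⟩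
    length (orbit φ d) * (2 * w (face d))  ≡⟨ sym (∑-const (orbit φ d) _) ⟩
    ∑ (orbit φ d) (λ _ → 2 * w (face d))   ≡⟨ ∑-cong (orbit φ d) (λ m → let o = F.∈-orbit⁻ m in
                                                sym (trans (share-in o) (cong (λ k →
                                                    2 * w k) (F.period-orbit o)))) ⟩
    ∑ (orbit φ d) (share d)                ≤⟨ F.∑-orbit-≤ d (share d) ⟩
    ∑ (allFin n) (share d) ∎
    where open ≤-Reasoning

  -- The two large faces already use up the whole curvature 2.
  tight : ∀ d → 2 * S + ∑ (orbit σ d) (λ e → 2 * w (face e) + B e) ≤ ∑ (orbit σ d) (λ e → S + A e)
  tight = total-tight A B vertexBound (begin
    4 * S + ∑ (allFin n) B                          ≡⟨ cong (4 * S +_) (trans (∑-constant 0) (*-zeroʳ n)) ⟩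
    4 * S + 0
        ≡⟨ solve 1 (λ s → con 4 :* s :+ con 0 := con 2 :* s :+ con 2 :* s) refl S ⟩
    2 * S + 2 * S                                   ≤⟨ +-mono-≤ (∑-share p) (∑-share q) ⟩
    ∑ (allFin n) (share p) + ∑ (allFin n) (share q) ≡⟨ sym (∑-+ (allFin n) (share p) (share q)) ⟩
    ∑ (allFin n) A ∎)
    where open ≤-Reasoning

  flat : ∀ {x} → Big x → deg x ≡ 3 → Flat (face (σ x)) (face (σ (σ x)))
  flat {x} b d3 = flat₃⁻ f (shareTight₃ (n !) (w (face x)) (u (face (σ x))) (u (face (σ (σ x)))) (A≤ x)
      (A-small (≤6⇒¬Big (proj₁ (flank≤6 f)))) (A-small (≤6⇒¬Big (proj₂ (flank≤6 f))))
      (w-small (proj₁ (flank≤6 f))) (w-small (proj₂ (flank≤6 f)))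
      (across d3 (λ es → 2 * S + ∑ es (λ e → 2 * w (face e) + B e) ≤ ∑ es (λ e → S + A e)) (tight x)))
    where f = flank-of (around b) d3

  -- A vertex away from both faces, even one on a third large face, would leave an unclaimed
  -- surplus, which `tight` excludes.
  hub : ∀ d → ∃ λ x → Big x × x ~ d × OnPQ x
  hub d = go (bigOrNone d)
    where
    go : (∃ λ x → Big x × x ~ d) ⊎ (∀ {e} → d ~ e → ¬ Big e) → ∃ λ x → Big x × x ~ d × OnPQ x
    go (inj₂ ¬bigs) = ⊥-elim (<⇒≱ (∑-zero λ o → A-small (¬bigs o)) (tight d))
    go (inj₁ (x , b , o)) = check (F.InOrbit? p x) (F.InOrbit? q x)
      where
      check : Dec (InOrbit φ p x) → Dec (InOrbit φ q x) → ∃ λ x → Big x × x ~ d × OnPQ x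
      check (yes i) _ = x , b , o , inj₁ i
      check (no _) (yes i) = x , b , o , inj₂ i
      check (no ¬i) (no ¬j) = ⊥-elim (<⇒≱ (∑-zero λ o′ → A-out λ i →
        [ ¬i , ¬j ]′ (subst OnPQ (big-unique (onPQ-Big i) b (~trans (~sym o′) (~sym o))) i)) (tight d))

  big-onPQ : ∀ {x} → Big x → OnPQ x
  big-onPQ {x} b = let y , by , o , i = hub x in subst OnPQ (big-unique by b o) i

  inner-at : ∀ {x y} → Big x → Big y → y ~ α (σ x) → Inner y (α (σ x))
  inner-at {x} bx by o = inner by o
    (λ eq → ≤6⇒¬Big (subst (_≤ 6) (sym (face-α (σ x))) (proj₂ (beside≤6 (around bx)))) (subst Big (sym eq) by))
    (λ eq → ≤6⇒¬Big (subst (_≤ 6) (sym (face-σα (σ x))) (proj₁ (beside≤6 (around bx)))) (subst Big (sym eq) by))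

  -- The inner edge ends at a vertex with a large corner. If that has degree 4, the hexagon beside
  -- the edge would be a triangle; if it has degree 3, the triangle would have two sides on large
  -- faces.
  no-hexagon : ∀ {x} → Big x → deg x ≡ 3 → face (σ x) ≡ 4 × face (σ (σ x)) ≡ 4
  no-hexagon {x} bx d3 = go refl refl (flat bx d3)
    where
    opposite = hub (α (σ x))
    y = proj₁ opposite
    by = proj₁ (proj₂ opposite)
    six≢3 : 6 ≢ 3
    six≢3 ()
    left-three : face (σ x) ≡ 3 → face (σ (σ x)) ≡ 6 → Inner y (α (σ x)) → ⊥
    left-three h h′ (cubic d3y eq) = fore-triangle bx (big-pred (ασ-pred d3y) by) h
        (trans (cong σ eq) (sym (α-inv _)))
    left-three h h′ (fore d4 eq) = six≢3
        (trans (sym h′) (trans (sym (face-α (σ x))) (trans (cong face eq) (proj₁ (threes-of (around by) d4)))))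
    left-three h h′ (aft d4 eq) = six≢3
        (trans (sym h′) (trans (sym (face-α (σ x)))
        (trans (cong face eq) (proj₁ (proj₂ (threes-of (around by) d4))))))
    right-three : face (σ x) ≡ 6 → face (σ (σ x)) ≡ 3 → Inner y (α (σ x)) → ⊥
    right-three h h′ (cubic d3y eq) = aft-triangle bx by d3 h′ eq
    right-three h h′ (fore d4 eq) =
        six≢3 (trans (sym h) (trans (sym (face-σα (σ x))) (trans (cong (face ∘ σ) eq)
        (proj₁ (proj₂ (threes-of (around by) d4))))))
    right-three h h′ (aft d4 eq) = six≢3
        (trans (sym h) (trans (sym (face-σα (σ x))) (trans (cong (face ∘ σ) eq)
        (proj₂ (proj₂ (threes-of (around by) d4))))))
    go : ∀ {a b} → face (σ x) ≡ a → face (σ (σ x)) ≡ b → Flat a b → face (σ x) ≡ 4 × face (σ (σ x)) ≡ 4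
    go h h′ g44 = h , h′
    go h h′ g36 = ⊥-elim (left-three h h′ (inner-at bx by (proj₁ (proj₂ (proj₂ opposite)))))
    go h h′ g63 = ⊥-elim (right-three h h′ (inner-at bx by (proj₁ (proj₂ (proj₂ opposite)))))

  -- First inner darts are partners of first inner darts: if `σ x` arrived as the second one, the
  -- triangle beside it would have two sides on large faces. As `y` determines `x`, this matches the
  -- boundary cycles injectively.
  opposite : ∀ {x} → Big x → ∃ λ y → Big y × OnPQ y × α (σ x) ≡ σ y
  opposite {x} bx = let y , by , o , i = hub (α (σ x)) in y , by , i , go by (around bx) (inner-at bx by o)
    where
    go : ∀ {y} → Big y → Around x → Inner y (α (σ x)) → α (σ x) ≡ σ y
    go by _ (cubic _ eq) = eq
    go by _ (fore _ eq) = eq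
    go {y} by a (aft d4 eq) = ⊥-elim (fore-triangle bx (big-pred back by) (three a)
        (trans (cong σ eq) (sym (α-inv _))))
      where
      back : φ (α (σ (σ (σ y)))) ≡ y
      back = trans (φα _) (cycle d4)
      three : Around x → face (σ x) ≡ 3
      three _ = trans (sym (face-σα (σ x))) (trans (cong (face ∘ σ) eq)
          (proj₂ (proj₂ (threes-of (around by) d4))))

  -- The partner cannot lie on the same face, as the edge between them would be a chord.
  opposite-side : ∀ {d e} → Big d → (∀ {x} → OnPQ x → ¬ InOrbit φ d x → InOrbit φ e x) →
    ∀ {x} → InOrbit φ d x → ∃ λ y → InOrbit φ e y × α (σ x) ≡ σ y
  opposite-side {d} bd other {x} o = let y , by , i , eq = opposite bx in
    y , other i (λ o′ → no-chord bx (F.InOrbit-trans (F.InOrbit-sym o) o′) (1 , sym eq)) , eq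
    where bx = subst (42 ≤_) (sym (F.period-orbit o)) bd

  face-≤ : ∀ {d e} → (∀ {x} → InOrbit φ d x → ∃ λ y → InOrbit φ e y × α (σ x) ≡ σ y) → face d ≤ face e
  face-≤ {d} {e} opp = injective⇒≤ {f = index} index-inj
    where
    at-index : (i : Fin (face d)) → ∃ λ k → k < face e × α (σ (iter φ (toℕ i) d)) ≡ σ (iter φ k e)
    at-index i = let y , o , eq = opp {iter φ (toℕ i) d} (toℕ i , refl)
                     k , k<N , at = F.InOrbit< o in k , k<N , trans eq (cong σ (sym at))
    index : Fin (face d) → Fin (face e)
    index i = fromℕ< (proj₁ (proj₂ (at-index i)))
    index-inj : ∀ {i j} → index i ≡ index j → i ≡ j
    index-inj {i} {j} eq = toℕ-injective (F.InOrbit-index (toℕ i) (toℕ j) (toℕ<n i) (toℕ<n j)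
      (σ-inj (α-inj (trans (proj₂ (proj₂ (at-index i))) (trans
        (cong (λ k → σ (iter φ k e)) (fromℕ<-injective _ _ (proj₁ (proj₂ (at-index i)))
            (proj₁ (proj₂ (at-index j))) eq))
        (sym (proj₂ (proj₂ (at-index j)))))))))

  face-p≡face-q : face p ≡ face q
  face-p≡face-q = ≤-antisym
    (face-≤ (opposite-side big-p λ { (inj₁ o) ¬o → ⊥-elim (¬o o) ; (inj₂ o) _ → o }))
    (face-≤ (opposite-side big-q λ { (inj₁ o) _ → o ; (inj₂ o) ¬o → ⊥-elim (¬o o) }))

  Uniform : ℕ → ℕ → Fin n → Set
  Uniform k c d = deg d ≡ k × (∀ {e} → d ~ e → Big e ⊎ face e ≡ c)

  uniform-σ : ∀ {k c d} → Uniform k c d → Uniform k c (σ d)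
  uniform-σ {d = d} (dk , h) = trans (deg-σ d) dk , h ∘ ~trans ~σ

  uniform : ∀ d → Uniform 4 3 d ⊎ Uniform 3 4 d
  uniform d = let x , b , o , _ = hub d in Sum.map (move o) (move o) (at-big b (around b))
    where
    move : ∀ {k c x} → x ~ d → Uniform k c x → Uniform k c d
    move o (dk , h) = trans (V.period-orbit o) dk , h ∘ ~trans o
    at-big : ∀ {x} → Big x → Around x → Uniform 4 3 x ⊎ Uniform 3 4 x
    at-big {x} b (around₃ d3 _) = inj₂ (d3 , λ o → corner (V.InOrbit< o))
      where
      corner : ∀ {e} → (∃ λ j → j < deg x × iter σ j x ≡ e) → Big e ⊎ face e ≡ 4
      corner (0 , _ , refl) = inj₁ b
      corner (1 , _ , refl) = inj₂ (proj₁ (no-hexagon b d3))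
      corner (2 , _ , refl) = inj₂ (proj₂ (no-hexagon b d3))
      corner (suc (suc (suc j)) , lt , _) with () ← <⇒≱ lt (subst (_≤ _) (sym d3) (m≤m+n 3 j))
    at-big {x} b (around₄ d4 h₁ h₂ h₃) = inj₁ (d4 , λ o → corner (V.InOrbit< o))
      where
      corner : ∀ {e} → (∃ λ j → j < deg x × iter σ j x ≡ e) → Big e ⊎ face e ≡ 3
      corner (0 , _ , refl) = inj₁ b
      corner (1 , _ , refl) = inj₂ h₁
      corner (2 , _ , refl) = inj₂ h₂
      corner (3 , _ , refl) = inj₂ h₃
      corner (suc (suc (suc (suc j))) , lt , _) with () ← <⇒≱ lt (subst (_≤ _) (sym d4) (m≤m+n 4 j))

  -- Both ends of an edge share the two faces beside it. At most one of these is large, and the size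
  -- of the other decides the type of both ends.
  uniform-clash : ∀ {k k′ c c′ d} → c ≤ 6 → c ≢ c′ → Uniform k c d → ¬ Uniform k′ c′ (α d)
  uniform-clash {c = c} {c′} {d} c≤6 c≢c′ (_ , h) (_ , h′) = go (h ~refl) (h ~σ)
    where
    clash : ∀ {e e′} → face e ≡ c → face e′ ≡ face e → α d ~ e′ → ⊥
    clash fe eq o = [ (λ b → ≤6⇒¬Big (subst (_≤ 6) (sym (trans eq fe)) c≤6) b) , (λ f →
        c≢c′ (trans (sym fe) (trans (sym eq) f))) ]′ (h′ o)
    go : Big d ⊎ face d ≡ c → Big (σ d) ⊎ face (σ d) ≡ c → ⊥
    go (inj₂ fd) _ = clash fd (face-σα d) ~σ
    go (inj₁ _) (inj₂ fσd) = clash fσd (face-α d) ~refl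
    go (inj₁ b) (inj₁ b′) = σd≢d d (sym (big-unique b b′ ~σ))

  4≢3 : 4 ≢ 3
  4≢3 ()

  uniform₄-α : ∀ {d} → Uniform 4 3 d → Uniform 4 3 (α d)
  uniform₄-α {d} U = [ id , (λ U′ → ⊥-elim (uniform-clash (≤ᵇ⇒≤ _ _ _) 3≢4 U U′)) ]′ (uniform (α d))

  uniform₃-α : ∀ {d} → Uniform 3 4 d → Uniform 3 4 (α d)
  uniform₃-α {d} U = [ (λ U′ → ⊥-elim (uniform-clash (≤ᵇ⇒≤ _ _ _) 4≢3 U U′)) , id ]′ (uniform (α d))

  uniform-reach : ∀ {k c} → (∀ {d} → Uniform k c d → Uniform k c (α d)) → ∀ {d e} → Reach d e → Uniform k c d →
      Uniform k c e
  uniform-reach step here U = U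
  uniform-reach step (byσ r) U = uniform-σ (uniform-reach step r U)
  uniform-reach step (byα r) U = step (uniform-reach step r U)

  -- Counting vertices and faces of the prism or antiprism

  ind : Fin n → ℕ
  ind e = if does (42 ≤? face e) then 1 else 0

  ind-big : ∀ {e} → Big e → ind e ≡ 1
  ind-big {e} b = cong (λ y → if y then 1 else 0) (dec-true (42 ≤? face e) b)

  ind-small : ∀ {e} → ¬ Big e → ind e ≡ 0
  ind-small {e} ¬b = cong (λ y → if y then 1 else 0) (dec-false (42 ≤? face e) ¬b)

  ∑ind-σ : ∀ d → ∑ (orbit σ d) ind ≡ 1
  ∑ind-σ d = let x , b , o , _ = hub d in trans (V.∑-orbit (~sym o) ind) (at-big b (around b))
    where
    at-big : ∀ {x} → Big x → Around x → ∑ (orbit σ x) ind ≡ 1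
    at-big b (around₃ d3 f) = along d3 (λ es → ∑ es ind ≡ 1) (cong₂ _+_ (ind-big b)
      (cong₂ _+_ (ind-small (≤6⇒¬Big (proj₁ (flank≤6 f)))) (cong₂ _+_ (ind-small (≤6⇒¬Big (proj₂ (flank≤6 f))))
          refl)))
    at-big b (around₄ d4 h₁ h₂ h₃) = along d4 (λ es → ∑ es ind ≡ 1) (cong₂ _+_ (ind-big b)
      (cong₂ _+_ (ind-small (≡3⇒¬Big h₁)) (cong₂ _+_ (ind-small (≡3⇒¬Big h₂))
          (cong₂ _+_ (ind-small (≡3⇒¬Big h₃)) refl))))

  rp rq : Fin n
  rp = proj₁ (F.hasRep p)
  rq = proj₁ (F.hasRep q)

  rp-orbit : InOrbit φ rp p
  rp-orbit = proj₂ (proj₂ (F.hasRep p))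

  rq-orbit : InOrbit φ rq q
  rq-orbit = proj₂ (proj₂ (F.hasRep q))

  big-rp : Big rp
  big-rp = subst (42 ≤_) (F.period-orbit rp-orbit) big-p

  big-rq : Big rq
  big-rq = subst (42 ≤_) (F.period-orbit rq-orbit) big-q

  smallReps : List (Fin n)
  smallReps = filter (λ r → ¬? (42 ≤? face r)) (reps φ)

  ∈-smallReps : ∀ {r} → r ∈ smallReps → ¬ Big r
  ∈-smallReps = proj₂ ∘ ∈-filter⁻ (λ r → ¬? (42 ≤? face r)) {xs = reps φ}

  reps-↭ : reps φ ↭ rp ∷ rq ∷ smallReps
  reps-↭ = ∼bag⇒↭ (unique∧set⇒bag F.reps-unique
    ((rp≢rq ∷ All.tabulate (λ m eq → ∈-smallReps (subst (_∈ smallReps) (sym eq) m) big-rp)) ∷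
     All.tabulate (λ m eq → ∈-smallReps (subst (_∈ smallReps) (sym eq) m) big-rq) ∷
     Unique.filter⁺ (λ r → ¬? (42 ≤? face r)) F.reps-unique)
    (mk⇔ to from))
    where
    rp≢rq : rp ≢ rq
    rp≢rq eq = p≁q (F.InOrbit-trans (F.InOrbit-sym rp-orbit) (subst (λ r → InOrbit φ r q) (sym eq) rq-orbit))
    to : ∀ {r} → r ∈ reps φ → r ∈ rp ∷ rq ∷ smallReps
    to {r} m = go (42 ≤? face r)
      where
      same : OnPQ r → r ∈ rp ∷ rq ∷ smallReps
      same (inj₁ o) = here (F.isRep-unique (F.∈-reps⁻ m) (proj₁ (proj₂ (F.hasRep p)))
          (F.InOrbit-sym (F.InOrbit-trans rp-orbit o)))
      same (inj₂ o) = there (here (F.isRep-unique (F.∈-reps⁻ m) (proj₁ (proj₂ (F.hasRep q)))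
          (F.InOrbit-sym (F.InOrbit-trans rq-orbit o))))
      go : Dec (Big r) → r ∈ rp ∷ rq ∷ smallReps
      go (yes b) = same (big-onPQ b)
      go (no ¬b) = there (there (∈-filter⁺ (λ r → ¬? (42 ≤? face r)) m ¬b))
    from : ∀ {r} → r ∈ rp ∷ rq ∷ smallReps → r ∈ reps φ
    from (here refl) = F.∈-reps⁺ (proj₁ (proj₂ (F.hasRep p)))
    from (there (here refl)) = F.∈-reps⁺ (proj₁ (proj₂ (F.hasRep q)))
    from (there (there m)) = proj₁ (∈-filter⁻ (λ r → ¬? (42 ≤? face r)) {xs = reps φ} m)

  N : ℕ
  N = face p

  face-rp : face rp ≡ N
  face-rp = sym (F.period-orbit rp-orbit)

  face-rq : face rq ≡ N
  face-rq = trans (sym (F.period-orbit rq-orbit)) (sym face-p≡face-q)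

  ∑-reps : (g : Fin n → ℕ) → ∑ (reps φ) g ≡ g rp + (g rq + ∑ smallReps g)
  ∑-reps g = sum-↭ (↭.map⁺ g reps-↭)

  ∑-ones : ∀ {f : Fin n → Fin n} (f-inj : ∀ {x y} → f x ≡ f y → x ≡ y) d → ∑ (orbit f d) (λ _ → 1) ≡ period f d
  ∑-ones {f} f-inj d = trans (∑-const (orbit f d) 1) (trans (*-identityʳ _) (Perm.length-orbit f f-inj d))

  -- Every vertex has exactly one large corner, so the large corners number `numV` when grouped by
  -- vertices, and N + N when grouped by faces.
  numV≡2N : numV ≡ 2 * N
  numV≡2N = begin
    numV                                     ≡⟨ sym (*-identityʳ numV) ⟩
    numV * 1                                 ≡⟨ sym (∑-const (reps σ) 1) ⟩
    ∑ (reps σ) (λ _ → 1)                     ≡⟨ sym (∑-cong (reps σ) (λ {r} _ → ∑ind-σ r)) ⟩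
    ∑ (reps σ) (λ r → ∑ (orbit σ r) ind)     ≡⟨ V.∑-orbits ind ⟩
    ∑ (allFin n) ind                         ≡⟨ sym (F.∑-orbits ind) ⟩
    ∑ (reps φ) (λ r → ∑ (orbit φ r) ind)     ≡⟨ ∑-reps (λ r → ∑ (orbit φ r) ind) ⟩
    ∑ (orbit φ rp) ind + (∑ (orbit φ rq) ind + ∑ smallReps (λ r → ∑ (orbit φ r) ind))
      ≡⟨ cong₂ _+_ (trans (large big-rp) face-rp) (cong₂ _+_ (trans (large big-rq) face-rq) small) ⟩
    2 * N ∎
    where
    open ≡-Reasoning
    large : ∀ {r} → Big r → ∑ (orbit φ r) ind ≡ face r
    large {r} b = trans (∑-cong (orbit φ r) (λ m →
        ind-big (subst (42 ≤_) (sym (F.period-orbit (F.∈-orbit⁻ m))) b))) (∑-ones φ-inj r)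
    small : ∑ smallReps (λ r → ∑ (orbit φ r) ind) ≡ 0
    small = trans (∑-cong smallReps λ {r} m → trans (∑-cong (orbit φ r) λ m′ →
        ind-small (∈-smallReps m ∘ subst (42 ≤_) (F.period-orbit (F.∈-orbit⁻ m′))))
      (trans (∑-const (orbit φ r) 0) (*-zeroʳ (length (orbit φ r)))))
      (trans (∑-const smallReps 0) (*-zeroʳ (length smallReps)))

  module Counting {k c} (all : ∀ d → Uniform k c d) where

    small-face : ∀ {r} → r ∈ smallReps → face r ≡ c
    small-face {r} m = [ (λ b → ⊥-elim (∈-smallReps m b)) , id ]′ (proj₂ (all r) ~refl)

    -- Darts grouped by vertices and by faces. The number of small faces follows: N for degree 3
    -- with squares, 2N for degree 4 with triangles.
    dart-count : 2 * N * k ≡ N + (N + length smallReps * c)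
    dart-count = begin
      2 * N * k                                      ≡⟨ cong (_* k) (sym numV≡2N) ⟩
      numV * k                                       ≡⟨ sym (∑-const (reps σ) k) ⟩
      ∑ (reps σ) (λ _ → k)
          ≡⟨ sym (∑-cong (reps σ) λ {r} _ → trans (∑-ones σ-inj r) (proj₁ (all r))) ⟩
      ∑ (reps σ) (λ r → ∑ (orbit σ r) (λ _ → 1))     ≡⟨ V.∑-orbits (λ _ → 1) ⟩
      ∑ (allFin n) (λ _ → 1)                         ≡⟨ sym (F.∑-orbits (λ _ → 1)) ⟩
      ∑ (reps φ) (λ r → ∑ (orbit φ r) (λ _ → 1))     ≡⟨ ∑-cong (reps φ) (λ {r} _ → ∑-ones φ-inj r) ⟩
      ∑ (reps φ) face                                ≡⟨ ∑-reps face ⟩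
      face rp + (face rq + ∑ smallReps face)
          ≡⟨ cong₂ _+_ face-rp (cong₂ _+_ face-rq (trans (∑-cong smallReps small-face) (∑-const smallReps c))) ⟩
      N + (N + length smallReps * c) ∎
      where open ≡-Reasoning

    faceSizes-↭ : faceSizes ↭ N ∷ N ∷ replicate (length smallReps) c
    faceSizes-↭ = ↭-trans (↭.map⁺ face reps-↭)
        (↭-reflexive (cong₂ _∷_ face-rp (cong₂ _∷_ face-rq (constant smallReps small-face))))
      where
      constant : ∀ rs → (∀ {r} → r ∈ rs → face r ≡ c) → map face rs ≡ replicate (length rs) c
      constant [] h = refl
      constant (r ∷ rs) h = cong₂ _∷_ (h (here refl)) (constant rs (h ∘ there))

  face-big : ∀ {x} → Big x → face x ≡ N
  face-big b = [ F.period-orbit , (λ o → trans (F.period-orbit o) (sym face-p≡face-q)) ]′ (big-onPQ b)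

  faceVector-hub : ∀ {xs} → (∀ {x} → Big x → map face (orbit σ x) ↭ xs) → ∀ d → faceVector d ↭ xs
  faceVector-hub h d = let x , b , o , _ = hub d in ↭-trans (↭.map⁺ face (V.orbit-↭ (~sym o))) (h b)

  prism : (∀ d → Uniform 3 4 d) → IsPrism N
  prism all = numV≡2N , subst (λ j → faceSizes ↭ N ∷ N ∷ replicate j 4) length≡N faceSizes-↭ ,
      faceVector-hub at-big
    where
    open Counting all
    length≡N : length smallReps ≡ N
    length≡N = *-cancelʳ-≡ _ _ 4 (+-cancelˡ-≡ (2 * N) _ _ (trans
      (solve 2 (λ x l → con 2 :* x :+ l :* con 4 := x :+ (x :+ l :* con 4)) refl N (length smallReps))
      (trans (sym dart-count) (solve 1 (λ x → con 2 :* x :* con 3 := con 2 :* x :+ x :* con 4) refl N))))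
    at-big : ∀ {x} → Big x → map face (orbit σ x) ↭ 4 ∷ 4 ∷ N ∷ []
    at-big {x} b = along (proj₁ (all x)) (λ es → map face es ↭ 4 ∷ 4 ∷ N ∷ [])
      (↭-trans (↭-reflexive (cong₂ _∷_ (face-big b) (cong₂ (λ y z → y ∷ z ∷ []) (proj₁ sides) (proj₂ sides))))
        (↭.∷↭∷ʳ N (4 ∷ 4 ∷ [])))
      where sides = no-hexagon b (proj₁ (all x))

  antiprism : (∀ d → Uniform 4 3 d) → IsAntiprism N
  antiprism all = numV≡2N , subst (λ j → faceSizes ↭ N ∷ N ∷ replicate j 3) length≡2N faceSizes-↭ ,
      faceVector-hub at-big
    where
    open Counting all
    length≡2N : length smallReps ≡ 2 * N
    length≡2N = *-cancelʳ-≡ _ _ 3 (+-cancelˡ-≡ (2 * N) _ _ (trans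
      (solve 2 (λ x l → con 2 :* x :+ l :* con 3 := x :+ (x :+ l :* con 3)) refl N (length smallReps))
      (trans (sym dart-count) (solve 1 (λ x → con 2 :* x :* con 4 :=
          con 2 :* x :+ con 2 :* x :* con 3) refl N))))
    at-big : ∀ {x} → Big x → map face (orbit σ x) ↭ 3 ∷ 3 ∷ 3 ∷ N ∷ []
    at-big {x} b = along (proj₁ (all x)) (λ es → map face es ↭ 3 ∷ 3 ∷ 3 ∷ N ∷ [])
      (↭-trans (↭-reflexive (cong₂ _∷_ (face-big b) (cong₂ _∷_ (proj₁ sides)
          (cong₂ (λ y z → y ∷ z ∷ []) (proj₁ (proj₂ sides)) (proj₂ (proj₂ sides))))))
        (↭.∷↭∷ʳ N (3 ∷ 3 ∷ 3 ∷ [])))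
      where sides = threes-of (around b) (proj₁ (all x))

  impossible : ⊥
  impossible = [ (λ U → proj₂ (proj₂ no-prisms) (N , antiprism (λ d →
      uniform-reach uniform₄-α (connected p d) U))) ,
                 (λ U → proj₁ (proj₂ no-prisms) (N , prism (λ d → uniform-reach uniform₃-α (connected p d) U)))
                     ]′ (uniform p)
    where no-prisms = proj₂ (proj₂ (proj₂ (proj₂ pcc)))

theorem13p1 : (n : ℕ) (M : CombMap n) → CombMap.IsPlanarPCC M →
    (d : Fin n) → CombMap.faceSize M d ≤ 41
theorem13p1 n M pcc d = s≤s⁻¹ (≰⇒> λ big → go big (Fin.any? λ e → (42 ≤? face e) ×-dec ¬? (F.InOrbit? d e)))
  where
  open Map M pcc using (face; φ; module F)
  go : 42 ≤ face d → ¬ Dec (∃ λ e → 42 ≤ face e × ¬ InOrbit φ d e)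
  go big (yes (e , big-e , d≁e)) = TwoBig.impossible M pcc d e big big-e d≁e
  go big (no ¬other) = OneBig.no-big M pcc (λ b b′ → F.InOrbit-trans (F.InOrbit-sym (on-d b)) (on-d b′)) d big
    where
    on-d : ∀ {e} → 42 ≤ face e → InOrbit φ d e
    on-d {e} big-e = decidable-stable (F.InOrbit? d e) λ d≁e → ¬other (e , big-e , d≁e)
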